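{- Let $q\ge 6$ be a prime power and let $\bar{\mathcal C}$ be an $\mathbb F_q$-conic of $\mathrm{PG}(2,q^3)$. Then in the Bruck-Bose representation in $\mathrm{PG}(6,q)$, $[\mathcal C]$ is a $k$-dimensional normal rational curve with $k=2$, $3$, $4$ or $6$.
   Context: **$\mathbb F_q$-conics.** An $\mathbb F_q$-subplane of $\mathrm{PG}(2,q^3)$ is a subplane of order $q$; an $\mathbb F_q$-conic is a non-degenerate conic of an $\mathbb F_q$-subplane. **Normal rational curves.** A $k$-dimensional normal rational curve in $\mathrm{PG}(n,q)$ is a set of points lying in a $k$-space and projectively equivalent to $\{(1,\theta,\dots,\theta^k):\theta\in\mathbb F_q\}\cup\{(0,\dots,0,1)\}$. **Regular 2-spread.** $X^q$ is obtained from $X$ by raising coordinates to the $q$-th power. A regular 2-spread $\mathcal S$ of $\Sigma_\infty\cong\mathrm{PG}(5,q)$ is obtained from a line $g$ of $\mathrm{PG}(5,q^3)$ disjoint from $\Sigma_\infty$ such that $g,g^q,g^{q^2}$ span $\mathrm{PG}(5,q^3)$: its elements are the planes $\langle X,X^q,X^{q^2}\rangle\cap\Sigma_\infty$, $X\in g$. **Bruck-Bose representation.** Let $\Sigma_\infty$ be a hyperplane of $\mathrm{PG}(6,q)$ and $\mathcal S$ a regular 2-spread of $\Sigma_\infty$. The incidence structure whose points are the points of $\mathrm{PG}(6,q)\setminus\Sigma_\infty$ (affine points) and the planes of $\mathcal S$; whose lines are the 3-spaces of $\mathrm{PG}(6,q)$ not contained in $\Sigma_\infty$ that contain a plane of $\mathcal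 S$, together with the line at infinity $\ell_\infty$ (the set of planes of $\mathcal S$); with incidence induced by $\mathrm{PG}(6,q)$, is isomorphic to $\mathrm{PG}(2,q^3)$. $[\mathcal C]$ denotes the representation of $\bar{\mathcal C}$ in $\mathrm{PG}(6,q)$. The usual Bruck-Bose convention is used: the representation is not required to be exact at infinity, and linear components contained in $\Sigma_\infty$ (or an extension of it) are ignored. Thus "$[\mathcal C]$ is a $k$-dimensional normal rational curve" means that there is a $k$-dimensional normal rational curve of $\mathrm{PG}(6,q)$ whose affine points are exactly the affine points representing the points of $\bar{\mathcal C}\setminus\ell_\infty$. -}

module Defs where

open import Algebra.Bundles using (CommutativeRing)
open import Algebra.Morphism.Structures using (module RingMorphisms)
open import Algebra.Structures using (IsCommutativeRing)
import Algebra.Properties.Semiring.Exp as Exp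
import Algebra.Properties.Semiring.Sum as Sum
open import Data.Fin.Base using (Fin; toℕ; fromℕ)
open import Data.Nat.Base as ℕ using (ℕ; suc; _≤_)
open import Data.Nat.Primality using (Prime)
open import Data.Product.Base using (Σ; ∃; ∃₂; ∃-syntax; _×_; _,_; proj₁; proj₂)
open import Data.Sum.Base using (_⊎_; inj₁; inj₂)
open import Data.Sum.Relation.Binary.Pointwise using (_⊎ₛ_; inj₁; inj₂)
open import Data.Unit.Base using (⊤; tt)
open import Data.Empty using (⊥)
open import Data.Vec.Functional using (Vector; []; _∷_; replicate; zipWith; updateAt)
open import Function.Base using (const; _∘_)
open import Function.Bundles using (_⇔_; _↔_; mk⇔; Equivalence; Inverse)
open import Level using (0ℓ)
open import Relation.Binary.Bundles using (Setoid)
import Relation.Binary.Construct.On as On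
open import Relation.Binary.PropositionalEquality
  using (_≡_; _≢_; _≗_; refl; sym; trans; cong; module ≡-Reasoning)
import Relation.Binary.PropositionalEquality as ≡
open import Relation.Nullary.Negation.Core using (¬_)
open import Relation.Unary using (Pred)

------------------------------------------------------------------------
-- Fields

record Field : Set₁ where
  infix  8 -_
  infixl 7 _*_
  infixl 6 _+_
  field
    Carrier           : Set
    _+_ _*_           : Carrier → Carrier → Carrier
    -_                : Carrier → Carrier
    0# 1#             : Carrier
    isCommutativeRing : IsCommutativeRing _≡_ _+_ _*_ -_ 0# 1#
    1≢0               : 1# ≢ 0#
    inverse           : ∀ x → x ≢ 0# → ∃[ y ] y * x ≡ 1#

  commutativeRing : CommutativeRing 0ℓ 0ℓ
  commutativeRing = record { isCommutativeRing = isCommutativeRing }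

  open CommutativeRing commutativeRing public
    using (semiring; rawRing; _-_; *-assoc; *-identityˡ; *-comm; zeroʳ)
  open Exp semiring public using (_^_)
  open Sum semiring public using (sum; sum-cong-≗; *-distribˡ-sum)

HasOrder : Field → ℕ → Set
HasOrder F n = Field.Carrier F ↔ Fin n

PrimePower : ℕ → Set
PrimePower q = ∃₂ λ p h → Prime p × 1 ≤ h × q ≡ p ℕ.^ h

record FieldExtension (K L : Field) : Set where
  open RingMorphisms (Field.rawRing K) (Field.rawRing L) using (IsRingHomomorphism)
  field
    embed              : Field.Carrier K → Field.Carrier L
    isRingHomomorphism : IsRingHomomorphism embed

------------------------------------------------------------------------
-- Incidence structures

record IncidenceStructure : Set₁ where
  field
    points lines : Setoid 0ℓ 0ℓ

  open Setoid points public using () renaming (Carrier to Point; _≈_ to _≈ₚ_)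
  open Setoid lines  public using () renaming (Carrier to Line;  _≈_ to _≈ₗ_)

  infix 4 _I_
  field
    _I_    : Point → Line → Set
    I-resp : ∀ {P Q l m} → P ≈ₚ Q → l ≈ₗ m → P I l → Q I m

  PointsOn : Line → Setoid 0ℓ 0ℓ
  PointsOn l = On.setoid {B = Σ Point (_I l)} points proj₁

infix 4 _≅_

record _≅_ (S T : IncidenceStructure) : Set where
  private
    module S = IncidenceStructure S
    module T = IncidenceStructure T
  field
    pointMap : Inverse S.points T.points
    lineMap  : Inverse S.lines T.lines

  onPoints : S.Point → T.Point
  onPoints = Inverse.to pointMap

  onLines : S.Line → T.Line
  onLines = Inverse.to lineMap

  field
    incidence : ∀ P l → (P S.I l) ⇔ (onPoints P T.I onLines l)

record IsProjectivePlane (S : IncidenceStructure) : Set where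
  open IncidenceStructure S
  field
    join : ∀ P Q → ¬ P ≈ₚ Q →
           ∃[ l ] P I l × Q I l × (∀ m → P I m → Q I m → m ≈ₗ l)
    meet : ∀ l m → ¬ l ≈ₗ m →
           ∃[ P ] P I l × P I m × (∀ Q → Q I l → Q I m → Q ≈ₚ P)
    quadrangle : Σ (Vector Point 4) λ A → ∀ (i j k : Fin 4) → i ≢ j → i ≢ k → j ≢ k →
                 ∀ l → A i I l → A j I l → A k I l → ⊥

record IsProjectivePlaneOfOrder (n : ℕ) (S : IncidenceStructure) : Set where
  open IncidenceStructure S
  field
    isProjectivePlane : IsProjectivePlane S
    order             : ∀ l → Inverse (PointsOn l) (≡.setoid (Fin (suc n)))

module _ (S : IncidenceStructure) where
  open IncidenceStructure S

  induced : Pred Point 0ℓ → Pred Line 0ℓ → IncidenceStructure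
  induced A B = record
    { points = On.setoid {B = Σ Point A} points proj₁
    ; lines  = On.setoid {B = Σ Line B} lines proj₁
    ; _I_    = λ P l → proj₁ P I proj₁ l
    ; I-resp = I-resp
    }

  record Subplane (n : ℕ) : Set₁ where
    field
      HasPoint      : Pred Point 0ℓ
      HasLine       : Pred Line 0ℓ
      HasPoint-resp : ∀ {P Q} → P ≈ₚ Q → HasPoint P → HasPoint Q
      HasLine-resp  : ∀ {l m} → l ≈ₗ m → HasLine l → HasLine m

    plane : IncidenceStructure
    plane = induced HasPoint HasLine

    field
      isPlaneOfOrder : IsProjectivePlaneOfOrder n plane

------------------------------------------------------------------------
-- Projective geometry over a field

module Projective (F : Field) where
  open Field F

  Vec : ℕ → Set
  Vec = Vector Carrier

  0ᵛ : ∀ {m} → Vec m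
  0ᵛ = replicate _ 0#

  infixl 6 _+ᵛ_
  infixr 7 _·_

  _+ᵛ_ : ∀ {m} → Vec m → Vec m → Vec m
  _+ᵛ_ = zipWith _+_

  _·_ : ∀ {m} → Carrier → Vec m → Vec m
  (c · v) i = c * v i

  lincomb : ∀ {r m} → Vec r → Vector (Vec m) r → Vec m
  lincomb c b i = sum (λ j → c j * b j i)

  infix 4 _∈⟨_⟩

  _∈⟨_⟩ : ∀ {r m} → Vec m → Vector (Vec m) r → Set
  v ∈⟨ b ⟩ = ∃[ c ] v ≗ lincomb c b

  Independent : ∀ {r m} → Vector (Vec m) r → Set
  Independent b = ∀ c → lincomb c b ≗ 0ᵛ → c ≗ 0ᵛ

  record Point (n : ℕ) : Set where
    field
      coords  : Vec (suc n)
      nonzero : ¬ (coords ≗ 0ᵛ)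

  open Point public

  infix 4 _∼_

  _∼_ : ∀ {n} → Point n → Point n → Set
  P ∼ Q = ∃[ c ] c ≢ 0# × coords P ≗ c · coords Q

  -- An r-space of PG(n,F), where r is the projective dimension.
  record Space (r n : ℕ) : Set where
    field
      basis       : Vector (Vec (suc n)) (suc r)
      independent : Independent basis

  open Space public

  infix 4 _∈_ _≐_

  _∈_ : ∀ {r n} → Vec (suc n) → Space r n → Set
  v ∈ U = v ∈⟨ basis U ⟩

  _≐_ : ∀ {r n} → Space r n → Space r n → Set
  U ≐ V = ∀ v → v ∈ U ⇔ v ∈ V

  record Hyperplane (n : ℕ) : Set where
    field
      form    : Vec (suc n)
      nonzero : ¬ (form ≗ 0ᵛ)

  infix 8 _∙_

  _∙_ : ∀ {m} → Vec m → Vec m → Carrier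
  u ∙ v = sum (λ i → u i * v i)

  ∼-refl : ∀ {n} {P : Point n} → P ∼ P
  ∼-refl = 1# , 1≢0 , λ i → sym (*-identityˡ _)

  inverse≢0 : ∀ {x y} → y * x ≡ 1# → y ≢ 0#
  inverse≢0 {x} yx≡1 refl = 1≢0 (trans (sym yx≡1) (trans (*-comm 0# x) (zeroʳ x)))

  ∼-sym : ∀ {n} {P Q : Point n} → P ∼ Q → Q ∼ P
  ∼-sym {P = P} {Q} (c , c≢0 , P≗cQ) with inverse c c≢0
  ... | d , dc≡1 = d , inverse≢0 dc≡1 , λ i → begin
    coords Q i             ≡⟨ *-identityˡ _ ⟨
    1# * coords Q i        ≡⟨ cong (_* coords Q i) dc≡1 ⟨
    (d * c) * coords Q i   ≡⟨ *-assoc d c _ ⟩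
    d * (c * coords Q i)   ≡⟨ cong (d *_) (P≗cQ i) ⟨
    d * coords P i         ∎
    where open ≡-Reasoning

  ∼-trans : ∀ {n} {P Q R : Point n} → P ∼ Q → Q ∼ R → P ∼ R
  ∼-trans {P = P} {Q} {R} (c , c≢0 , P≗cQ) (d , d≢0 , Q≗dR) = c * d , cd≢0 , λ i → begin
    coords P i             ≡⟨ P≗cQ i ⟩
    c * coords Q i         ≡⟨ cong (c *_) (Q≗dR i) ⟩
    c * (d * coords R i)   ≡⟨ *-assoc c d _ ⟨
    (c * d) * coords R i   ∎
    where
    open ≡-Reasoning
    cd≢0 : c * d ≢ 0#
    cd≢0 cd≡0 with inverse c c≢0
    ... | e , ec≡1 = d≢0 (begin
      d             ≡⟨ *-identityˡ d ⟨
      1# * d        ≡⟨ cong (_* d) ec≡1 ⟨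
      (e * c) * d   ≡⟨ *-assoc e c d ⟩
      e * (c * d)   ≡⟨ cong (e *_) cd≡0 ⟩
      e * 0#        ≡⟨ zeroʳ e ⟩
      0#            ∎)

  ≐-refl : ∀ {r n} {U : Space r n} → U ≐ U
  ≐-refl v = mk⇔ (λ x → x) (λ x → x)

  ≐-sym : ∀ {r n} {U V : Space r n} → U ≐ V → V ≐ U
  ≐-sym U≐V v = mk⇔ (Equivalence.from (U≐V v)) (Equivalence.to (U≐V v))

  ≐-trans : ∀ {r n} {U V W : Space r n} → U ≐ V → V ≐ W → U ≐ W
  ≐-trans U≐V V≐W v = mk⇔ (Equivalence.to (V≐W v) ∘ Equivalence.to (U≐V v))
                          (Equivalence.from (U≐V v) ∘ Equivalence.from (V≐W v))

  pointSetoid : ℕ → Setoid 0ℓ 0ℓ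
  pointSetoid n = record
    { Carrier       = Point n
    ; _≈_           = _∼_
    ; isEquivalence = record
      { refl  = λ {P} → ∼-refl {P = P}
      ; sym   = λ {P Q} → ∼-sym {P = P} {Q}
      ; trans = λ {P Q R} → ∼-trans {P = P} {Q} {R}
      }
    }

  spaceSetoid : ℕ → ℕ → Setoid 0ℓ 0ℓ
  spaceSetoid r n = record
    { Carrier       = Space r n
    ; _≈_           = _≐_
    ; isEquivalence = record
      { refl  = λ {U} → ≐-refl {U = U}
      ; sym   = λ {U V} → ≐-sym {U = U} {V}
      ; trans = λ {U V W} → ≐-trans {U = U} {V} {W}
      }
    }

  ∈-resp-∼ : ∀ {r n} (U : Space r n) {P Q : Point n} →
             P ∼ Q → coords P ∈ U → coords Q ∈ U
  ∈-resp-∼ U {P} {Q} P∼Q (a , P≗) with ∼-sym {P = P} {Q} P∼Q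
  ... | c , _ , Q≗cP = c · a , λ i → begin
    coords Q i                             ≡⟨ Q≗cP i ⟩
    c * coords P i                         ≡⟨ cong (c *_) (P≗ i) ⟩
    c * sum (λ j → a j * basis U j i)      ≡⟨ *-distribˡ-sum c (λ j → a j * basis U j i) ⟩
    sum (λ j → c * (a j * basis U j i))    ≡⟨ sum-cong-≗ (λ j → *-assoc c (a j) (basis U j i)) ⟨
    sum (λ j → (c * a j) * basis U j i)    ∎
    where open ≡-Reasoning

  PG : ℕ → IncidenceStructure
  PG n = record
    { points = pointSetoid n
    ; lines  = spaceSetoid 1 n
    ; _I_    = λ P l → coords P ∈ l
    ; I-resp = λ {P} {Q} {l} {m} P∼Q l≐m P∈l →
        Equivalence.to (l≐m (coords Q)) (∈-resp-∼ l {P} {Q} P∼Q P∈l)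
    }

  -- The form Σᵢⱼ A i j xᵢ xⱼ.  The matrix A is not assumed symmetric, so that
  -- every quadratic form arises, in characteristic 2 as well.
  QuadraticForm : ℕ → Set
  QuadraticForm m = Fin m → Vec m

  eval : ∀ {m} → QuadraticForm m → Vec m → Carrier
  eval A v = sum (λ i → sum (λ j → A i j * (v i * v j)))

  -- No singular point: a vector on which the form vanishes and which is
  -- orthogonal to everything under the polar form
  -- B(v,w) = A(v + w) - A(v) - A(w) is zero.  In characteristic 2 this
  -- allows the polar form itself to be degenerate (the nucleus).
  NonDegenerate : ∀ {m} → QuadraticForm m → Set
  NonDegenerate A = ∀ v → eval A v ≡ 0# →
    (∀ w → eval A (v +ᵛ w) - eval A v - eval A w ≡ 0#) → v ≗ 0ᵛ

  data StandardCurve (k : ℕ) : Vec (suc k) → Set where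
    affine   : ∀ θ → StandardCurve k (λ i → θ ^ toℕ i)
    infinity : StandardCurve k (updateAt 0ᵛ (fromℕ k) (const 1#))

  -- A k-space together with a basis amounts to an injective linear map, hence
  -- a projectivity, from PG(k,F) onto that k-space.
  IsNormalRationalCurve : (k : ℕ) {n : ℕ} → Pred (Point n) 0ℓ → Set
  IsNormalRationalCurve k {n} N = Σ (Space k n) λ U → ∀ P →
    N P ⇔ (∃[ x ] StandardCurve k x × (∃[ c ] c ≢ 0# × coords P ≗ c · lincomb x (basis U)))

------------------------------------------------------------------------
-- F_q-conics in a plane over an extension

module _ (K L : Field) (q : ℕ) where
  private
    module K = Projective K
    module L = Projective L

  -- Conics of a subplane of order q are taken with respect to a
  -- coordinatisation of the subplane by PG(2,K), where |K| = q.
  IsSubplaneConic : Subplane (L.PG 2) q → Pred (L.Point 2) 0ℓ → Set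
  IsSubplaneConic π C =
    Σ (K.PG 2 ≅ Subplane.plane π) λ ψ →
    Σ (K.QuadraticForm 3) λ A →
      K.NonDegenerate A ×
      (∀ X → C X ⇔ (∃[ Y ] K.eval A (K.coords Y) ≡ Field.0# K ×
                           X L.∼ proj₁ (_≅_.onPoints ψ Y)))

  IsFqConic : Pred (L.Point 2) 0ℓ → Set₁
  IsFqConic C = Σ (Subplane (L.PG 2) q) λ π → IsSubplaneConic π C

------------------------------------------------------------------------
-- The Bruck-Bose representation

module BruckBose {K L : Field} (E : FieldExtension K L) (q : ℕ) where
  open FieldExtension E
  private
    module K = Projective K
    module L = Projective L

  conj : ∀ {m} → L.Vec m → L.Vec m
  conj X i = Field._^_ L (X i) q

  embedᵛ : ∀ {m} → K.Vec m → L.Vec m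
  embedᵛ v i = embed (v i)

  module _ (Σ∞ : K.Hyperplane 6) where
    open K.Hyperplane Σ∞ using (form)

    InΣ∞ : K.Vec 7 → Set
    InΣ∞ v = form K.∙ v ≡ Field.0# K

    -- Σ∞ ≅ PG(5,q) extended to PG(5,q³): the same equation over L.
    InΣ∞* : L.Vec 7 → Set
    InΣ∞* X = embedᵛ form L.∙ X ≡ Field.0# L

    record RegularSpread : Set where
      field
        g          : L.Space 1 6
        g⊆Σ∞*      : ∀ X → X L.∈ g → InΣ∞* X
        g-disjoint : ∀ (P : K.Point 6) → InΣ∞ (K.coords P) →
                     ¬ (embedᵛ (K.coords P) L.∈ g)
        g-spans    : ∀ W → InΣ∞* W → ∃[ X ] ∃[ Y ] ∃[ Z ]
                     X L.∈ g × Y L.∈ g × Z L.∈ g ×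
                     W ≗ (X L.+ᵛ conj Y L.+ᵛ conj (conj Z))

      -- The plane ⟨X, X^q, X^(q²)⟩ ∩ Σ∞ for some point X of g.
      IsElement : K.Space 2 6 → Set
      IsElement U = Σ (L.Point 6) λ X → L.coords X L.∈ g ×
        (∀ v → v K.∈ U ⇔
          (InΣ∞ v × embedᵛ v L.∈⟨ L.coords X ∷ conj (L.coords X) ∷ conj (conj (L.coords X)) ∷ [] ⟩))

  module _ {Σ∞ : K.Hyperplane 6} (S : RegularSpread Σ∞) where
    open RegularSpread S

    AffinePoint : Set
    AffinePoint = Σ (K.Point 6) λ P → ¬ InΣ∞ Σ∞ (K.coords P)

    SpreadPlane : Set
    SpreadPlane = Σ (K.Space 2 6) IsElement

    -- 3-spaces not contained in Σ∞ that contain a spread plane.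
    AffineLine : Set
    AffineLine = Σ (K.Space 3 6) λ V →
      ¬ (∀ v → v K.∈ V → InΣ∞ Σ∞ v) ×
      (Σ SpreadPlane λ U → ∀ v → v K.∈ proj₁ U → v K.∈ V)

    affinePoints spreadPlanes affineLines : Setoid 0ℓ 0ℓ
    affinePoints = On.setoid {B = AffinePoint} (K.pointSetoid 6) proj₁
    spreadPlanes = On.setoid {B = SpreadPlane} (K.spaceSetoid 2 6) proj₁
    affineLines  = On.setoid {B = AffineLine} (K.spaceSetoid 3 6) proj₁

    -- inj₂ tt is the line at infinity.
    Incident : AffinePoint ⊎ SpreadPlane → AffineLine ⊎ ⊤ → Set
    Incident (inj₁ P) (inj₁ V)  = K.coords (proj₁ P) K.∈ proj₁ V
    Incident (inj₁ P) (inj₂ tt) = ⊥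
    Incident (inj₂ U) (inj₁ V)  = ∀ v → v K.∈ proj₁ U → v K.∈ proj₁ V
    Incident (inj₂ U) (inj₂ tt) = ⊤

    private
      pts lns : Setoid 0ℓ 0ℓ
      pts = affinePoints ⊎ₛ spreadPlanes
      lns = affineLines ⊎ₛ ≡.setoid ⊤

      Incident-resp : ∀ {P Q l m} → Setoid._≈_ pts P Q → Setoid._≈_ lns l m →
                      Incident P l → Incident Q m
      Incident-resp {l = inj₁ V} (inj₁ {P} {Q} P∼Q) (inj₁ V≐W) P∈V =
        Equivalence.to (V≐W (K.coords (proj₁ Q)))
          (K.∈-resp-∼ (proj₁ V) {proj₁ P} {proj₁ Q} P∼Q P∈V)
      Incident-resp (inj₂ U≐U′) (inj₁ V≐W) U⊆V v v∈U′ =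
        Equivalence.to (V≐W v) (U⊆V v (Equivalence.from (U≐U′ v) v∈U′))
      Incident-resp (inj₁ _) (inj₂ refl) ()
      Incident-resp (inj₂ _) (inj₂ refl) _ = tt

    representation : IncidenceStructure
    representation = record
      { points = pts
      ; lines  = lns
      ; _I_    = Incident
      ; I-resp = λ {P} {Q} {l} {m} → Incident-resp {P} {Q} {l} {m}
      }

    -- The affine points of N are exactly the affine points representing the
    -- points of C off the line at infinity.  An isomorphism sends affine points
    -- precisely to the points off the image of the line at infinity.
    Represents : representation ≅ L.PG 2 → Pred (L.Point 2) 0ℓ → Pred (K.Point 6) 0ℓ → Set
    Represents φ C N = ∀ (P : AffinePoint) → N (proj₁ P) ⇔ C (_≅_.onPoints φ (inj₁ P))

{-# OPTIONS --safe #-}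

-- The extension of Σ∞ is the direct sum of g and its two conjugates, so
-- (k , a , b) ↦ k e + Tr (a g₀ + b g₁), with e a fixed affine vector and g₀, g₁ a basis of g,
-- identifies K × L × L with K⁷, and reading (k , a , b) as homogeneous coordinates turns the
-- Bruck-Bose representation into PG(2,q³). Whatever the isomorphism φ and the subplane are,
-- the conic thereby becomes {(x₀(t) : x₁(t) : x₂(t)) : t ∈ PG(1,q)} with independent binary
-- quadratic forms xᵢ over L: a line-preserving map of PG(2,q) acts on coordinates through a
-- multiplicative map K → L, whose values are fixed by the q-th power map and so lie in K.
-- Multiplying by a form u of least degree for which x₀ u is defined over K gives a curve
-- (x₀ u , x₁ u , x₂ u) of degree k = 2 + deg u in PG(6,q):
--   u = 1                 if x₀ is a multiple of a form over K,
--   u = l^(q²)            if x₀ = l l^q,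
--   u = m^q m^(q²)        if x₀ = l m with only l defined over K,
--   u = x₀^q x₀^(q²)      if x₀ and x₀^q are coprime,
-- and these are all the cases. In each of them the forms y u, y quadratic, span together with
-- their conjugates all forms of degree k. Dually, a K-rational linear dependence between the
-- k + 1 coefficient vectors of the curve vanishes, so it is a normal rational curve.

module Submission where

open import Defs
open import Algebra.Bundles using (CommutativeRing)
open import Algebra.Morphism.Structures using (module RingMorphisms)
import Algebra.Properties.CommutativeMonoid.Sum as CommutativeMonoidSum
import Algebra.Properties.Ring as RingProperties
import Algebra.Properties.Semiring.Exp as Exp
import Algebra.Properties.Semiring.Mult.TCOptimised as Mult
import Algebra.Properties.Semiring.Sum as Sum
import Algebra.Solver.Ring as Solver
open import Algebra.Solver.Ring.AlmostCommutativeRing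
  using (fromCommutativeRing; _-Raw-AlmostCommutative⟶_)
open import Data.Empty using (⊥; ⊥-elim)
open import Data.Fin.Base
  using (Fin; zero; suc; toℕ; fromℕ; inject≤; finToFun; funToFin; punchOut; combine)
open import Data.Fin.Permutation using (Permutation; permutation; _⟨$⟩ʳ_)
import Data.Fin.Properties as Fin
open import Data.Integer.Base as ℤ using (ℤ; -[1+_]) renaming (+_ to pos)
import Data.Integer.Properties as ℤ
open import Data.Maybe.Base using (Maybe; just; nothing)
open import Data.Nat.Base as ℕ using (ℕ; zero; suc; _≤_; _<_; z≤n; s≤s)
import Data.Nat.Properties as ℕ
open import Data.Product.Base using (Σ; ∃; ∃₂; ∃-syntax; _×_; _,_; proj₁; proj₂)
open import Data.Product.Function.NonDependent.Propositional using (_×-↔_)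
open import Data.Product.Properties using (≡-dec)
open import Data.Sum.Base using (_⊎_; inj₁; inj₂)
open import Data.Sum.Relation.Binary.Pointwise using (inj₁; inj₂)
open import Data.Unit.Base using (tt)
open import Data.Vec.Functional using (Vector; []; _∷_; updateAt)
open import Function.Base using (_∘_; id; const)
open import Function.Bundles using (_↔_; _⇔_; mk⇔; Equivalence; Inverse)
open import Function.Construct.Composition using () renaming (inverse to compose)
open import Function.Construct.Symmetry using () renaming (inverse to symmetry)
open import Function.Properties.Inverse using (Inverse⇒Injection)
open import Level using (0ℓ)
open import Relation.Binary.Bundles using (Setoid)
open import Relation.Binary.Definitions using (DecidableEquality)
open import Relation.Binary.PropositionalEquality
  using (_≡_; _≢_; _≗_; refl; sym; trans; cong; cong₂; subst; _→-setoid_; module ≡-Reasoning)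
import Relation.Binary.PropositionalEquality as ≡
open import Relation.Nullary.Decidable using (Dec; yes; no; via-injection)
import Relation.Nullary.Decidable as Dec
open import Relation.Nullary.Negation using (¬_; contradiction)
open import Relation.Unary using (Pred)

-- Fields and counting

-- Homogeneous coordinates of a point are determined up to a factor in `L`, but the vector of an
-- affine point in K⁷ must have its first coordinate in `K` and is determined only up to a factor in
-- `K`. This is why x₀ u has to be defined over `K`; and since u does not vanish at a parameter
-- where x₀ does not, no affine point is lost.
--
-- Independence is treated dually in order to avoid dimension counts for spaces of forms. A sequence
-- c over `K` is a functional on forms of degree k, and multiplication by a form becomes a
-- recurrence on c. A dependence c kills y u for every quadratic y and, being invariant under the
-- q-th power map, kills the conjugates too. Once all multiples of two coprime forms are killed, a
-- small linear system on consecutive entries gives c = 0. Coprimality means a nonzero determinant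
-- or resultant, and the cases are divided accordingly.
--
-- Where ranks would be compared, all spaces are finite, and an injection or a surjection between
-- sets of the same size is used instead.

module FieldFacts (F : Field) where
  open Field F public
  open CommutativeRing commutativeRing public
    using (ring; +-assoc; +-comm; +-identityˡ; +-identityʳ; -‿inverseˡ; -‿inverseʳ;
           *-identityʳ; zeroˡ; distribˡ; distribʳ; *-commutativeMonoid)
  open RingProperties ring public
    using (-‿involutive; -‿+-comm; -‿distribˡ-*; -‿distribʳ-*; -0#≈0#)

  open Mult semiring using (1+×; ×-homo-+; ×1-homo-*) renaming (_×_ to _×′_)

  -- The ring solver cancels terms by computing with their coefficients, which is possible
  -- in ℤ but not in the abstract field.
  fromℤ : ℤ → Carrier
  fromℤ (pos n)    = n ×′ 1#
  fromℤ -[1+ n ] = - (suc n ×′ 1#)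

  fromℤ-neg : ∀ i → fromℤ (ℤ.- i) ≡ - fromℤ i
  fromℤ-neg (pos zero)  = sym -0#≈0#
  fromℤ-neg (pos (suc n)) = refl
  fromℤ-neg -[1+ n ]  = sym (-‿involutive _)

  fromℤ-⊖ : ∀ m n → fromℤ (m ℤ.⊖ n) ≡ m ×′ 1# - n ×′ 1#
  fromℤ-⊖ m zero = trans (cong fromℤ (ℤ.⊖-≥ {m} {0} ℕ.z≤n))
    (trans (sym (+-identityʳ _)) (cong ((m ×′ 1#) +_) (sym -0#≈0#)))
  fromℤ-⊖ zero (suc n) = sym (+-identityˡ _)
  fromℤ-⊖ (suc m) (suc n) = begin
    fromℤ (suc m ℤ.⊖ suc n)              ≡⟨ cong fromℤ (ℤ.[1+m]⊖[1+n]≡m⊖n m n) ⟩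
    fromℤ (m ℤ.⊖ n)                      ≡⟨ fromℤ-⊖ m n ⟩
    m ×′ 1# - n ×′ 1#                    ≡⟨ cancel ⟩
    (1# + m ×′ 1#) - (1# + n ×′ 1#)      ≡⟨ cong₂ _-_ (1+× m 1#) (1+× n 1#) ⟨
    suc m ×′ 1# - suc n ×′ 1#            ∎
    where
    open ≡-Reasoning
    cancel : m ×′ 1# - n ×′ 1# ≡ (1# + m ×′ 1#) - (1# + n ×′ 1#)
    cancel = sym (begin
      (1# + a) + - (1# + b)      ≡⟨ cong ((1# + a) +_) (-‿+-comm 1# b) ⟨
      (1# + a) + (- 1# + - b)    ≡⟨ cong (_+ (- 1# + - b)) (+-comm 1# a) ⟩
      (a + 1#) + (- 1# + - b)    ≡⟨ +-assoc a 1# _ ⟩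
      a + (1# + (- 1# + - b))    ≡⟨ cong (a +_) (+-assoc 1# (- 1#) (- b)) ⟨
      a + ((1# + - 1#) + - b)    ≡⟨ cong (λ z → a + (z + - b)) (-‿inverseʳ 1#) ⟩
      a + (0# + - b)             ≡⟨ cong (a +_) (+-identityˡ _) ⟩
      a + - b                    ∎)
      where
      a = m ×′ 1#
      b = n ×′ 1#

  fromℤ-+ : ∀ i j → fromℤ (i ℤ.+ j) ≡ fromℤ i + fromℤ j
  fromℤ-+ (pos m)    (pos n)    = ×-homo-+ 1# m n
  fromℤ-+ (pos m)    -[1+ n ] = fromℤ-⊖ m (suc n)
  fromℤ-+ -[1+ m ] (pos n)    = trans (fromℤ-⊖ n (suc m)) (+-comm _ _)
  fromℤ-+ -[1+ m ] -[1+ n ] = begin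
    - (suc (suc (m ℕ.+ n)) ×′ 1#)         ≡⟨ cong (λ k → - (suc k ×′ 1#)) (ℕ.+-suc m n) ⟨
    - ((suc m ℕ.+ suc n) ×′ 1#)           ≡⟨ cong -_ (×-homo-+ 1# (suc m) (suc n)) ⟩
    - (suc m ×′ 1# + suc n ×′ 1#)         ≡⟨ -‿+-comm _ _ ⟨
    - (suc m ×′ 1#) + - (suc n ×′ 1#)     ∎
    where
    open ≡-Reasoning

  fromℤ-*-pos : ∀ m i → fromℤ (pos m ℤ.* i) ≡ m ×′ 1# * fromℤ i
  fromℤ-*-pos m (pos n) = trans (cong fromℤ (sym (ℤ.pos-* m n))) (×1-homo-* m n)
  fromℤ-*-pos m -[1+ n ] = begin
    fromℤ (pos m ℤ.* (ℤ.- (pos (suc n))))     ≡⟨ cong fromℤ (ℤ.neg-distribʳ-* (pos m) (pos (suc n))) ⟨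
    fromℤ (ℤ.- (pos m ℤ.* pos (suc n)))       ≡⟨ fromℤ-neg (pos m ℤ.* pos (suc n)) ⟩
    - fromℤ (pos m ℤ.* pos (suc n))           ≡⟨ cong -_ (fromℤ-*-pos m (pos (suc n))) ⟩
    - (m ×′ 1# * suc n ×′ 1#)           ≡⟨ -‿distribʳ-* _ _ ⟩
    m ×′ 1# * - (suc n ×′ 1#)           ∎
    where open ≡-Reasoning

  fromℤ-* : ∀ i j → fromℤ (i ℤ.* j) ≡ fromℤ i * fromℤ j
  fromℤ-* (pos m) j = fromℤ-*-pos m j
  fromℤ-* -[1+ m ] j = begin
    fromℤ ((ℤ.- (pos (suc m))) ℤ.* j)     ≡⟨ cong fromℤ (ℤ.neg-distribˡ-* (pos (suc m)) j) ⟨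
    fromℤ (ℤ.- (pos (suc m) ℤ.* j))       ≡⟨ fromℤ-neg (pos (suc m) ℤ.* j) ⟩
    - fromℤ (pos (suc m) ℤ.* j)           ≡⟨ cong -_ (fromℤ-*-pos (suc m) j) ⟩
    - (suc m ×′ 1# * fromℤ j)         ≡⟨ -‿distribˡ-* _ _ ⟩
    - (suc m ×′ 1#) * fromℤ j         ∎
    where open ≡-Reasoning

  fromℤ-morphism : CommutativeRing.rawRing ℤ.+-*-commutativeRing
                     -Raw-AlmostCommutative⟶ fromCommutativeRing commutativeRing
  fromℤ-morphism = record
    { ⟦_⟧    = fromℤ
    ; +-homo = fromℤ-+
    ; *-homo = fromℤ-*
    ; -‿homo = fromℤ-neg
    ; 0-homo = refl
    ; 1-homo = refl
    }

  fromℤ-≟ : ∀ i j → Maybe (fromℤ i ≡ fromℤ j)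
  fromℤ-≟ i j with i ℤ.≟ j
  ... | yes i≡j = just (cong fromℤ i≡j)
  ... | no  _   = nothing

  open Solver _ (fromCommutativeRing commutativeRing) fromℤ-morphism fromℤ-≟ public
    using (solve; _:=_; _:+_; _:*_; _:-_; :-_; con; Polynomial)

  :0 :1 : ∀ {n} → Polynomial n
  :0 = con (pos 0)
  :1 = con (pos 1)

  x-y≡0⇒x≡y : ∀ {x y} → x - y ≡ 0# → x ≡ y
  x-y≡0⇒x≡y {x} {y} x-y≡0 = begin
    x            ≡⟨ solve 2 (λ x y → x := x :- y :+ y) refl x y ⟩
    x - y + y    ≡⟨ cong (_+ y) x-y≡0 ⟩
    0# + y       ≡⟨ +-identityˡ y ⟩
    y            ∎
    where open ≡-Reasoning

  x≡y⇒x-y≡0 : ∀ {x y} → x ≡ y → x - y ≡ 0#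
  x≡y⇒x-y≡0 {x} refl = -‿inverseʳ x

  *-cancelˡ-0 : ∀ {x y} → x ≢ 0# → x * y ≡ 0# → y ≡ 0#
  *-cancelˡ-0 {x} {y} x≢0 xy≡0 = let z , zx≡1 = inverse x x≢0 in begin
    y            ≡⟨ *-identityˡ y ⟨
    1# * y       ≡⟨ cong (_* y) zx≡1 ⟨
    z * x * y    ≡⟨ *-assoc z x y ⟩
    z * (x * y)  ≡⟨ cong (z *_) xy≡0 ⟩
    z * 0#       ≡⟨ zeroʳ z ⟩
    0#           ∎
    where open ≡-Reasoning

  *-cancelʳ-0 : ∀ {x y} → y ≢ 0# → x * y ≡ 0# → x ≡ 0#
  *-cancelʳ-0 {x} {y} y≢0 xy≡0 = *-cancelˡ-0 y≢0 (trans (*-comm y x) xy≡0)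

  *-≢0 : ∀ {x y} → x ≢ 0# → y ≢ 0# → x * y ≢ 0#
  *-≢0 x≢0 y≢0 xy≡0 = y≢0 (*-cancelˡ-0 x≢0 xy≡0)

  *-cancelˡ : ∀ {x y z} → x ≢ 0# → x * y ≡ x * z → y ≡ z
  *-cancelˡ {x} {y} {z} x≢0 xy≡xz = x-y≡0⇒x≡y (*-cancelˡ-0 x≢0 (begin
    x * (y - z)      ≡⟨ solve 3 (λ x y z → x :* (y :- z) := x :* y :- x :* z) refl x y z ⟩
    x * y - x * z    ≡⟨ x≡y⇒x-y≡0 xy≡xz ⟩
    0#               ∎))
    where open ≡-Reasoning

injective⇒surjective : ∀ {n} (f : Fin n → Fin n) → (∀ {i j} → f i ≡ f j → i ≡ j) →
                       ∀ k → ∃[ i ] f i ≡ k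
injective⇒surjective {zero}  f inj ()
injective⇒surjective {suc n} f inj k with Fin.any? (λ i → f i Fin.≟ k)
... | yes hit = hit
... | no miss = contradiction
  (Fin.injective⇒≤ {f = λ i → punchOut (k≢f i)}
     (λ {i} {j} eq → inj (Fin.punchOut-injective (k≢f i) (k≢f j) eq)))
  ℕ.1+n≰n
  where
  k≢f : ∀ i → k ≢ f i
  k≢f i k≡fi = miss (i , sym k≡fi)

Counted : Setoid 0ℓ 0ℓ → ℕ → Set
Counted A n = Inverse A (≡.setoid (Fin n))

module _ {A B : Setoid 0ℓ 0ℓ} {n : ℕ} (countA : Counted A n) (countB : Counted B n) where
  private
    module A = Setoid A
    module B = Setoid B
    module CA = Inverse countA
    module CB = Inverse countB

  -- The section `g` is injective, so by counting it reaches every element up to `≈`, and on its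
  -- image `f` is inverse to it. As `g` is not assumed to respect `≈`, it is applied only to the
  -- fixed representatives `CB.from i`.
  section⇒injective : (f : A.Carrier → B.Carrier) → (∀ {x y} → x A.≈ y → f x B.≈ f y) →
                      (g : B.Carrier → A.Carrier) → (∀ y → f (g y) B.≈ y) →
                      ∀ {x y} → f x B.≈ f y → x A.≈ y
  section⇒injective f f-cong g fg≈id {x} {y} fx≈fy with hit x | hit y
    where
    h : Fin n → Fin n
    h i = CA.to (g (CB.from i))

    g-from : ∀ {i z} → h i ≡ CA.to z → g (CB.from i) A.≈ z
    g-from {i} {z} eq = A.trans (A.sym (CA.inverseʳ (sym eq))) (CA.inverseʳ refl)

    h-injective : ∀ {i j} → h i ≡ h j → i ≡ j
    h-injective {i} {j} hi≡hj = trans (sym (CB.inverseˡ B.refl)) (CB.inverseˡ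
      (B.trans (B.sym (fg≈id _)) (B.trans (f-cong (g-from hi≡hj)) (fg≈id _))))

    hit : ∀ z → ∃[ i ] g (CB.from i) A.≈ z
    hit z = let i , eq = injective⇒surjective h h-injective (CA.to z) in i , g-from eq
  ... | i , gi≈x | j , gj≈y = A.trans (A.sym gi≈x) (A.trans (A.reflexive (cong (g ∘ CB.from) i≡j)) gj≈y)
    where
    i≡j : i ≡ j
    i≡j = trans (sym (CB.inverseˡ B.refl)) (CB.inverseˡ
      (B.trans (B.sym (fg≈id _)) (B.trans (f-cong gi≈x)
        (B.trans fx≈fy (B.trans (f-cong (A.sym gj≈y)) (fg≈id _))))))

  -- This takes the place of rank arguments: an injective linear map between spaces with equally
  -- many vectors is onto.
  injection⇒surjection : (f : A.Carrier → B.Carrier) → (∀ {x y} → x A.≈ y → f x B.≈ f y) →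
                         (∀ {x y} → f x B.≈ f y → x A.≈ y) → ∀ y → ∃[ x ] f x B.≈ y
  injection⇒surjection f f-cong f-inj y =
    let i , eq = injective⇒surjective (λ i → CB.to (f (CA.from i))) inj (CB.to y)
    in CA.from i , B.trans (B.sym (CB.inverseʳ (sym eq))) (CB.inverseʳ refl)
    where
    inj : ∀ {i j} → CB.to (f (CA.from i)) ≡ CB.to (f (CA.from j)) → i ≡ j
    inj eq = trans (sym (CA.inverseˡ A.refl)) (CA.inverseˡ (f-inj
      (B.trans (B.sym (CB.inverseʳ refl)) (CB.inverseʳ eq))))

finite-any? : ∀ {a p n} {A : Set a} {P : A → Set p} → A ↔ Fin n → (∀ x → Dec (P x)) → Dec (∃ P)
finite-any? {P = P} order P? = Dec.map′
  (λ (i , p) → Inverse.from order i , p)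
  (λ (x , p) → Inverse.to order x , subst P (sym (Inverse.strictlyInverseʳ order x)) p)
  (Fin.any? (λ i → P? (Inverse.from order i)))

module FiniteField (F : Field) {n : ℕ} (order : HasOrder F n) where
  open FieldFacts F
  open Projective F using (Vec)

  infix 4 _≟_

  opaque
    _≟_ : DecidableEquality Carrier
    _≟_ = via-injection (Inverse⇒Injection order) Fin._≟_

  search : ∀ {p} {P : Carrier → Set p} → (∀ x → Dec (P x)) → Dec (∃ P)
  search = finite-any? order

  countVec : ∀ m → Counted (Fin m →-setoid Carrier) (n ℕ.^ m)
  countVec m = record
    { to        = λ v → funToFin (λ i → Inverse.to order (v i))
    ; from      = λ k i → Inverse.from order (finToFun k i)
    ; to-cong   = λ v≗w → funToFin-cong (λ i → cong (Inverse.to order) (v≗w i))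
    ; from-cong = λ { refl i → refl }
    ; inverse   =
        (λ {k} {v} v≗ → trans
          (funToFin-cong (λ i → trans (cong (Inverse.to order) (v≗ i)) (Inverse.strictlyInverseˡ order _)))
          (Fin.funToFin-finToFin {m} {n} k)) ,
        λ { {v} refl i → trans (cong (Inverse.from order) (Fin.finToFun-funToFin _ i))
                               (Inverse.strictlyInverseʳ order (v i)) }
    }
    where
    funToFin-cong : ∀ {m} {f g : Fin m → Fin n} → f ≗ g → funToFin f ≡ funToFin g
    funToFin-cong {zero}  f≗g = refl
    funToFin-cong {suc m} f≗g = cong₂ combine (f≗g zero) (funToFin-cong (f≗g ∘ suc))

Counted-≡ : ∀ {A m n} → m ≡ n → Counted A m → Counted A n
Counted-≡ refl c = c

-- Polynomial functions and the Frobenius automorphism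

module Polynomials (F : Field) where
  open FieldFacts F

  -- f is a polynomial function of degree at most n whose coefficient at degree n is a.
  Poly : Carrier → ℕ → (Carrier → Carrier) → Set
  Poly a zero    f = ∀ x → f x ≡ a
  Poly a (suc n) f = ∃[ g ] ∃[ c ] Poly a n g × (∀ x → f x ≡ x * g x + c)

  Poly-cong : ∀ n {a b f g} → a ≡ b → f ≗ g → Poly a n f → Poly b n g
  Poly-cong zero    refl f≗g f-a = λ x → trans (sym (f≗g x)) (f-a x)
  Poly-cong (suc n) refl f≗g (h , c , h-poly , eq) = h , c , h-poly , λ x → trans (sym (f≗g x)) (eq x)

  Poly-raise : ∀ n {a f} → Poly a n f → Poly 0# (suc n) f
  Poly-raise zero {a} f-a = (λ _ → 0#) , a , (λ _ → refl) , λ x → trans (f-a x)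
    (solve 2 (λ x a → a := x :* :0 :+ a) refl x a)
  Poly-raise (suc n) (g , c , g-poly , eq) = g , c , Poly-raise n g-poly , eq

  Poly-raise< : ∀ {m n a f} → Poly a m f → suc m ℕ.≤′ n → Poly 0# n f
  Poly-raise< {m} p ℕ.≤′-refl         = Poly-raise m p
  Poly-raise<     p (ℕ.≤′-step {n} m<n) = Poly-raise n (Poly-raise< p m<n)

  Poly-lower : ∀ n {f} → Poly 0# (suc n) f → ∃[ b ] Poly b n f
  Poly-lower zero (g , c , g≗0 , eq) = c , λ x → trans (eq x)
    (trans (cong (λ z → x * z + c) (g≗0 x)) (solve 2 (λ x c → x :* :0 :+ c := c) refl x c))
  Poly-lower (suc n) (g , c , g-poly , eq) = let b , g-poly′ = Poly-lower n g-poly in b , g , c , g-poly′ , eq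

  Poly-+ : ∀ n {a b f g} → Poly a n f → Poly b n g → Poly (a + b) n (λ x → f x + g x)
  Poly-+ zero    f-a g-b = λ x → cong₂ _+_ (f-a x) (g-b x)
  Poly-+ (suc n) (f , c , f-poly , f-eq) (g , d , g-poly , g-eq) =
    _ , c + d , Poly-+ n f-poly g-poly , λ x → trans (cong₂ _+_ (f-eq x) (g-eq x))
      (solve 5 (λ x f g c d → x :* f :+ c :+ (x :* g :+ d) := x :* (f :+ g) :+ (c :+ d)) refl x (f x) (g x) c d)

  Poly-scale : ∀ n {a f} b → Poly a n f → Poly (b * a) n (λ x → b * f x)
  Poly-scale zero    b f-a = λ x → cong (b *_) (f-a x)
  Poly-scale (suc n) b (g , c , g-poly , eq) =
    _ , b * c , Poly-scale n b g-poly , λ x → trans (cong (b *_) (eq x))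
      (solve 4 (λ b x g c → b :* (x :* g :+ c) := x :* (b :* g) :+ b :* c) refl b x (g x) c)

  Poly-x* : ∀ n {a f} → Poly a n f → Poly a (suc n) (λ x → x * f x)
  Poly-x* n p = _ , 0# , p , λ x → sym (+-identityʳ _)

  Poly-^ : ∀ n → Poly 1# n (_^ n)
  Poly-^ zero    = λ _ → refl
  Poly-^ (suc n) = Poly-x* n (Poly-^ n)

  Poly-[+]^ : ∀ n y → Poly 1# n (λ x → (x + y) ^ n)
  Poly-[+]^ zero    y = λ _ → refl
  Poly-[+]^ (suc n) y = Poly-cong (suc n) (+-identityʳ 1#) (λ x → sym (distribʳ _ x y))
    (Poly-+ (suc n) (Poly-x* n (Poly-[+]^ n y)) (Poly-raise n (Poly-scale n y (Poly-[+]^ n y))))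

  Poly-factor : ∀ n {a f} → Poly a (suc n) f → ∀ r →
                ∃[ h ] Poly a n h × (∀ x → f x ≡ f r + (x - r) * h x)
  Poly-factor zero {a} {f} (g , c , g-a , eq) r = (λ _ → a) , (λ _ → refl) , λ x → begin
    f x                          ≡⟨ eq′ x ⟩
    x * a + c                    ≡⟨ solve 4 (λ x a c r → x :* a :+ c := r :* a :+ c :+ (x :- r) :* a)
        refl x a c r ⟩
    r * a + c + (x - r) * a      ≡⟨ cong (_+ (x - r) * a) (eq′ r) ⟨
    f r + (x - r) * a            ∎
    where
    open ≡-Reasoning
    eq′ : ∀ x → f x ≡ x * a + c
    eq′ x = trans (eq x) (cong (λ z → x * z + c) (g-a x))
  Poly-factor (suc n) {a} {f} (g , c , g-poly , eq) r with Poly-factor n g-poly r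
  ... | h , h-poly , g-eq = _ , (h , g r , h-poly , λ _ → refl) , λ x → begin
    f x                                        ≡⟨ eq x ⟩
    x * g x + c                                ≡⟨ cong (λ z → x * z + c) (g-eq x) ⟩
    x * (g r + (x - r) * h x) + c              ≡⟨ solve 5 (λ x r g h c →
      x :* (g :+ (x :- r) :* h) :+ c := r :* g :+ c :+ (x :- r) :* (x :* h :+ g)) refl x r (g r) (h x) c ⟩
    r * g r + c + (x - r) * (x * h x + g r)    ≡⟨ cong (_+ (x - r) * (x * h x + g r)) (eq r) ⟨
    f r + (x - r) * (x * h x + g r)            ∎
    where open ≡-Reasoning

  -- Both conclusions are used: the first bounds the number of roots of a monic polynomial, the
  -- second makes a function with too many zeros vanish. The coefficient `a` is carried along in
  -- `Poly` because a function on a finite field does not determine its degree.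
  Poly-roots : ∀ n {a f} → Poly a n f → (r : Fin (suc n) → Carrier) →
               (∀ {i j} → r i ≡ r j → i ≡ j) → (∀ i → f (r i) ≡ 0#) → a ≡ 0# × (∀ x → f x ≡ 0#)
  Poly-roots zero f-a r _ root = a≡0 , λ x → trans (f-a x) a≡0
    where a≡0 = trans (sym (f-a (r zero))) (root zero)
  Poly-roots (suc n) {a} {f} f-poly r r-inj root with Poly-factor n f-poly (r zero)
  ... | h , h-poly , eq = let a≡0 , h≗0 = Poly-roots n h-poly (r ∘ suc) (Fin.suc-injective ∘ r-inj) h-root in
    a≡0 , λ x → begin
      f x                               ≡⟨ eq x ⟩
      f (r zero) + (x - r zero) * h x   ≡⟨ cong₂ (λ u v → u + (x - r zero) * v) (root zero) (h≗0 x) ⟩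
      0# + (x - r zero) * 0#            ≡⟨ trans (+-identityˡ _) (zeroʳ _) ⟩
      0#                                ∎
    where
    open ≡-Reasoning
    h-root : ∀ i → h (r (suc i)) ≡ 0#
    h-root i = *-cancelˡ-0 (λ eq₀ → Fin.0≢1+n (sym (r-inj (x-y≡0⇒x≡y eq₀)))) (begin
      (x - r zero) * h x                ≡⟨ +-identityˡ _ ⟨
      0# + (x - r zero) * h x           ≡⟨ cong (_+ (x - r zero) * h x) (root zero) ⟨
      f (r zero) + (x - r zero) * h x   ≡⟨ eq x ⟨
      f x                               ≡⟨ root (suc i) ⟩
      0#                                ∎)
      where x = r (suc i)

module Fermat (F : Field) {n : ℕ} (order : HasOrder F n) where
  open FieldFacts F
  open FiniteField F order
  open Inverse order using (to; from; strictlyInverseˡ; strictlyInverseʳ)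
  open CommutativeMonoidSum *-commutativeMonoid
    using () renaming (sum to product; sum-cong-≗ to product-cong; sum-permute to product-permute;
      ∑-distrib-+ to product-*; sum-replicate to product-replicate; sum-replicate-zero to product-replicate-1)

  product-single : ∀ {m} (f : Vector Carrier m) k {x} → f k ≡ x → (∀ i → i ≢ k → f i ≡ 1#) → product f ≡ x
  product-single {suc m} f zero    fk≡x f≡1 = trans
    (cong₂ _*_ fk≡x (trans (product-cong (λ i → f≡1 (suc i) λ ())) (product-replicate-1 m)))
    (*-identityʳ _)
  product-single {suc m} f (suc k) fk≡x f≡1 = trans
    (cong₂ _*_ (f≡1 zero λ ()) (product-single (f ∘ suc) k fk≡x
        (λ i i≢k → f≡1 (suc i) (i≢k ∘ Fin.suc-injective))))
    (*-identityˡ _)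

  product≢0 : ∀ {m} (f : Vector Carrier m) → (∀ i → f i ≢ 0#) → product f ≢ 0#
  product≢0 {zero}  f f≢0 = 1≢0
  product≢0 {suc m} f f≢0 = *-≢0 (f≢0 zero) (product≢0 (f ∘ suc) (f≢0 ∘ suc))

  if0 : ∀ {x : Carrier} → Carrier → Carrier → Dec (x ≡ 0#) → Carrier
  if0 a b (yes _) = a
  if0 a b (no  _) = b

  -- The element of `Fin m` serves as the proof that `m` is positive.
  0^m≡0 : ∀ {m} → Fin m → 0# ^ m ≡ 0#
  0^m≡0 {suc m} _ = zeroˡ _

  -- Multiplication by x permutes the nonzero elements, so their product P satisfies P = xⁿ⁻¹ P.
  -- Zero is kept in the index set: it contributes 1 to P, and x to the exceptional factor.
  x^n≡x : ∀ x → x ^ n ≡ x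
  x^n≡x x with x ≟ 0#
  ... | yes refl = 0^m≡0 (to 0#)
  ... | no  x≢0  = begin
    x ^ n                                    ≡⟨ product-replicate n ⟨
    product {n} (λ _ → x)                    ≡⟨ product-cong (λ i → split (from i)) ⟨
    product (λ i → u (from i) * e (from i))  ≡⟨ product-* (u ∘ from) (e ∘ from) ⟩
    product (u ∘ from) * product (e ∘ from)  ≡⟨ cong₂ _*_ product-u product-e ⟩
    1# * x                                   ≡⟨ *-identityˡ x ⟩
    x                                        ∎
    where
    open ≡-Reasoning
    y = proj₁ (inverse x x≢0)
    yx≡1 = proj₂ (inverse x x≢0)

    nz u e : Carrier → Carrier
    nz z = if0 1# z (z ≟ 0#)
    u  z = if0 1# x (z ≟ 0#)
    e  z = if0 x 1# (z ≟ 0#)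

    split : ∀ z → u z * e z ≡ x
    split z with z ≟ 0#
    ... | yes _ = *-identityˡ x
    ... | no  _ = *-identityʳ x

    y*x* : ∀ z → y * (x * z) ≡ z
    y*x* z = trans (sym (*-assoc y x z)) (trans (cong (_* z) yx≡1) (*-identityˡ z))

    x*y* : ∀ z → x * (y * z) ≡ z
    x*y* z = trans (sym (*-assoc x y z)) (trans (cong (_* z) (trans (*-comm x y) yx≡1)) (*-identityˡ z))

    π : Permutation n n
    π = permutation (λ i → to (x * from i)) (λ i → to (y * from i))
      (λ i → trans (cong (λ z → to (x * z)) (strictlyInverseʳ _)) (trans
          (cong to (x*y* _)) (strictlyInverseˡ i)))
      (λ i → trans (cong (λ z → to (y * z)) (strictlyInverseʳ _)) (trans
          (cong to (y*x* _)) (strictlyInverseˡ i)))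

    nz-x* : ∀ z → nz (x * z) ≡ u z * nz z
    nz-x* z with z ≟ 0# | x * z ≟ 0#
    ... | yes _    | yes _    = sym (*-identityˡ 1#)
    ... | yes refl | no xz≢0  = contradiction (zeroʳ x) xz≢0
    ... | no z≢0   | yes xz≡0 = contradiction (*-cancelˡ-0 x≢0 xz≡0) z≢0
    ... | no _     | no _     = refl

    nz≢0 : ∀ z → nz z ≢ 0#
    nz≢0 z with z ≟ 0#
    ... | yes _  = 1≢0
    ... | no z≢0 = z≢0

    product-u : product (u ∘ from) ≡ 1#
    product-u = *-cancelˡ (product≢0 (nz ∘ from) (nz≢0 ∘ from)) (begin
      product (nz ∘ from) * product (u ∘ from)      ≡⟨ *-comm _ _ ⟩
      product (u ∘ from) * product (nz ∘ from)      ≡⟨ product-* (u ∘ from) (nz ∘ from) ⟨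
      product (λ i → u (from i) * nz (from i))      ≡⟨ product-cong (λ i → nz-x* (from i)) ⟨
      product (λ i → nz (x * from i))               ≡⟨ product-cong
          (λ i → cong nz (strictlyInverseʳ (x * from i))) ⟨
      product (λ i → nz (from (π ⟨$⟩ʳ i)))          ≡⟨ product-permute (nz ∘ from) π ⟨
      product (nz ∘ from)                           ≡⟨ *-identityʳ _ ⟨
      product (nz ∘ from) * 1#                      ∎)

    product-e : product (e ∘ from) ≡ x
    product-e = product-single (e ∘ from) (to 0#) e0 e≢0
      where
      e0 : e (from (to 0#)) ≡ x
      e0 with from (to 0#) ≟ 0#
      ... | yes _ = refl
      ... | no ≢0 = contradiction (strictlyInverseʳ 0#) ≢0
      e≢0 : ∀ i → i ≢ to 0# → e (from i) ≡ 1#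
      e≢0 i i≢ with from i ≟ 0#
      ... | yes eq = contradiction (trans (sym (strictlyInverseˡ i)) (cong to eq)) i≢
      ... | no _ = refl

module Frobenius {K L : Field} {q : ℕ} (6≤q : 6 ≤ q) (K-order : HasOrder K q) (L-order : HasOrder L (q ℕ.^ 3))
                 (E : FieldExtension K L) where
  private
    module K where
      open FieldFacts K public
      open FiniteField K K-order public
  open FieldFacts L
  open FiniteField L L-order
  open Polynomials L
  open Exp semiring using (^-assocʳ)
  open FieldExtension E
  open RingMorphisms.IsRingHomomorphism isRingHomomorphism public using ()
    renaming (+-homo to embed-+; *-homo to embed-*; 0#-homo to embed-0; 1#-homo to embed-1; -‿homo to embed-neg)

  private
    1<q : 1 < q
    1<q = ℕ.≤-trans (s≤s (s≤s z≤n)) 6≤q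

    q<q² : q < q ℕ.* q
    q<q² = ℕ.m<m*n q q {{ℕ.>-nonZero (ℕ.<-trans (s≤s z≤n) 1<q)}} 1<q

    q²<q³ : q ℕ.* q < q ℕ.^ 3
    q²<q³ = subst (_< q ℕ.^ 3) (cong (q ℕ.*_) (ℕ.*-identityʳ q)) (ℕ.^-monoʳ-< q 1<q (ℕ.≤-refl {3}))

  embed-injective : ∀ {x y} → embed x ≡ embed y → x ≡ y
  embed-injective {x} {y} eq with x K.- y K.≟ K.0#
  ... | yes x-y≡0 = K.x-y≡0⇒x≡y x-y≡0
  ... | no  x-y≢0 = let z , z*≡1 = K.inverse _ x-y≢0 in contradiction (begin
    1#                              ≡⟨ embed-1 ⟨
    embed K.1#                      ≡⟨ cong embed z*≡1 ⟨
    embed (z K.* (x K.- y))         ≡⟨ embed-* _ _ ⟩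
    embed z * embed (x K.- y)       ≡⟨ cong (embed z *_) (trans (embed-+ _ _)
        (cong (embed x +_) (embed-neg y))) ⟩
    embed z * (embed x - embed y)   ≡⟨ cong (embed z *_) (x≡y⇒x-y≡0 eq) ⟩
    embed z * 0#                    ≡⟨ zeroʳ _ ⟩
    0#                              ∎) 1≢0
    where open ≡-Reasoning

  embed-≢0 : ∀ {x} → x ≢ K.0# → embed x ≢ 0#
  embed-≢0 x≢0 eq = x≢0 (embed-injective (trans eq (sym embed-0)))

  embed-^ : ∀ x n → embed (x K.^ n) ≡ embed x ^ n
  embed-^ x zero    = embed-1
  embed-^ x (suc n) = trans (embed-* _ _) (cong (embed x *_) (embed-^ x n))

  frob : Carrier → Carrier
  frob x = x ^ q

  frob-embed : ∀ x → frob (embed x) ≡ embed x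
  frob-embed x = trans (sym (embed-^ x q)) (cong embed (Fermat.x^n≡x K K-order x))

  frob-* : ∀ x y → frob (x * y) ≡ frob x * frob y
  frob-* x y = go q
    where
    go : ∀ n → (x * y) ^ n ≡ x ^ n * y ^ n
    go zero    = sym (*-identityˡ 1#)
    go (suc n) = trans (cong (x * y *_) (go n))
      (solve 4 (λ x y a b → x :* y :* (a :* b) := x :* a :* (y :* b)) refl x y (x ^ n) (y ^ n))

  -- For fixed y the difference has degree less than q in x, so it vanishes identically
  -- once it vanishes on K; this is used first for y in K and then for arbitrary y.
  frob-+ : ∀ x y → frob (x + y) ≡ frob x + frob y
  frob-+ x y = x-y≡0⇒x≡y (trans (solve 3 (λ a b c → a :- (b :+ c) := a :- b :- c) refl _ _ _)
    (vanish y (λ a → trans (swap (embed a) y) (vanish (embed a) (embedded a) y)) x))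
    where
    δ : Carrier → Carrier → Carrier
    δ x y = frob (x + y) - frob x - frob y

    swap : ∀ x y → δ x y ≡ δ y x
    swap x y = trans (cong (λ z → frob z - frob x - frob y) (+-comm x y))
      (solve 3 (λ a b c → a :- b :- c := a :- c :- b) refl _ _ _)

    embedded : ∀ a b → δ (embed b) (embed a) ≡ 0#
    embedded a b = begin
      δ (embed b) (embed a)
        ≡⟨ cong (λ z → frob z - frob (embed b) - frob (embed a)) (embed-+ b a) ⟨
      frob (embed (b K.+ a)) - frob (embed b) - frob (embed a)
        ≡⟨ cong₂ _-_ (cong₂ _-_ (frob-embed _) (frob-embed b)) (frob-embed a) ⟩
      embed (b K.+ a) - embed b - embed a
        ≡⟨ cong (λ z → z - embed b - embed a) (embed-+ b a) ⟩
      embed b + embed a - embed b - embed a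
        ≡⟨ solve 2 (λ a b → b :+ a :- b :- a := :0) refl (embed a) (embed b) ⟩
      0# ∎
      where open ≡-Reasoning

    δ-poly : ∀ y → Poly 0# q (λ x → δ x y)
    -- The leading coefficients 1 of `(x + y) ^ q` and -1 of the negated `x ^ q` cancel, and
    -- `frob y` is constant in x.
    δ-poly y = Poly-cong q (solve 0 (:1 :+ :- :1 :* :1 :+ :0 := :0) refl)
      (λ x → cong (λ z → frob (x + y) + z - frob y)
        (solve 1 (λ a → :- :1 :* a := :- a) refl (frob x)))
      (Poly-+ q (Poly-+ q (Poly-[+]^ q y) (Poly-scale q (- 1#) (Poly-^ q)))
        (Poly-raise< {0} (λ _ → refl) (ℕ.<⇒<′ (ℕ.<-trans (s≤s z≤n) 1<q))))

    vanish : ∀ y → (∀ a → δ (embed a) y ≡ 0#) → ∀ x → δ x y ≡ 0#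
    -- Dropping the zero leading term lowers the degree to q - 1, so the q elements of `K` are one
    -- root too many.
    vanish y root = go (suc-pred′ q 1<q) (δ-poly y) (embed ∘ Inverse.from K-order)
        (λ eq → trans (sym (Inverse.strictlyInverseˡ K-order _))
          (trans (cong (Inverse.to K-order) (embed-injective eq)) (Inverse.strictlyInverseˡ K-order _)))
        (root ∘ Inverse.from K-order)
      where
      suc-pred′ : ∀ n → 1 < n → ∃[ m ] n ≡ suc m
      suc-pred′ (suc m) _ = m , refl
      go : ∀ {n f} → ∃[ m ] n ≡ suc m → Poly 0# n f → (r : Fin n → Carrier) →
           (∀ {i j} → r i ≡ r j → i ≡ j) → (∀ i → f (r i) ≡ 0#) → ∀ x → f x ≡ 0#
      go (m , refl) p r r-inj root = proj₂ (Poly-roots m (proj₂ (Poly-lower m p)) r r-inj root)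

  frob-0 : frob 0# ≡ 0#
  frob-0 = trans (cong frob (sym embed-0)) (trans (frob-embed K.0#) embed-0)

  frob-1 : frob 1# ≡ 1#
  frob-1 = trans (cong frob (sym embed-1)) (trans (frob-embed K.1#) embed-1)

  frob³ : ∀ x → frob (frob (frob x)) ≡ x
  frob³ x = begin
    ((x ^ q) ^ q) ^ q       ≡⟨ cong (_^ q) (^-assocʳ x q q) ⟩
    (x ^ (q ℕ.* q)) ^ q     ≡⟨ ^-assocʳ x (q ℕ.* q) q ⟩
    x ^ (q ℕ.* q ℕ.* q)     ≡⟨ cong (x ^_) (trans (ℕ.*-assoc q q q) (cong (λ z → q ℕ.* (q ℕ.* z))
        (sym (ℕ.*-identityʳ q)))) ⟩
    x ^ (q ℕ.^ 3)           ≡⟨ Fermat.x^n≡x L L-order x ⟩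
    x                       ∎
    where open ≡-Reasoning

  frob-≢0 : ∀ {x} → x ≢ 0# → frob x ≢ 0#
  frob-≢0 {x} x≢0 eq = x≢0 (trans (sym (frob³ x)) (trans (cong (frob ∘ frob) eq)
    (trans (cong frob frob-0) frob-0)))

  -- Otherwise `x` and the q elements of `K` would be q + 1 roots of the monic polynomial X^q - X.
  frob-fixed : ∀ {x} → frob x ≡ x → ∃[ a ] embed a ≡ x
  frob-fixed {x} fx≡x with K.search (λ a → embed a ≟ x)
  ... | yes hit = hit
  ... | no miss = contradiction (proj₁ (Poly-roots q poly r r-inj root)) 1≢0
    where
    poly : Poly 1# q (λ x → frob x + - x)
    poly = Poly-cong q (+-identityʳ 1#) (λ x → cong (frob x +_)
        (solve 1 (λ x → :- :1 :* (x :* :1) := :- x) refl x))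
      (Poly-+ q (Poly-^ q) (Poly-raise< (Poly-scale 1 (- 1#) (Poly-^ 1)) (ℕ.<⇒<′ 1<q)))

    r : Fin (suc q) → Carrier
    r zero    = x
    r (suc i) = embed (Inverse.from K-order i)

    r-inj : ∀ {i j} → r i ≡ r j → i ≡ j
    r-inj {zero}  {zero}  eq = refl
    r-inj {zero}  {suc j} eq = contradiction (_ , sym eq) miss
    r-inj {suc i} {zero}  eq = contradiction (_ , eq) miss
    r-inj {suc i} {suc j} eq = cong suc (trans (sym (Inverse.strictlyInverseˡ K-order _))
      (trans (cong (Inverse.to K-order) (embed-injective eq)) (Inverse.strictlyInverseˡ K-order _)))

    root : ∀ i → frob (r i) + - r i ≡ 0#
    root zero    = x≡y⇒x-y≡0 fx≡x
    root (suc i) = x≡y⇒x-y≡0 (frob-embed _)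

  trace : Carrier → Carrier
  trace x = x + frob x + frob (frob x)

  frob-trace : ∀ x → frob (trace x) ≡ trace x
  frob-trace x = begin
    frob (x + frob x + frob (frob x))                ≡⟨ trans (frob-+ _ _)
        (cong (_+ frob (frob (frob x))) (frob-+ _ _)) ⟩
    frob x + frob (frob x) + frob (frob (frob x))    ≡⟨ cong (frob x + frob (frob x) +_) (frob³ x) ⟩
    frob x + frob (frob x) + x                       ≡⟨ solve 3 (λ a b c → b :+ c :+ a := a :+ b :+ c)
        refl _ _ _ ⟩
    x + frob x + frob (frob x)                       ∎
    where open ≡-Reasoning

  trace-1 : ∃[ α ] trace α ≡ 1#
  trace-1 with search (λ x → Dec.¬? (trace x ≟ 0#))
  ... | no none = contradiction (proj₁ (Poly-roots (q ℕ.* q) poly r r-inj root)) 1≢0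
    where
    poly : Poly 1# (q ℕ.* q) trace
    poly = Poly-cong (q ℕ.* q) (trans (+-identityʳ _) (+-identityʳ 1#))
      (λ x → trans (cong₂ (λ u v → u + frob x + v) (sym (^-assocʳ x q q)) (*-identityʳ x))
        (solve 3 (λ a b c → c :+ b :+ a := a :+ b :+ c) refl _ _ _))
      (Poly-+ (q ℕ.* q) (Poly-+ (q ℕ.* q) (Poly-^ (q ℕ.* q))
        (Poly-raise< (Poly-^ q) (ℕ.<⇒<′ q<q²)))
        (Poly-raise< (Poly-^ 1) (ℕ.<⇒<′ (ℕ.<-trans 1<q q<q²))))

    r : Fin (suc (q ℕ.* q)) → Carrier
    r i = Inverse.from L-order (inject≤ i q²<q³)

    r-inj : ∀ {i j} → r i ≡ r j → i ≡ j
    r-inj eq = Fin.inject≤-injective q²<q³ q²<q³ _ _ (trans (sym (Inverse.strictlyInverseˡ L-order _))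
      (trans (cong (Inverse.to L-order) eq) (Inverse.strictlyInverseˡ L-order _)))

    root : ∀ i → trace (r i) ≡ 0#
    root i = Dec.decidable-stable (_ ≟ _) (λ ≢0 → none (_ , ≢0))
  ... | yes (x , t≢0) = let z , zt≡1 = inverse (trace x) t≢0 in z * x , (begin
      z * x + frob (z * x) + frob (frob (z * x))
        ≡⟨ cong₂ (λ u v → z * x + u + v) (scaled z zt≡1 x) (trans
            (cong frob (scaled z zt≡1 x)) (scaled z zt≡1 (frob x))) ⟩
      z * x + z * frob x + z * frob (frob x)
        ≡⟨ solve 4 (λ z a b c → z :* a :+ z :* b :+ z :* c := z :* (a :+ b :+ c)) refl z x _ _ ⟩
      z * trace x
        ≡⟨ zt≡1 ⟩
      1# ∎)
    where
    open ≡-Reasoning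
    scaled : ∀ z → z * trace x ≡ 1# → ∀ y → frob (z * y) ≡ z * frob y
    scaled z zt≡1 y = trans (frob-* z y) (cong (_* frob y) (*-cancelˡ t≢0 (begin
      trace x * frob z          ≡⟨ cong (_* frob z) (frob-trace x) ⟨
      frob (trace x) * frob z   ≡⟨ *-comm _ _ ⟩
      frob z * frob (trace x)   ≡⟨ frob-* z (trace x) ⟨
      frob (z * trace x)        ≡⟨ cong frob zt≡1 ⟩
      frob 1#                   ≡⟨ frob-1 ⟩
      1#                        ≡⟨ zt≡1 ⟨
      z * trace x               ≡⟨ *-comm _ _ ⟩
      trace x * z               ∎)))

-- Binary forms acting on sequences

module Sequences (F : Field) where
  open FieldFacts F

  Pair Triple Sequence : Set
  Pair     = Carrier × Carrier
  Triple   = Carrier × Carrier × Carrier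
  Sequence = ℕ → Carrier

  0₃ e₀ e₁ e₂ : Triple
  0₃ = 0# , 0# , 0#
  e₀ = 1# , 0# , 0#
  e₁ = 0# , 1# , 0#
  e₂ = 0# , 0# , 1#

  infixl 7 _∙₃_
  infixr 5 _▷₁_ _▷₂_

  _∙₃_ : Triple → Triple → Carrier
  (a , b , c) ∙₃ (x , y , z) = a * x + b * y + c * z

  det₂ : Pair → Pair → Carrier
  det₂ (a , b) (c , d) = a * d - b * c

  opaque
    -- A binary form acts on sequences with (s , t) acting as (identity , shift), so that
    -- composition of actions is multiplication of forms. The action is opaque to let
    -- unification recover the sequence it is applied to.
    _▷₁_ : Pair → Sequence → Sequence
    ((a , b) ▷₁ c) i = a * c i + b * c (suc i)

    _▷₂_ : Triple → Sequence → Sequence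
    (f ▷₂ c) i = f ∙₃ (c i , c (suc i) , c (suc (suc i)))

  opaque
    unfolding _▷₁_ _▷₂_

    ▷₁-cong : ∀ m {c d} → c ≗ d → m ▷₁ c ≗ m ▷₁ d
    ▷₁-cong (a , b) c≗d i = cong₂ (λ x y → a * x + b * y) (c≗d i) (c≗d (suc i))

    ▷₂-cong : ∀ f {c d} → c ≗ d → f ▷₂ c ≗ f ▷₂ d
    ▷₂-cong (a₀ , a₁ , a₂) c≗d i = cong₂ _+_ (cong₂ (λ x y → a₀ * x + a₁ * y) (c≗d i) (c≗d (suc i)))
      (cong (a₂ *_) (c≗d (suc (suc i))))

    ▷₁-comm : ∀ l m c → l ▷₁ m ▷₁ c ≗ m ▷₁ l ▷₁ c
    ▷₁-comm (l₀ , l₁) (m₀ , m₁) c i = solve 7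
      (λ l₀ l₁ m₀ m₁ x y z → l₀ :* (m₀ :* x :+ m₁ :* y) :+ l₁ :* (m₀ :* y :+ m₁ :* z)
                          := m₀ :* (l₀ :* x :+ l₁ :* y) :+ m₁ :* (l₀ :* y :+ l₁ :* z)) refl
      l₀ l₁ m₀ m₁ (c i) (c (suc i)) (c (suc (suc i)))

    ▷₂-comm : ∀ f g c → f ▷₂ g ▷₂ c ≗ g ▷₂ f ▷₂ c
    ▷₂-comm (f₀ , f₁ , f₂) (g₀ , g₁ , g₂) c i = solve 11
      (λ f₀ f₁ f₂ g₀ g₁ g₂ x y z u v →
        f₀ :* (g₀ :* x :+ g₁ :* y :+ g₂ :* z) :+ f₁ :* (g₀ :* y :+ g₁ :* z :+ g₂ :* u) :+ f₂ :* (g₀ :* z :+ g₁ :* u :+ g₂ :* v)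
     := g₀ :* (f₀ :* x :+ f₁ :* y :+ f₂ :* z) :+ g₁ :* (f₀ :* y :+ f₁ :* z :+ f₂ :* u) :+ g₂ :* (f₀ :* z :+ f₁ :* u :+ f₂ :* v)) refl
      f₀ f₁ f₂ g₀ g₁ g₂ (c i) (c (suc i)) (c (suc (suc i))) (c (suc (suc (suc i)))) (c (suc (suc (suc (suc i)))))

  infixl 8 _⊗_

  _⊗_ : Pair → Pair → Triple
  (l₀ , l₁) ⊗ (m₀ , m₁) = l₀ * m₀ , l₀ * m₁ + l₁ * m₀ , l₁ * m₁

  opaque
    unfolding _▷₁_ _▷₂_

    ⊗-▷ : ∀ l m c → (l ⊗ m) ▷₂ c ≗ l ▷₁ m ▷₁ c
    ⊗-▷ (l₀ , l₁) (m₀ , m₁) c i = solve 7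
      (λ l₀ l₁ m₀ m₁ x y z → l₀ :* m₀ :* x :+ (l₀ :* m₁ :+ l₁ :* m₀) :* y :+ l₁ :* m₁ :* z
                          := l₀ :* (m₀ :* x :+ m₁ :* y) :+ l₁ :* (m₀ :* y :+ m₁ :* z)) refl
      l₀ l₁ m₀ m₁ (c i) (c (suc i)) (c (suc (suc i)))

  -- A form of degree `n`, encoded by its pairing with sequences. It reads the entries up to index
  -- `n` only, so it can be applied to finite vectors that `extend` pads with zeros.
  record Linear (n : ℕ) (u : Sequence → Carrier) : Set where
    field
      u-cong : ∀ {c d} → (∀ i → i ≤ n → c i ≡ d i) → u c ≡ u d
      u-+    : ∀ c d → u (λ i → c i + d i) ≡ u c + u d
      u-*    : ∀ a c → u (λ i → a * c i) ≡ a * u c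

  open Linear public

  head-linear : Linear 0 (λ c → c 0)
  head-linear = record { u-cong = λ c≗d → c≗d 0 z≤n ; u-+ = λ _ _ → refl ; u-* = λ _ _ → refl }

  scale-linear : ∀ {n u} s → Linear n u → Linear n (λ c → s * u c)
  scale-linear s lin = record
    { u-cong = λ c≗d → cong (s *_) (u-cong lin c≗d)
    ; u-+ = λ c d → trans (cong (s *_) (u-+ lin c d)) (distribˡ s _ _)
    ; u-* = λ a c → trans (cong (s *_) (u-* lin a c)) (solve 3 (λ s a u → s :* (a :* u) := a :* (s :* u))
        refl _ _ _)
    }

  opaque
    unfolding _▷₁_ _▷₂_

    ▷₁-linear : ∀ {n u} m → Linear n u → Linear (suc n) (λ c → u (m ▷₁ c))
    ▷₁-linear (a , b) lin = record
      { u-cong = λ c≗d → u-cong lin (λ i i≤n →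
          cong₂ (λ x y → a * x + b * y) (c≗d i (ℕ.m≤n⇒m≤1+n i≤n)) (c≗d (suc i) (s≤s i≤n)))
      ; u-+ = λ c d → trans (u-cong lin (λ i _ → solve 6
          (λ a b x y z w → a :* (x :+ y) :+ b :* (z :+ w) := a :* x :+ b :* z :+ (a :* y :+ b :* w))
              refl a b _ _ _ _))
          (u-+ lin ((a , b) ▷₁ c) ((a , b) ▷₁ d))
      ; u-* = λ r c → trans (u-cong lin (λ i _ → solve 5
          (λ a b r x y → a :* (r :* x) :+ b :* (r :* y) := r :* (a :* x :+ b :* y)) refl a b r _ _))
          (u-* lin r ((a , b) ▷₁ c))
      }

    ▷₂-linear : ∀ {n u} f → Linear n u → Linear (suc (suc n)) (λ c → u (f ▷₂ c))
    ▷₂-linear f@(a₀ , a₁ , a₂) lin = record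
      { u-cong = λ c≗d → u-cong lin (λ i i≤n → cong₂ _+_
          (cong₂ (λ x y → a₀ * x + a₁ * y) (c≗d i (ℕ.m≤n⇒m≤o+n 2 i≤n)) (c≗d (suc i) (s≤s (ℕ.m≤n⇒m≤1+n i≤n))))
          (cong (a₂ *_) (c≗d (suc (suc i)) (s≤s (s≤s i≤n)))))
      ; u-+ = λ c d → trans (u-cong lin (λ i _ → solve 9
          (λ a b c x y z w p q → a :* (x :+ y) :+ b :* (z :+ w) :+ c :* (p :+ q)
                              := a :* x :+ b :* z :+ c :* p :+ (a :* y :+ b :* w :+ c :* q))
                                  refl a₀ a₁ a₂ _ _ _ _ _ _))
          (u-+ lin (f ▷₂ c) (f ▷₂ d))
      ; u-* = λ r c → trans (u-cong lin (λ i _ → solve 7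
          (λ a b c r x y z → a :* (r :* x) :+ b :* (r :* y) :+ c :* (r :* z)
              := r :* (a :* x :+ b :* y :+ c :* z)) refl a₀ a₁ a₂ r _ _ _))
          (u-* lin r (f ▷₂ c))
      }

  extend : ∀ {n} → Vector Carrier n → Sequence
  extend {zero}  v i       = 0#
  extend {suc n} v zero    = v zero
  extend {suc n} v (suc i) = extend (v ∘ suc) i

  minor-⊗ : ∀ {l m n : Pair} → det₂ m n ≡ 0# →
    let l₀ , l₁ = l ; f₀ , f₁ , f₂ = l ⊗ m ; g₀ , g₁ , g₂ = l ⊗ n in f₀ * g₁ - f₁ * g₀ ≡ 0#
  minor-⊗ {l₀ , l₁} {m₀ , m₁} {n₀ , n₁} det≡0 = trans
    (solve 6 (λ l₀ l₁ m₀ m₁ n₀ n₁ → l₀ :* m₀ :* (l₀ :* n₁ :+ l₁ :* n₀) :- (l₀ :* m₁ :+ l₁ :* m₀) :* (l₀ :* n₀)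
      := l₀ :* l₀ :* (m₀ :* n₁ :- m₁ :* n₀)) refl l₀ l₁ m₀ m₁ n₀ n₁)
    (trans (cong (l₀ * l₀ *_) det≡0) (zeroʳ _))

  kernel₁ : ∀ {m n : Pair} → det₂ m n ≢ 0# → ∀ {x y} →
    let m₀ , m₁ = m ; n₀ , n₁ = n in
    m₀ * x + m₁ * y ≡ 0# → n₀ * x + n₁ * y ≡ 0# → x ≡ 0# × y ≡ 0#
  kernel₁ {m₀ , m₁} {n₀ , n₁} det≢0 {x} {y} mx≡0 nx≡0 =
    *-cancelˡ-0 det≢0 (trans
      (solve 6 (λ a b c d x y → (a :* d :- b :* c) :* x
          := d :* (a :* x :+ b :* y) :- b :* (c :* x :+ d :* y)) refl m₀ m₁ n₀ n₁ x y)
      (vanish n₁ m₁)) ,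
    *-cancelˡ-0 det≢0 (trans
      (solve 6 (λ a b c d x y → (a :* d :- b :* c) :* y
          := a :* (c :* x :+ d :* y) :- c :* (a :* x :+ b :* y)) refl m₀ m₁ n₀ n₁ x y)
      (trans (cong₂ (λ u v → m₀ * u - n₀ * v) nx≡0 mx≡0) (solve 2 (λ a b → a :* :0 :- b :* :0 := :0) refl _ _)))
    where
    vanish : ∀ a b → a * (m₀ * x + m₁ * y) - b * (n₀ * x + n₁ * y) ≡ 0#
    vanish a b = trans (cong₂ (λ u v → a * u - b * v) mx≡0 nx≡0)
      (solve 2 (λ a b → a :* :0 :- b :* :0 := :0) refl a b)

  resultant : Triple → Triple → Carrier
  resultant (f₀ , f₁ , f₂) (g₀ , g₁ , g₂) =
    (f₀ * g₂ - f₂ * g₀) * (f₀ * g₂ - f₂ * g₀) - (f₀ * g₁ - f₁ * g₀) * (f₁ * g₂ - f₂ * g₁)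

  -- Cramer's rule for the Sylvester matrix.
  kernel₂ : ∀ f g → resultant f g ≢ 0# → ∀ {x y z w} →
            f ∙₃ (x , y , z) ≡ 0# → f ∙₃ (y , z , w) ≡ 0# → g ∙₃ (x , y , z) ≡ 0# → g ∙₃ (y , z , w) ≡ 0# →
            x ≡ 0# × y ≡ 0# × z ≡ 0# × w ≡ 0#
  kernel₂ f@(f₀ , f₁ , f₂) g@(g₀ , g₁ , g₂) res≢0 {x} {y} {z} {w} fx fy gx gy =
    by (solve 10 (λ f₀ f₁ f₂ g₀ g₁ g₂ x y z w →
          ((f₀ :* g₂ :- f₂ :* g₀) :* (f₀ :* g₂ :- f₂ :* g₀) :- (f₀ :* g₁ :- f₁ :* g₀) :* (f₁ :* g₂ :- f₂ :* g₁)) :* x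
       := (f₀ :* g₂ :* g₂ :+ f₂ :* g₁ :* g₁ :- f₁ :* g₁ :* g₂ :- f₂ :* g₂ :* g₀) :* (f₀ :* x :+ f₁ :* y :+ f₂ :* z)
          :+ (f₂ :* g₁ :* g₂ :- f₁ :* g₂ :* g₂) :* (f₀ :* y :+ f₁ :* z :+ f₂ :* w)
          :+ (f₁ :* f₁ :* g₂ :+ f₂ :* f₂ :* g₀ :- f₁ :* f₂ :* g₁ :- f₂ :* f₀ :* g₂) :* (g₀ :* x :+ g₁ :* y :+ g₂ :* z)
          :+ (f₁ :* f₂ :* g₂ :- f₂ :* f₂ :* g₁) :* (g₀ :* y :+ g₁ :* z :+ g₂ :* w))
      refl f₀ f₁ f₂ g₀ g₁ g₂ x y z w) ,
    by (solve 10 (λ f₀ f₁ f₂ g₀ g₁ g₂ x y z w →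
          ((f₀ :* g₂ :- f₂ :* g₀) :* (f₀ :* g₂ :- f₂ :* g₀) :- (f₀ :* g₁ :- f₁ :* g₀) :* (f₁ :* g₂ :- f₂ :* g₁)) :* y
       := (f₁ :* g₀ :* g₂ :- f₂ :* g₀ :* g₁) :* (f₀ :* x :+ f₁ :* y :+ f₂ :* z)
          :+ (f₀ :* g₂ :* g₂ :- f₂ :* g₀ :* g₂) :* (f₀ :* y :+ f₁ :* z :+ f₂ :* w)
          :+ (f₀ :* f₂ :* g₁ :- f₀ :* f₁ :* g₂) :* (g₀ :* x :+ g₁ :* y :+ g₂ :* z)
          :+ (f₂ :* f₂ :* g₀ :- f₀ :* f₂ :* g₂) :* (g₀ :* y :+ g₁ :* z :+ g₂ :* w))
      refl f₀ f₁ f₂ g₀ g₁ g₂ x y z w) ,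
    by (solve 10 (λ f₀ f₁ f₂ g₀ g₁ g₂ x y z w →
          ((f₀ :* g₂ :- f₂ :* g₀) :* (f₀ :* g₂ :- f₂ :* g₀) :- (f₀ :* g₁ :- f₁ :* g₀) :* (f₁ :* g₂ :- f₂ :* g₁)) :* z
       := (f₂ :* g₀ :* g₀ :- f₀ :* g₀ :* g₂) :* (f₀ :* x :+ f₁ :* y :+ f₂ :* z)
          :+ (f₁ :* g₀ :* g₂ :- f₀ :* g₁ :* g₂) :* (f₀ :* y :+ f₁ :* z :+ f₂ :* w)
          :+ (f₀ :* f₀ :* g₂ :- f₀ :* f₂ :* g₀) :* (g₀ :* x :+ g₁ :* y :+ g₂ :* z)
          :+ (f₀ :* f₂ :* g₁ :- f₁ :* f₂ :* g₀) :* (g₀ :* y :+ g₁ :* z :+ g₂ :* w))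
      refl f₀ f₁ f₂ g₀ g₁ g₂ x y z w) ,
    by (solve 10 (λ f₀ f₁ f₂ g₀ g₁ g₂ x y z w →
          ((f₀ :* g₂ :- f₂ :* g₀) :* (f₀ :* g₂ :- f₂ :* g₀) :- (f₀ :* g₁ :- f₁ :* g₀) :* (f₁ :* g₂ :- f₂ :* g₁)) :* w
       := (f₀ :* g₀ :* g₁ :- f₁ :* g₀ :* g₀) :* (f₀ :* x :+ f₁ :* y :+ f₂ :* z)
          :+ (f₀ :* g₁ :* g₁ :+ f₂ :* g₀ :* g₀ :- f₀ :* g₂ :* g₀ :- f₁ :* g₀ :* g₁) :* (f₀ :* y :+ f₁ :* z :+ f₂ :* w)
          :+ (f₀ :* f₁ :* g₀ :- f₀ :* f₀ :* g₁) :* (g₀ :* x :+ g₁ :* y :+ g₂ :* z)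
          :+ (f₀ :* f₀ :* g₂ :+ f₁ :* f₁ :* g₀ :- f₀ :* f₁ :* g₁ :- f₂ :* f₀ :* g₀) :* (g₀ :* y :+ g₁ :* z :+ g₂ :* w))
      refl f₀ f₁ f₂ g₀ g₁ g₂ x y z w)
    where
    by : ∀ {u a b c d} → resultant f g * u ≡ a * (f ∙₃ (x , y , z)) + b * (f ∙₃ (y , z , w))
                                           + c * (g ∙₃ (x , y , z)) + d * (g ∙₃ (y , z , w)) → u ≡ 0#
    by {u} {a} {b} {c} {d} eq = *-cancelˡ-0 res≢0 (trans eq (trans
      (cong₂ _+_ (cong₂ _+_ (cong₂ (λ s t → a * s + b * t) fx fy) (cong (c *_) gx)) (cong (d *_) gy))
      (solve 4 (λ a b c d → a :* :0 :+ b :* :0 :+ c :* :0 :+ d :* :0 := :0)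
        refl a b c d)))

  opaque
    unfolding _▷₁_ _▷₂_

    -- At each index the two recurrences form an invertible system for a window of two entries, so
    -- one index is gained. Dually, the multiples of two coprime linear forms span all forms of
    -- degree `suc N`.
    annihilated₁ : ∀ {m n : Pair} → det₂ m n ≢ 0# → ∀ N {c} →
                   (∀ i → i ≤ N → (m ▷₁ c) i ≡ 0#) → (∀ i → i ≤ N → (n ▷₁ c) i ≡ 0#) →
                   ∀ i → i ≤ suc N → c i ≡ 0#
    annihilated₁ det≢0 N mc nc zero    i≤N       = proj₁ (kernel₁ det≢0 (mc 0 z≤n) (nc 0 z≤n))
    annihilated₁ det≢0 N mc nc (suc i) (s≤s i≤N) = proj₂ (kernel₁ det≢0 (mc i i≤N) (nc i i≤N))

    -- The recurrences at two consecutive indices form the Sylvester system for a window of four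
    -- entries; hence the hypotheses reach `suc N` when the windows start at most at `N`. Dually,
    -- the multiples of two coprime quadratic forms span all forms of degree N + 3.
    annihilated₂ : ∀ f g → resultant f g ≢ 0# → ∀ N {c} →
                   (∀ i → i ≤ suc N → (f ▷₂ c) i ≡ 0#) → (∀ i → i ≤ suc N → (g ▷₂ c) i ≡ 0#) →
                   ∀ i → i ≤ suc (suc (suc N)) → c i ≡ 0#
    annihilated₂ f g res≢0 N {c} fc gc = λ where
        0                 _                     → proj₁ (window 0 z≤n)
        1                 _                     → proj₁ (proj₂ (window 0 z≤n))
        2                 _                     → proj₁ (proj₂ (proj₂ (window 0 z≤n)))
        (suc (suc (suc i))) (s≤s (s≤s (s≤s i≤N))) → proj₂ (proj₂ (proj₂ (window i i≤N)))
      where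
      window : ∀ i → i ≤ N → c i ≡ 0# × c (1 ℕ.+ i) ≡ 0# × c (2 ℕ.+ i) ≡ 0# × c (3 ℕ.+ i) ≡ 0#
      window i i≤N = kernel₂ f g res≢0 (fc i (ℕ.m≤n⇒m≤1+n i≤N)) (fc (suc i) (s≤s i≤N))
                                       (gc i (ℕ.m≤n⇒m≤1+n i≤N)) (gc (suc i) (s≤s i≤N))

    ▷₂-e₀ : ∀ c i → (e₀ ▷₂ c) i ≡ c i
    ▷₂-e₀ c i = solve 3 (λ x y z → :1 :* x :+ :0 :* y :+ :0 :* z := x) refl _ _ _

    ▷₂-e₁ : ∀ c i → (e₁ ▷₂ c) i ≡ c (suc i)
    ▷₂-e₁ c i = solve 3 (λ x y z → :0 :* x :+ :1 :* y :+ :0 :* z := y) refl _ _ _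

    ▷₂-e₂ : ∀ c i → (e₂ ▷₂ c) i ≡ c (suc (suc i))
    ▷₂-e₂ c i = solve 3 (λ x y z → :0 :* x :+ :0 :* y :+ :1 :* z := z) refl _ _ _

  opaque
    unfolding _▷₁_ _▷₂_

    ▷₂-expand : ∀ f c i → (f ▷₂ c) i ≡ f ∙₃ ((e₀ ▷₂ c) i , (e₁ ▷₂ c) i , (e₂ ▷₂ c) i)
    ▷₂-expand (a , b , d) c i = sym (cong₂ _+_ (cong₂ (λ x y → a * x + b * y) (▷₂-e₀ c i) (▷₂-e₁ c i))
        (cong (d *_) (▷₂-e₂ c i)))

  linear-expand : ∀ {n u} → Linear n u → ∀ f c → u (f ▷₂ c) ≡ f ∙₃ (u (e₀ ▷₂ c) , u (e₁ ▷₂ c) , u (e₂ ▷₂ c))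
  linear-expand {u = u} lin (a , b , d) c = trans (u-cong lin (λ i _ → ▷₂-expand (a , b , d) c i))
    (trans (u-+ lin (λ i → a * (e₀ ▷₂ c) i + b * (e₁ ▷₂ c) i) (λ i → d * (e₂ ▷₂ c) i))
      (cong₂ _+_ (trans (u-+ lin (λ i → a * (e₀ ▷₂ c) i) (λ i → b * (e₁ ▷₂ c) i))
        (cong₂ _+_ (u-* lin a (e₀ ▷₂ c)) (u-* lin b (e₁ ▷₂ c)))) (u-* lin d (e₂ ▷₂ c))))

  extend-toℕ : ∀ {k} (g : Sequence) i → i ≤ k → extend {suc k} (g ∘ toℕ) i ≡ g i
  extend-toℕ {k}     g zero    i≤k       = refl
  extend-toℕ {suc k} g (suc i) (s≤s i≤k) = extend-toℕ {k} (g ∘ suc) i i≤k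

  extend-lookup : ∀ {n} (v : Vector Carrier n) j → extend v (toℕ j) ≡ v j
  extend-lookup v zero    = refl
  extend-lookup v (suc j) = extend-lookup (v ∘ suc) j

-- Multipliers that make a binary quadratic form rational

module Multipliers {K L : Field} {q : ℕ} (6≤q : 6 ≤ q) (K-order : HasOrder K q) (L-order : HasOrder L (q ℕ.^ 3))
                   (E : FieldExtension K L) where
  open FieldExtension E
  open FieldFacts L
  open FiniteField L L-order
  open Frobenius 6≤q K-order L-order E
  open Sequences L
  private module K = Field K

  -- Parameters of a conic, or of a normal rational curve: θ, or nothing for infinity.
  Parameter : Set
  Parameter = Maybe K.Carrier

  point : Parameter → Triple
  point (just θ) = 1# , embed θ , embed θ * embed θ
  point nothing  = e₂

  linearAt : Pair → Parameter → Carrier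
  linearAt (a , b) (just θ) = a + b * embed θ
  linearAt (a , b) nothing  = b

  top : ℕ → Sequence
  top zero    zero    = 1#
  top zero    (suc i) = 0#
  top (suc k) zero    = 0#
  top (suc k) (suc i) = top k i

  -- Evaluation at the parameter, as a functional on forms of degree `k`. At infinity it reads the
  -- last coefficient, so there it depends on the degree.
  veronese : Parameter → ℕ → Sequence
  veronese (just θ) k i = embed θ ^ i
  veronese nothing  k   = top k

  top-≤ : ∀ {i k} → i ≤ k → top (suc k) i ≡ 0#
  top-≤ z≤n       = refl
  top-≤ (s≤s i≤k) = top-≤ i≤k

  opaque
    unfolding _▷₁_ _▷₂_

    -- Evaluation is multiplicative, so acting by a form only scales the evaluation functional by
    -- the value of that form. The bound on `i` matters at infinity, where the entry of
    -- `top (suc k)` just beyond index k is 1.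
    ▷₁-veronese : ∀ m t {k} i → i ≤ k → (m ▷₁ veronese t (suc k)) i ≡ linearAt m t * veronese t k i
    ▷₁-veronese (a , b) (just θ) i i≤k =
      solve 4 (λ a b x y → a :* y :+ b :* (x :* y) := (a :+ b :* x) :* y) refl a b (embed θ) (embed θ ^ i)
    ▷₁-veronese (a , b) nothing {k} i i≤k = trans (cong (λ z → a * z + b * top k i) (top-≤ i≤k))
      (solve 3 (λ a b x → a :* :0 :+ b :* x := b :* x) refl a b (top k i))

    ▷₂-veronese : ∀ f t {k} i → i ≤ k → (f ▷₂ veronese t (suc (suc k))) i ≡ f ∙₃ point t * veronese t k i
    ▷₂-veronese (a , b , c) (just θ) i i≤k =
      solve 5 (λ a b c x y → a :* y :+ b :* (x :* y) :+ c :* (x :* (x :* y))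
        := (a :* :1 :+ b :* x :+ c :* (x :* x)) :* y) refl a b c (embed θ) (embed θ ^ i)
    ▷₂-veronese (a , b , c) nothing {k} i i≤k = trans
      (cong₂ (λ z w → a * z + b * w + c * top k i) (top-≤ (ℕ.m≤n⇒m≤1+n i≤k)) (top-≤ i≤k))
      (solve 4 (λ a b c x → a :* :0 :+ b :* :0 :+ c :* x
        := (a :* :0 :+ b :* :0 :+ c :* :1) :* x) refl a b c (top k i))

  evaluate₁ : ∀ {n u} → Linear n u → ∀ m t → u (m ▷₁ veronese t (suc n)) ≡ linearAt m t * u (veronese t n)
  evaluate₁ {n} lin m t = trans (u-cong lin (▷₁-veronese m t)) (u-* lin (linearAt m t) (veronese t n))

  evaluate₂ : ∀ {n u} → Linear n u → ∀ f t → u (f ▷₂ veronese t (suc (suc n))) ≡ f ∙₃ point t * u (veronese t n)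
  evaluate₂ {n} lin f t = trans (u-cong lin (▷₂-veronese f t)) (u-* lin (f ∙₃ point t) (veronese t n))

  veronese-head : ∀ t → veronese t 0 0 ≡ 1#
  veronese-head (just θ) = refl
  veronese-head nothing  = refl

  linearAt-⊗ : ∀ l m t → (l ⊗ m) ∙₃ point t ≡ linearAt l t * linearAt m t
  linearAt-⊗ (a , b) (c , d) (just θ) = solve 5
    (λ a b c d x → a :* c :* :1 :+ (a :* d :+ b :* c) :* x :+ b :* d :* (x :* x)
        := (a :+ b :* x) :* (c :+ d :* x))
    refl a b c d (embed θ)
  linearAt-⊗ (a , b) (c , d) nothing = solve 4
    (λ a b c d → a :* c :* :0 :+ (a :* d :+ b :* c) :* :0 :+ b :* d :* :1 := b :* d) refl a b c d

  frob₁ : Pair → Pair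
  frob₁ (a , b) = frob a , frob b

  frob₂ : Triple → Triple
  frob₂ (a , b , c) = frob a , frob b , frob c

  frob₁³ : ∀ m → frob₁ (frob₁ (frob₁ m)) ≡ m
  frob₁³ (a , b) = cong₂ _,_ (frob³ a) (frob³ b)

  frob₂³ : ∀ f → frob₂ (frob₂ (frob₂ f)) ≡ f
  frob₂³ (a , b , c) = cong₂ _,_ (frob³ a) (cong₂ _,_ (frob³ b) (frob³ c))

  opaque
    unfolding _▷₁_ _▷₂_

    frob-▷₁ : ∀ m c i → frob ((m ▷₁ c) i) ≡ (frob₁ m ▷₁ frob ∘ c) i
    frob-▷₁ (a , b) c i = trans (frob-+ _ _) (cong₂ _+_ (frob-* _ _) (frob-* _ _))

    frob-▷₂ : ∀ f c i → frob ((f ▷₂ c) i) ≡ (frob₂ f ▷₂ frob ∘ c) i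
    frob-▷₂ (a₀ , a₁ , a₂) c i = trans (frob-+ _ _) (cong₂ _+_
      (trans (frob-+ _ _) (cong₂ _+_ (frob-* _ _) (frob-* _ _))) (frob-* _ _))

  -- Parameters are defined over `K`, so conjugating a value conjugates the coefficients only.
  -- Consequently a form and its conjugates vanish at the same parameters.
  frob-linearAt : ∀ m t → frob (linearAt m t) ≡ linearAt (frob₁ m) t
  frob-linearAt (a , b) (just θ) = trans (frob-+ _ _) (cong (frob a +_)
    (trans (frob-* _ _) (cong (frob b *_) (frob-embed θ))))
  frob-linearAt (a , b) nothing  = refl

  frob-point : ∀ f t → frob (f ∙₃ point t) ≡ frob₂ f ∙₃ point t
  frob-point (a , b , c) t = trans (trans (frob-+ _ _) (cong₂ _+_ (trans (frob-+ _ _)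
      (cong₂ _+_ (frob-* _ _) (frob-* _ _))) (frob-* _ _)))
    (cong₂ _+_ (cong₂ (λ x y → frob a * x + frob b * y) (fix₀ t) (fix₁ t)) (cong (frob c *_) (fix₂ t)))
    where
    fix₀ : ∀ t → frob (proj₁ (point t)) ≡ proj₁ (point t)
    fix₀ (just θ) = frob-1
    fix₀ nothing  = frob-0
    fix₁ : ∀ t → frob (proj₁ (proj₂ (point t))) ≡ proj₁ (proj₂ (point t))
    fix₁ (just θ) = frob-embed θ
    fix₁ nothing  = frob-0
    fix₂ : ∀ t → frob (proj₂ (proj₂ (point t))) ≡ proj₂ (proj₂ (point t))
    fix₂ (just θ) = trans (frob-* _ _) (cong₂ _*_ (frob-embed θ) (frob-embed θ))
    fix₂ nothing  = frob-1

  Fixed : Sequence → Set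
  Fixed c = ∀ i → frob (c i) ≡ c i

  ▷₁-fixed : ∀ m {c} → Fixed c → ∀ i → frob ((m ▷₁ c) i) ≡ (frob₁ m ▷₁ c) i
  ▷₁-fixed m fix i = trans (frob-▷₁ m _ i) (▷₁-cong (frob₁ m) fix i)

  ▷₂-fixed : ∀ f {c} → Fixed c → ∀ i → frob ((f ▷₂ c) i) ≡ (frob₂ f ▷₂ c) i
  ▷₂-fixed f fix i = trans (frob-▷₂ f _ i) (▷₂-cong (frob₂ f) fix i)

  -- Multiplication by a form u of degree n (as the functional c ↦ (u ▷ c) 0) which clears
  -- the denominator f: the products u f are defined over K, and the products u y with y
  -- quadratic span, together with their conjugates, all forms of degree n + 2.
  record Multiplier (f : Triple) (n : ℕ) : Set where
    field
      u            : Sequence → Carrier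
      linear       : Linear n u
      rational     : ∀ {c} → Fixed c → frob (u (f ▷₂ c)) ≡ u (f ▷₂ c)
      nonvanishing : ∀ t → f ∙₃ point t ≢ 0# → u (veronese t n) ≢ 0#
      spanning     : ∀ {c} → Fixed c → (∀ y → u (y ▷₂ c) ≡ 0#) → ∀ i → i ≤ suc (suc n) → c i ≡ 0#

  -- The values of u on y ▷ c for the three monomials y are the first three terms of u ▷ c.
  initial : ∀ (w : Sequence → Sequence) c →
            (∀ y → w (y ▷₂ c) 0 ≡ 0#) → (∀ y i → w (y ▷₂ c) i ≡ (y ▷₂ w c) i) → ∀ i → i ≤ 2 → w c i ≡ 0#
  initial w c w≡0 comm 0 _ = trans (sym (▷₂-e₀ (w c) 0)) (trans (sym (comm e₀ 0)) (w≡0 e₀))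
  initial w c w≡0 comm 1 _ = trans (sym (▷₂-e₁ (w c) 0)) (trans (sym (comm e₁ 0)) (w≡0 e₁))
  initial w c w≡0 comm 2 _ = trans (sym (▷₂-e₂ (w c) 0)) (trans (sym (comm e₂ 0)) (w≡0 e₂))
  initial w c w≡0 comm (suc (suc (suc i))) (s≤s (s≤s ()))

  opaque
    unfolding _▷₁_ _▷₂_

    ▷₁₂-comm : ∀ m f c → m ▷₁ f ▷₂ c ≗ f ▷₂ m ▷₁ c
    ▷₁₂-comm (l₀ , l₁) (m₀ , m₁ , m₂) c i = solve 9
      (λ l₀ l₁ m₀ m₁ m₂ x y z w → l₀ :* (m₀ :* x :+ m₁ :* y :+ m₂ :* z) :+ l₁ :* (m₀ :* y :+ m₁ :* z :+ m₂ :* w)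
        := m₀ :* (l₀ :* x :+ l₁ :* y) :+ m₁ :* (l₀ :* y :+ l₁ :* z) :+ m₂ :* (l₀ :* z :+ l₁ :* w)) refl
      l₀ l₁ m₀ m₁ m₂ (c i) (c (suc i)) (c (suc (suc i))) (c (suc (suc (suc i))))

  zero-conj : ∀ {x y} → frob x ≡ y → x ≡ 0# → y ≡ 0#
  zero-conj eq refl = trans (sym eq) frob-0

  module Split (m : Pair) where
    m′ m″ : Pair
    m′ = frob₁ m
    m″ = frob₁ m′

    norm : Sequence → Sequence
    norm c = m ▷₁ m′ ▷₁ m″ ▷₁ c

    -- `frob` permutes the three factors `m`, `m′`, `m″` cyclically, and their actions commute.
    norm-fixed : ∀ {c} → Fixed c → Fixed (norm c)
    norm-fixed {c} fix i = begin
      frob ((m ▷₁ m′ ▷₁ m″ ▷₁ c) i)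
        ≡⟨ frob-▷₁ m _ i ⟩
      (m′ ▷₁ frob ∘ (m′ ▷₁ m″ ▷₁ c)) i
        ≡⟨ ▷₁-cong m′ (λ i → trans (frob-▷₁ m′ _ i) (▷₁-cong m″ (▷₁-fixed m″ fix) i)) i ⟩
      (m′ ▷₁ m″ ▷₁ frob₁ m″ ▷₁ c) i
        ≡⟨ cong (λ n → (m′ ▷₁ m″ ▷₁ n ▷₁ c) i) (frob₁³ m) ⟩
      (m′ ▷₁ m″ ▷₁ m ▷₁ c) i
        ≡⟨ ▷₁-cong m′ (▷₁-comm m″ m c) i ⟩
      (m′ ▷₁ m ▷₁ m″ ▷₁ c) i
        ≡⟨ ▷₁-comm m′ m _ i ⟩
      (m ▷₁ m′ ▷₁ m″ ▷₁ c) i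
        ∎
      where open ≡-Reasoning

    conj₁ : ∀ {c N} → Fixed c → (∀ i → i ≤ N → (m″ ▷₁ c) i ≡ 0#) → ∀ i → i ≤ N → (m ▷₁ c) i ≡ 0#
    conj₁ {c} fix zer i i≤N = zero-conj
      (trans (▷₁-fixed m″ fix i) (cong (λ n → (n ▷₁ c) i) (frob₁³ m))) (zer i i≤N)

    conj₁′ : ∀ {c N} → Fixed c → (∀ i → i ≤ N → (m ▷₁ c) i ≡ 0#) → ∀ i → i ≤ N → (m′ ▷₁ c) i ≡ 0#
    conj₁′ fix zer i i≤N = zero-conj (▷₁-fixed m fix i) (zer i i≤N)

    -- Since `c` is rational, being killed by `m″` implies being killed by its conjugates `m` and
    -- `m′`, which are coprime.
    vanish₁ : det₂ m m′ ≢ 0# → ∀ {c} N → Fixed c → (∀ i → i ≤ N → (m″ ▷₁ c) i ≡ 0#) →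
              ∀ i → i ≤ suc N → c i ≡ 0#
    vanish₁ det≢0 N fix zer = annihilated₁ det≢0 N (conj₁ fix zer) (conj₁′ fix (conj₁ fix zer))

    value≢0 : ∀ t → linearAt m t ≢ 0# → linearAt m″ t ≢ 0#
    value≢0 t ≢0 = subst (_≢ 0#) (trans
        (cong frob (frob-linearAt m t)) (frob-linearAt m′ t)) (frob-≢0 (frob-≢0 ≢0))

    value′≢0 : ∀ t → linearAt m t ≢ 0# → linearAt m′ t ≢ 0#
    value′≢0 t ≢0 = subst (_≢ 0#) (frob-linearAt m t) (frob-≢0 ≢0)

  multiplier₀ : ∀ {f f₀ s r} → r * s ≡ 1# → frob₂ f₀ ≡ f₀ → (∀ c → f ▷₂ c ≗ λ i → s * (f₀ ▷₂ c) i) → Multiplier f 0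
  multiplier₀ {f} {f₀} {s} {r} rs≡1 fix₀ f▷ = record
    { u = λ c → r * c 0
    ; linear = lin
    ; rational = λ {c} fix → begin
        frob (r * (f ▷₂ c) 0)   ≡⟨ cong frob (cancel c) ⟩
        frob ((f₀ ▷₂ c) 0)      ≡⟨ ▷₂-fixed f₀ fix 0 ⟩
        (frob₂ f₀ ▷₂ c) 0       ≡⟨ cong (λ g → (g ▷₂ c) 0) fix₀ ⟩
        (f₀ ▷₂ c) 0             ≡⟨ cancel c ⟨
        r * (f ▷₂ c) 0          ∎
    ; nonvanishing = λ t _ eq → r≢0 (trans (sym (*-identityʳ r)) (trans (cong (r *_)
        (sym (veronese-head t))) eq))
    ; spanning = λ {c} fix u≡0 → initial id c (λ y → *-cancelˡ-0 r≢0 (u≡0 y)) (λ _ _ → refl)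
    }
    where
    open ≡-Reasoning
    lin : Linear 0 (λ c → r * c 0)
    lin = scale-linear r head-linear
    r≢0 : r ≢ 0#
    r≢0 = Projective.inverse≢0 L rs≡1
    cancel : ∀ c → r * (f ▷₂ c) 0 ≡ (f₀ ▷₂ c) 0
    cancel c = trans (cong (r *_) (f▷ c 0)) (trans (sym (*-assoc r s _)) (trans (cong (_* (f₀ ▷₂ c) 0) rs≡1)
        (*-identityˡ _)))

  -- The missing conjugate `m″` completes `f` to the norm of `m`, and `r` removes the scalar `s`.
  -- The hypothesis compares actions instead of coefficients, so that the order of the two linear
  -- factors can be changed by `▷₁-comm`.
  multiplier₁ : ∀ {f m s r} → det₂ m (frob₁ m) ≢ 0# → r * s ≡ 1# →
                (∀ c → f ▷₂ c ≗ λ i → s * ((m ⊗ frob₁ m) ▷₂ c) i) → Multiplier f 1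
  multiplier₁ {f} {m} {s} {r} det≢0 rs≡1 f▷ = record
    { u = λ c → r * (m″ ▷₁ c) 0
    ; linear = scale-linear r (▷₁-linear m″ head-linear)
    ; rational = λ {c} fix → trans (cong frob (product c)) (trans (norm-fixed fix 0) (sym (product c)))
    ; nonvanishing = λ t f≢0 → subst (_≢ 0#)
        (sym (cong (r *_) (evaluate₁ head-linear m″ t)))
        (*-≢0 r≢0 (*-≢0 (value≢0 t (m≢0 t f≢0)) (subst (_≢ 0#) (sym (veronese-head t)) 1≢0)))
    ; spanning = λ {c} fix u≡0 → vanish₁ det≢0 2 fix
        (initial (m″ ▷₁_) c (λ y → *-cancelˡ-0 r≢0 (u≡0 y)) (λ y → ▷₁₂-comm m″ y c))
    }
    where
    open Split m
    r≢0 : r ≢ 0#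
    r≢0 = Projective.inverse≢0 L rs≡1
    cancel : ∀ x → r * (s * x) ≡ x
    cancel x = trans (sym (*-assoc r s x)) (trans (cong (_* x) rs≡1) (*-identityˡ x))
    f▷m : ∀ c i → (f ▷₂ c) i ≡ s * (m ▷₁ m′ ▷₁ c) i
    f▷m c i = trans (f▷ c i) (cong (s *_) (⊗-▷ m m′ c i))
    open ≡-Reasoning
    product : ∀ c → r * (m″ ▷₁ f ▷₂ c) 0 ≡ norm c 0
    product c = begin
      r * (m″ ▷₁ f ▷₂ c) 0              ≡⟨ cong (r *_) (▷₁₂-comm m″ f c 0) ⟩
      r * (f ▷₂ m″ ▷₁ c) 0              ≡⟨ cong (r *_) (f▷m _ 0) ⟩
      r * (s * norm c 0)                ≡⟨ cancel _ ⟩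
      norm c 0                          ∎
    m≢0 : ∀ t → f ∙₃ point t ≢ 0# → linearAt m t ≢ 0#
    m≢0 t f≢0 m≡0 = f≢0 (begin
      f ∙₃ point t                                      ≡⟨ *-identityʳ _ ⟨
      f ∙₃ point t * 1#                                 ≡⟨ cong (f ∙₃ point t *_) (veronese-head t) ⟨
      f ∙₃ point t * veronese t 0 0                     ≡⟨ ▷₂-veronese f t 0 z≤n ⟨
      (f ▷₂ veronese t 2) 0                             ≡⟨ f▷ _ 0 ⟩
      s * ((m ⊗ m′) ▷₂ veronese t 2) 0                  ≡⟨ cong (s *_) (▷₂-veronese (m ⊗ m′) t 0 z≤n) ⟩
      s * ((m ⊗ m′) ∙₃ point t * veronese t 0 0)        ≡⟨ cong
          (λ z → s * (z * veronese t 0 0)) (linearAt-⊗ m m′ t) ⟩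
      s * (linearAt m t * linearAt m′ t * _)            ≡⟨ cong (λ z → s * (z * linearAt m′ t * _)) m≡0 ⟩
      s * (0# * linearAt m′ t * veronese t 0 0)         ≡⟨ solve 3 (λ a b c → a :* (:0 :* b :* c) := :0)
          refl _ _ _ ⟩
      0#                                                ∎)

  multiplier₂ : ∀ {l m} → frob₁ l ≡ l → det₂ m (frob₁ m) ≢ 0# → Multiplier (l ⊗ m) 2
  multiplier₂ {l} {m} fix-l det≢0 = record
    { u = λ c → (m′ ▷₁ m″ ▷₁ c) 0
    ; linear = ▷₁-linear m″ (▷₁-linear m′ head-linear)
    ; rational = λ {c} fix → trans (cong frob (product c))
        (trans (trans (frob-▷₁ l _ 0) (trans (▷₁-cong (frob₁ l) (norm-fixed fix) 0) (cong
            (λ n → (n ▷₁ norm c) 0) fix-l)))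
          (sym (product c)))
    ; nonvanishing = λ t f≢0 → subst (_≢ 0#)
        (sym (trans (evaluate₁ (▷₁-linear m′ head-linear) m″ t)
            (cong (linearAt m″ t *_) (evaluate₁ head-linear m′ t))))
        (*-≢0 (value≢0 t (m≢0 t f≢0)) (*-≢0 (value′≢0 t (m≢0 t f≢0)) (subst (_≢ 0#)
            (sym (veronese-head t)) 1≢0)))
    ; spanning = λ {c} fix u≡0 → spanning fix (initial (λ c → m′ ▷₁ m″ ▷₁ c) c u≡0
        (λ y i → trans (▷₁-cong m′ (▷₁₂-comm m″ y c) i) (▷₁₂-comm m′ y _ i)))
    }
    where
    open Split m
    open ≡-Reasoning
    product : ∀ c → (m′ ▷₁ m″ ▷₁ (l ⊗ m) ▷₂ c) 0 ≡ (l ▷₁ norm c) 0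
    product c = begin
      (m′ ▷₁ m″ ▷₁ (l ⊗ m) ▷₂ c) 0      ≡⟨ ▷₁-cong m′ (▷₁₂-comm m″ (l ⊗ m) c) 0 ⟩
      (m′ ▷₁ (l ⊗ m) ▷₂ m″ ▷₁ c) 0      ≡⟨ ▷₁₂-comm m′ (l ⊗ m) _ 0 ⟩
      ((l ⊗ m) ▷₂ m′ ▷₁ m″ ▷₁ c) 0      ≡⟨ ⊗-▷ l m _ 0 ⟩
      (l ▷₁ norm c) 0                   ∎
    m≢0 : ∀ t → (l ⊗ m) ∙₃ point t ≢ 0# → linearAt m t ≢ 0#
    m≢0 t f≢0 m≡0 = f≢0 (trans (linearAt-⊗ l m t) (trans (cong (linearAt l t *_) m≡0) (zeroʳ _)))
    spanning : ∀ {c} → Fixed c → (∀ i → i ≤ 2 → (m′ ▷₁ m″ ▷₁ c) i ≡ 0#) → ∀ i → i ≤ 4 → c i ≡ 0#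
    -- The sequence `m″ ▷₁ c` is killed by `m′` by hypothesis and by `m` after conjugation, so it
    -- vanishes up to index 3. Then `vanish₁` conjugates once more and removes the last factor.
    spanning {c} fix zer = vanish₁ det≢0 3 fix (annihilated₁ det≢0 2
        (λ i i≤2 → trans (▷₁-comm m m″ c i) (zero-conj (conj′ i) (zer i i≤2))) zer)
      where
      conj′ : ∀ i → frob ((m′ ▷₁ m″ ▷₁ c) i) ≡ (m″ ▷₁ m ▷₁ c) i
      conj′ i = trans (frob-▷₁ m′ _ i) (▷₁-cong m″ (λ i → trans (▷₁-fixed m″ fix i) (cong
          (λ n → (n ▷₁ c) i) (frob₁³ m))) i)

  multiplier₄ : ∀ {f} → resultant f (frob₂ f) ≢ 0# → Multiplier f 4
  multiplier₄ {f} res≢0 = record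
    { u = λ c → (f′ ▷₂ f″ ▷₂ c) 0
    ; linear = ▷₂-linear f″ (▷₂-linear f′ head-linear)
    ; rational = λ {c} fix → begin
        frob ((f′ ▷₂ f″ ▷₂ f ▷₂ c) 0)
          ≡⟨ trans (frob-▷₂ f′ _ 0) (▷₂-cong f″
              (λ i → trans (frob-▷₂ f″ _ i) (▷₂-cong (frob₂ f″) (▷₂-fixed f fix) i)) 0) ⟩
        (f″ ▷₂ frob₂ f″ ▷₂ f′ ▷₂ c) 0
          ≡⟨ cong (λ g → (f″ ▷₂ g ▷₂ f′ ▷₂ c) 0) (frob₂³ f) ⟩
        (f″ ▷₂ f ▷₂ f′ ▷₂ c) 0
          ≡⟨ ▷₂-cong f″ (▷₂-comm f f′ c) 0 ⟩
        (f″ ▷₂ f′ ▷₂ f ▷₂ c) 0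
          ≡⟨ ▷₂-comm f″ f′ _ 0 ⟩
        (f′ ▷₂ f″ ▷₂ f ▷₂ c) 0
          ∎
    ; nonvanishing = λ t f≢0 → subst (_≢ 0#)
        (sym (trans (evaluate₂ (▷₂-linear f′ head-linear) f″ t)
            (cong (f″ ∙₃ point t *_) (evaluate₂ head-linear f′ t))))
        (*-≢0 (subst (_≢ 0#) (trans (cong frob (frob-point f t)) (frob-point f′ t)) (frob-≢0 (frob-≢0 f≢0)))
          (*-≢0 (subst (_≢ 0#) (frob-point f t) (frob-≢0 f≢0)) (subst (_≢ 0#) (sym (veronese-head t)) 1≢0)))
    ; spanning = λ {c} fix u≡0 → spanning fix (initial (λ c → f′ ▷₂ f″ ▷₂ c) c u≡0
        (λ y i → trans (▷₂-cong f′ (▷₂-comm f″ y c) i) (▷₂-comm f′ y _ i)))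
    }
    where
    open ≡-Reasoning
    f′ = frob₂ f
    f″ = frob₂ f′
    spanning : ∀ {c} → Fixed c → (∀ i → i ≤ 2 → (f′ ▷₂ f″ ▷₂ c) i ≡ 0#) → ∀ i → i ≤ 6 → c i ≡ 0#
    -- The factors are removed in two stages, each gaining two indices (2, 4, 6): `f″ ▷₂ c` is
    -- killed by `f′` and, after conjugation, by `f`; then `c` itself is killed by the conjugates
    -- `f` and `f′`.
    spanning {c} fix zer = annihilated₂ f f′ res≢0 3 f▷≡0 (λ i i≤4 → zero-conj (▷₂-fixed f fix i) (f▷≡0 i i≤4))
      where
      conj : ∀ i → frob ((f′ ▷₂ f″ ▷₂ c) i) ≡ (f ▷₂ f″ ▷₂ c) i
      conj i = begin
        frob ((f′ ▷₂ f″ ▷₂ c) i)     ≡⟨ trans (frob-▷₂ f′ _ i) (▷₂-cong f″ (▷₂-fixed f″ fix) i) ⟩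
        (f″ ▷₂ frob₂ f″ ▷₂ c) i      ≡⟨ cong (λ g → (f″ ▷₂ g ▷₂ c) i) (frob₂³ f) ⟩
        (f″ ▷₂ f ▷₂ c) i             ≡⟨ ▷₂-comm f″ f c i ⟩
        (f ▷₂ f″ ▷₂ c) i             ∎
      f″▷≡0 : ∀ i → i ≤ 4 → (f″ ▷₂ c) i ≡ 0#
      f″▷≡0 = annihilated₂ f f′ res≢0 1 (λ i i≤2 → zero-conj (conj i) (zer i i≤2)) zer
      f▷≡0 : ∀ i → i ≤ 4 → (f ▷₂ c) i ≡ 0#
      f▷≡0 i i≤4 = zero-conj (trans (▷₂-fixed f″ fix i) (cong (λ g → (g ▷₂ c) i) (frob₂³ f))) (f″▷≡0 i i≤4)

  opaque
    unfolding _▷₁_ _▷₂_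

    proportional : ∀ {f f₀ : Triple} {s : Carrier} → (let a₀ , a₁ , a₂ = f ; b₀ , b₁ , b₂ = f₀) →
                   a₀ ≡ s * b₀ → a₁ ≡ s * b₁ → a₂ ≡ s * b₂ → ∀ c → f ▷₂ c ≗ λ i → s * (f₀ ▷₂ c) i
    proportional {_} {b₀ , b₁ , b₂} {s} refl refl refl c i = solve 7
      (λ s a b d x y z → s :* a :* x :+ s :* b :* y :+ s :* d :* z := s :* (a :* x :+ b :* y :+ d :* z))
          refl s b₀ b₁ b₂ _ _ _

  -- The hypothesis is the vanishing of the determinant of `(a , b)` and its conjugate, that is, the
  -- equation (a / b)^q = a / b with denominators cleared.
  frob-ratio : ∀ {a b r} → r * b ≡ 1# → b * frob a ≡ a * frob b → frob (r * a) ≡ r * a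
  frob-ratio {a} {b} {r} rb≡1 eq = begin
    frob (r * a)                            ≡⟨ frob-* r a ⟩
    frob r * frob a                         ≡⟨ *-identityˡ _ ⟨
    1# * (frob r * frob a)                  ≡⟨ cong (_* (frob r * frob a)) rb≡1 ⟨
    r * b * (frob r * frob a)               ≡⟨ solve 4 (λ r b u v → r :* b :* (u :* v)
        := r :* u :* (b :* v)) refl r b (frob r) (frob a) ⟩
    r * frob r * (b * frob a)               ≡⟨ cong (r * frob r *_) eq ⟩
    r * frob r * (a * frob b)               ≡⟨ solve 4 (λ r a u v → r :* u :* (a :* v)
        := r :* a :* (u :* v)) refl r a (frob r) (frob b) ⟩
    r * a * (frob r * frob b)               ≡⟨ cong (r * a *_) (trans (sym (frob-* r b)) (cong frob rb≡1)) ⟩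
    r * a * frob 1#                         ≡⟨ cong (r * a *_) frob-1 ⟩
    r * a * 1#                              ≡⟨ *-identityʳ _ ⟩
    r * a                                   ∎
    where open ≡-Reasoning

  undo : ∀ {r s a} → r * s ≡ 1# → a ≡ s * (r * a)
  undo {r} {s} {a} rs≡1 = sym (trans (solve 3 (λ r s a → s :* (r :* a) := r :* s :* a) refl r s a)
    (trans (cong (_* a) rs≡1) (*-identityˡ a)))

  -- Scaling a nonzero coefficient to 1 makes all coefficients fixed by frob.
  rational-multiple : ∀ f → f ≢ 0₃ → (let f₀ , f₁ , f₂ = f) →
    f₀ * frob f₁ ≡ f₁ * frob f₀ → f₀ * frob f₂ ≡ f₂ * frob f₀ → f₁ * frob f₂ ≡ f₂ * frob f₁ → Multiplier f 0
  rational-multiple f@(f₀ , f₁ , f₂) f≢0 p r s with f₀ ≟ 0# | f₁ ≟ 0# | f₂ ≟ 0#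
  ... | no f₀≢0 | _ | _ = let t , tf≡1 = inverse f₀ f₀≢0 in
    multiplier₀ {f₀ = t * f₀ , t * f₁ , t * f₂} tf≡1
      (cong₂ _,_ (frob-ratio tf≡1 refl) (cong₂ _,_ (frob-ratio tf≡1 p) (frob-ratio tf≡1 r)))
      (proportional (undo tf≡1) (undo tf≡1) (undo tf≡1))
  ... | yes _ | no f₁≢0 | _ = let t , tf≡1 = inverse f₁ f₁≢0 in
    multiplier₀ {f₀ = t * f₀ , t * f₁ , t * f₂} tf≡1
      (cong₂ _,_ (frob-ratio tf≡1 (sym p)) (cong₂ _,_ (frob-ratio tf≡1 refl) (frob-ratio tf≡1 s)))
      (proportional (undo tf≡1) (undo tf≡1) (undo tf≡1))
  ... | yes _ | yes _ | no f₂≢0 = let t , tf≡1 = inverse f₂ f₂≢0 in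
    multiplier₀ {f₀ = t * f₀ , t * f₁ , t * f₂} tf≡1
      (cong₂ _,_ (frob-ratio tf≡1 (sym r)) (cong₂ _,_ (frob-ratio tf≡1 (sym s)) (frob-ratio tf≡1 refl)))
      (proportional (undo tf≡1) (undo tf≡1) (undo tf≡1))
  ... | yes refl | yes refl | yes refl = contradiction refl f≢0

  Classified : Triple → Set
  Classified f = ∃[ n ] (n ≡ 0 ⊎ n ≡ 1 ⊎ n ≡ 2 ⊎ n ≡ 4) × Multiplier f n

  -- f = l m and frob f = l n share the factor l = (1 , ρ). If l is not fixed, it divides
  -- the conjugate of m, so that f is a multiple of the product of frob² l and its conjugate l.
  common-factor : ∀ {f} ρ m → f ≡ (1# , ρ) ⊗ m → f ≢ 0₃ →
                  (frob₂ f) ∙₃ (ρ * ρ , - ρ , 1#) ≡ 0# →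
                  (let f₀ , f₁ , f₂ = f) → f₀ * frob f₁ - f₁ * frob f₀ ≢ 0# → Classified f
  common-factor ρ m@(m₀ , m₁) refl f≢0 root p≢0 with frob ρ ≟ ρ
  ... | yes fix = 2 , inj₂ (inj₂ (inj₁ refl)) , multiplier₂ (cong₂ _,_ frob-1 fix) det≢0
    where
    det≢0 : det₂ m (frob₁ m) ≢ 0#
    det≢0 det≡0 = p≢0 (trans
      (cong₂ (λ u v → f₀ * u - f₁ * v) (trans (frob-+ _ _) (cong₂ _+_ (trans (frob-* _ _)
          (cong (_* frob m₁) frob-1))
          (trans (frob-* _ _) (cong (_* frob m₀) fix))))
        (trans (frob-* _ _) (cong (_* frob m₀) frob-1)))
      (minor-⊗ {1# , ρ} {m} {frob₁ m} det≡0))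
      where
      f₀ = proj₁ ((1# , ρ) ⊗ m)
      f₁ = proj₁ (proj₂ ((1# , ρ) ⊗ m))
  ... | no ρ′≢ρ = 1 , inj₂ (inj₁ refl) ,
    multiplier₁ {m = l″} {s = m₀} {r = r} det≢0 rm₀≡1 λ c i →
      trans (proportional {f₀ = (1# , ρ) ⊗ l″} e₀≡ e₁≡ e₂≡ c i) (cong (m₀ *_) (trans (⊗-▷ (1# , ρ) l″ c i)
        (trans (▷₁-comm (1# , ρ) l″ c i) (trans (sym (⊗-▷ l″ (1# , ρ) c i)) (cong (λ n → ((l″ ⊗ n) ▷₂ c) i)
            (sym l‴≡l))))))
    where
    open ≡-Reasoning
    ρ′ = frob ρ
    ρ″ = frob ρ′
    l″ = (1# , ρ″)
    l‴≡l : frob₁ l″ ≡ (1# , ρ)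
    l‴≡l = cong₂ _,_ frob-1 (frob³ ρ)
    -- The root (ρ , -1) of l is not a root of the conjugate of l, so it is one of the conjugate of m.
    m′≡ : frob m₁ ≡ frob m₀ * ρ
    m′≡ = sym (x-y≡0⇒x≡y (*-cancelˡ-0 (λ eq → ρ′≢ρ (sym (x-y≡0⇒x≡y eq))) (begin
      (ρ - ρ′) * (frob m₀ * ρ - frob m₁)
        ≡⟨ solve 4 (λ ρ σ a b → (ρ :- σ) :* (a :* ρ :- b)
          := :1 :* a :* (ρ :* ρ) :+ (:1 :* b :+ σ :* a) :* (:- ρ) :+ σ :* b :* :1)
              refl ρ ρ′ (frob m₀) (frob m₁) ⟩
      (((1# , ρ′) ⊗ frob₁ m) ∙₃ (ρ * ρ , - ρ , 1#))
        ≡⟨ cong (λ g → g ∙₃ (ρ * ρ , - ρ , 1#)) (cong₂ _,_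
             (trans (frob-* _ _) (cong (_* frob m₀) frob-1)) (cong₂ _,_
             (trans (frob-+ _ _) (cong₂ _+_ (trans (frob-* _ _)
                 (cong (_* frob m₁) frob-1)) (frob-* _ _))) (frob-* _ _))) ⟨
      frob₂ ((1# , ρ) ⊗ m) ∙₃ (ρ * ρ , - ρ , 1#)
        ≡⟨ root ⟩
      0# ∎)))
    m₁≡ : m₁ ≡ m₀ * ρ″
    m₁≡ = begin
      m₁                          ≡⟨ frob³ m₁ ⟨
      frob (frob (frob m₁))       ≡⟨ cong (frob ∘ frob) m′≡ ⟩
      frob (frob (frob m₀ * ρ))   ≡⟨ trans (cong frob (frob-* _ _)) (frob-* _ _) ⟩
      frob (frob (frob m₀)) * ρ″  ≡⟨ cong (_* ρ″) (frob³ m₀) ⟩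
      m₀ * ρ″                     ∎
    e₀≡ : 1# * m₀ ≡ m₀ * (1# * 1#)
    e₀≡ = solve 1 (λ m → :1 :* m := m :* (:1 :* :1)) refl m₀
    e₁≡ : 1# * m₁ + ρ * m₀ ≡ m₀ * (1# * ρ″ + ρ * 1#)
    e₁≡ = trans (cong (λ z → 1# * z + ρ * m₀) m₁≡) (solve 3 (λ m ρ σ → :1 :* (m :* σ) :+ ρ :* m
      := m :* (:1 :* σ :+ ρ :* :1)) refl m₀ ρ ρ″)
    e₂≡ : ρ * m₁ ≡ m₀ * (ρ * ρ″)
    e₂≡ = trans (cong (ρ *_) m₁≡) (solve 3 (λ m ρ σ → ρ :* (m :* σ) := m :* (ρ :* σ)) refl m₀ ρ ρ″)
    m₀≢0 : m₀ ≢ 0#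
    m₀≢0 eq = f≢0 (cong₂ _,_ (zer e₀≡) (cong₂ _,_ (zer e₁≡) (zer e₂≡)))
      where
      zer : ∀ {x y} → x ≡ m₀ * y → x ≡ 0#
      zer refl = trans (cong (_* _) eq) (zeroˡ _)
    r = proj₁ (inverse m₀ m₀≢0)
    rm₀≡1 = proj₂ (inverse m₀ m₀≢0)
    det≢0 : det₂ l″ (frob₁ l″) ≢ 0#
    det≢0 eq = ρ′≢ρ (begin
      frob ρ                  ≡⟨ cong frob (x-y≡0⇒x≡y (trans (solve 2 (λ ρ σ → ρ :- σ
                                   := :1 :* ρ :- σ :* :1) refl ρ ρ″)
                                   (trans (cong (λ n → det₂ l″ n) (sym l‴≡l)) eq))) ⟩
      frob ρ″                 ≡⟨ frob³ ρ ⟩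
      ρ                       ∎)

  -- The resultant is the square of the middle minor minus the product of the other two, so it
  -- reduces to that square when the first minor is zero.
  middle-minor : ∀ {f g : Triple} → (let f₀ , f₁ , f₂ = f ; g₀ , g₁ , g₂ = g) →
    resultant f g ≡ 0# → f₀ * g₁ - f₁ * g₀ ≡ 0# → f₀ * g₂ - f₂ * g₀ ≡ 0#
  middle-minor {f₀ , f₁ , f₂} {g₀ , g₁ , g₂} res≡0 p≡0 with f₀ * g₂ - f₂ * g₀ ≟ 0#
  ... | yes eq = eq
  ... | no r≢0 = *-cancelˡ-0 r≢0 (trans (sym (trans (cong (λ z → r * r - z * (f₁ * g₂ - f₂ * g₁)) p≡0)
      (solve 2 (λ a b → a :- :0 :* b := a) refl (r * r) (f₁ * g₂ - f₂ * g₁)))) res≡0)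
    where r = f₀ * g₂ - f₂ * g₀

  classify : ∀ f → f ≢ 0₃ → Classified f
  classify f@(f₀ , f₁ , f₂) f≢0 with resultant f (frob₂ f) ≟ 0#
  ... | no res≢0 = 4 , inj₂ (inj₂ (inj₂ refl)) , multiplier₄ res≢0
  ... | yes res≡0 with f₀ * frob f₁ - f₁ * frob f₀ ≟ 0#
  -- With f = f₀ s² + f₁ s t + f₂ t² and g its conjugate, f₀ g - g₀ f = t (p s + (f₀ g₂ - f₂ g₀) t).
  -- As p is nonzero, t is not a common factor, so the common factor is s + ρ t with ρ = (f₀ g₂ - f₂
  -- g₀) / p. The second argument is the quotient of f by it.
  ... | no p≢0 = let r , rp≡1 = inverse p p≢0 in
    common-factor (r * (f₀ * g₂ - f₂ * g₀)) (f₀ , f₁ - r * (f₀ * g₂ - f₂ * g₀) * f₀)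
      (cong₂ _,_ (sym (*-identityˡ f₀)) (cong₂ _,_
        (solve 3 (λ a b ρ → b := :1 :* (b :- ρ :* a) :+ ρ :* a) refl f₀ f₁ (r * (f₀ * g₂ - f₂ * g₀)))
        (x-y≡0⇒x≡y (trans (sym (vieta f₀ f₁ f₂ _)) (root r rp≡1 f₀ f₁ f₂ (expand-f f₀ f₁ f₂ g₀ g₁ g₂))))))
      f≢0
      (trans (vieta′ g₀ g₁ g₂ _) (root r rp≡1 g₀ g₁ g₂ (expand-g f₀ f₁ f₂ g₀ g₁ g₂)))
      p≢0
    where
    open ≡-Reasoning
    g₀ = frob f₀
    g₁ = frob f₁
    g₂ = frob f₂
    p = f₀ * frob f₁ - f₁ * frob f₀
    vieta : ∀ a b c ρ → a * (ρ * ρ) + b * (- ρ) + c ≡ c - ρ * (b - ρ * a)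
    vieta = solve 4 (λ a b c ρ → a :* (ρ :* ρ) :+ b :* (:- ρ) :+ c := c :- ρ :* (b :- ρ :* a)) refl
    vieta′ : ∀ a b c ρ → a * (ρ * ρ) + b * (- ρ) + c * 1# ≡ a * (ρ * ρ) + b * (- ρ) + c
    vieta′ a b c ρ = cong (a * (ρ * ρ) + b * (- ρ) +_) (*-identityʳ c)
    -- The value of the first form at the candidate root, cleared of the denominator p, is its
    -- leading coefficient times the resultant; `expand-g` is the same for the conjugate form.
    expand-f : ∀ a b c d e f → a * ((a * f - c * d) * (a * f - c * d)) - b * ((a * f - c * d) * (a * e - b * d))
                               + c * ((a * e - b * d) * (a * e - b * d))
                             ≡ a * ((a * f - c * d) * (a * f - c * d) - (a * e - b * d) * (b * f - c * e))
    expand-f = solve 6 (λ a b c d e f → a :* ((a :* f :- c :* d) :* (a :* f :- c :* d)) :- b :* ((a :* f :- c :* d) :* (a :* e :- b :* d))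
                               :+ c :* ((a :* e :- b :* d) :* (a :* e :- b :* d))
                             := a :* ((a :* f :- c :* d) :* (a :* f :- c :* d) :- (a :* e :- b :* d) :* (b :* f :- c :* e))) refl
    expand-g : ∀ a b c d e f → d * ((a * f - c * d) * (a * f - c * d)) - e * ((a * f - c * d) * (a * e - b * d))
                               + f * ((a * e - b * d) * (a * e - b * d))
                             ≡ d * ((a * f - c * d) * (a * f - c * d) - (a * e - b * d) * (b * f - c * e))
    expand-g = solve 6 (λ a b c d e f → d :* ((a :* f :- c :* d) :* (a :* f :- c :* d)) :- e :* ((a :* f :- c :* d) :* (a :* e :- b :* d))
                               :+ f :* ((a :* e :- b :* d) :* (a :* e :- b :* d))
                             := d :* ((a :* f :- c :* d) :* (a :* f :- c :* d) :- (a :* e :- b :* d) :* (b :* f :- c :* e))) refl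
    root : ∀ r → r * p ≡ 1# → ∀ a b c → (let s = f₀ * g₂ - f₂ * g₀) →
           a * (s * s) - b * (s * p) + c * (p * p) ≡ a * resultant f (frob₂ f) →
           a * (r * s * (r * s)) + b * (- (r * s)) + c ≡ 0#
    root r rp≡1 a b c eq = begin
      a * (r * s * (r * s)) + b * (- (r * s)) + c
        ≡⟨ solve 5 (λ a b c r s → a :* (r :* s :* (r :* s)) :+ b :* (:- (r :* s)) :+ c
             := a :* (r :* r :* (s :* s)) :- b :* (r :* s :* :1) :+ c :* (:1 :* :1)) refl a b c r s ⟩
      a * (r * r * (s * s)) - b * (r * s * 1#) + c * (1# * 1#)
        ≡⟨ cong (λ z → a * (r * r * (s * s)) - b * (r * s * z) + c * (z * z)) rp≡1 ⟨
      a * (r * r * (s * s)) - b * (r * s * (r * p)) + c * (r * p * (r * p))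
        ≡⟨ solve 6 (λ a b c r s p → a :* (r :* r :* (s :* s)) :- b :* (r :* s :* (r :* p)) :+ c :* (r :* p :* (r :* p))
             := r :* r :* (a :* (s :* s) :- b :* (s :* p) :+ c :* (p :* p))) refl a b c r s p ⟩
      r * r * (a * (s * s) - b * (s * p) + c * (p * p))
        ≡⟨ cong (r * r *_) (trans eq (trans (cong (a *_) res≡0) (zeroʳ a))) ⟩
      r * r * 0#
        ≡⟨ zeroʳ _ ⟩
      0# ∎
      where s = f₀ * g₂ - f₂ * g₀
  ... | yes p≡0 with f₁ * frob f₂ - f₂ * frob f₁ ≟ 0#
  ... | yes s≡0 = 0 , inj₁ refl , rational-multiple f f≢0 (x-y≡0⇒x≡y p≡0) (x-y≡0⇒x≡y (middle-minor res≡0 p≡0)) (x-y≡0⇒x≡y s≡0)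
  -- Only the last of the three minors is nonzero. Expanding a determinant in which the row f is
  -- repeated then gives f₀ = 0, so f is divisible by t, which is defined over `K`.
  ... | no s≢0 = 2 , inj₂ (inj₂ (inj₁ refl)) , subst (λ g → Multiplier g 2)
      (cong₂ _,_ (trans (zeroˡ _) (sym f₀≡0)) (cong₂ _,_
        (solve 2 (λ a b → :0 :* b :+ :1 :* a := a) refl f₁ f₂) (*-identityˡ f₂)))
      (multiplier₂ {0# , 1#} {f₁ , f₂} (cong₂ _,_ frob-0 frob-1) s≢0)
    where
    f₀≡0 : f₀ ≡ 0#
    f₀≡0 = *-cancelʳ-0 s≢0 (trans
      (solve 6 (λ a b c d e f → a :* (b :* f :- c :* e)
          := b :* (a :* f :- c :* d) :- c :* (a :* e :- b :* d)) refl
        f₀ f₁ f₂ (frob f₀) (frob f₁) (frob f₂))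
      (trans (cong₂ (λ u v → f₁ * u - f₂ * v) (middle-minor res≡0 p≡0) p≡0) (solve 2
          (λ a b → a :* :0 :- b :* :0 := :0) refl _ _)))

-- Coordinates for embeddings of PG(2, q)

module Triples (F : Field) where
  open FieldFacts F
  open Sequences F using (Triple; 0₃; e₀; e₁; e₂; _∙₃_) public

  infixl 6 _+₃_
  infixr 7 _·₃_

  _+₃_ : Triple → Triple → Triple
  (a , b , c) +₃ (x , y , z) = a + x , b + y , c + z

  _·₃_ : Carrier → Triple → Triple
  s ·₃ (x , y , z) = s * x , s * y , s * z

  triple-≡ : ∀ {a b c x y z : Carrier} → a ≡ x → b ≡ y → c ≡ z → (a , b , c) ≡ (x , y , z)
  triple-≡ refl refl refl = refl

  Independent₂ : Triple → Triple → Set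
  Independent₂ x y = ∀ a b → a ·₃ x +₃ b ·₃ y ≡ 0₃ → a ≡ 0# × b ≡ 0#

  OnLine : Triple → Triple → Triple → Set
  OnLine x y z = ∃₂ λ a b → z ≡ a ·₃ x +₃ b ·₃ y

  ∙₃-scale : ∀ l s v → l ∙₃ (s ·₃ v) ≡ s * (l ∙₃ v)
  ∙₃-scale (a , b , c) s (x , y , z) = solve 7
    (λ a b c s x y z → a :* (s :* x) :+ b :* (s :* y) :+ c :* (s :* z) := s :* (a :* x :+ b :* y :+ c :* z))
        refl a b c s x y z

  opaque
    Triple-order : ∀ {n} → HasOrder F n → Triple ↔ Fin (n ℕ.* (n ℕ.* n))
    Triple-order order = compose (order ×-↔ compose (order ×-↔ order) (symmetry Fin.*↔×)) (symmetry Fin.*↔×)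

  left-inverse⇒right-inverse : ∀ {n} → HasOrder F n → (f g : Triple → Triple) → (∀ w → g (f w) ≡ w) → ∀ v → f (g v) ≡ v
  left-inverse⇒right-inverse order f g gf≡id v =
    let w , fw≡v = injection⇒surjection (Triple-order order) (Triple-order order) f (cong f)
                     (λ {x} {y} eq → trans (sym (gf≡id x)) (trans (cong g eq) (gf≡id y))) v
    in trans (cong (f ∘ g) (sym fw≡v)) (trans (cong f (gf≡id w)) fw≡v)

-- Line-preserving maps from PG(2, q)

module Fundamental {K L : Field} {q : ℕ} (6≤q : 6 ≤ q) (K-order : HasOrder K q) (L-order : HasOrder L (q ℕ.^ 3))
                   (E : FieldExtension K L) where
  private
    module K where
      open FieldFacts K public
      open Triples K public
      open FiniteField K K-order public
  open FieldExtension E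
  open FieldFacts L
  open FiniteField L L-order
  open Frobenius 6≤q K-order L-order E
  open Triples L
  open Multipliers 6≤q K-order L-order E using (Parameter; point)

  -- The map `f` picks any representative of each image point, with no compatibility between the
  -- values at proportional vectors. The equivalence also keeps points off the line away from its
  -- image, which is what makes the coordinate map injective.
  record LineImage (f : K.Triple → Triple) (x y : K.Triple) : Set where
    field
      l     : Triple
      l≢0   : l ≢ 0₃
      image : ∀ z → z ≢ K.0₃ → K.OnLine x y z ⇔ l ∙₃ f z ≡ 0#

    on : ∀ {z} → z ≢ K.0₃ → K.OnLine x y z → l ∙₃ f z ≡ 0#
    on z≢0 = Equivalence.to (image _ z≢0)

    off : ∀ {z} → z ≢ K.0₃ → ¬ K.OnLine x y z → l ∙₃ f z ≢ 0#
    off z≢0 ∉ eq = ∉ (Equivalence.from (image _ z≢0) eq)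

  PreservesLines : (K.Triple → Triple) → Set
  PreservesLines f = ∀ x y → K.Independent₂ x y → LineImage f x y

  ⟨_,_⟩ : K.Carrier → K.Carrier → K.Triple
  ⟨ x , y ⟩ = K.1# , x , y

  unit : K.Triple
  unit = ⟨ K.1# , K.1# ⟩

  affine≢0 : ∀ {x y} → ⟨ x , y ⟩ ≢ K.0₃
  affine≢0 eq = K.1≢0 (cong proj₁ eq)

  e₀≢0 : K.e₀ ≢ K.0₃
  e₀≢0 eq = K.1≢0 (cong proj₁ eq)

  e₁≢0 : K.e₁ ≢ K.0₃
  e₁≢0 eq = K.1≢0 (cong (proj₁ ∘ proj₂) eq)

  e₂≢0 : K.e₂ ≢ K.0₃
  e₂≢0 eq = K.1≢0 (cong (proj₂ ∘ proj₂) eq)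

  endˡ : ∀ x y → K.OnLine x y x
  endˡ (a , b , c) (x , y , z) = K.1# , K.0# , K.triple-≡ (eq a x) (eq b y) (eq c z)
    where
    eq : ∀ a x → a ≡ K.1# K.* a K.+ K.0# K.* x
    eq = K.solve 2 (λ a x → a K.:= K.:1 K.:* a K.:+ K.:0 K.:* x) refl

  endʳ : ∀ x y → K.OnLine x y y
  endʳ (a , b , c) (x , y , z) = K.0# , K.1# , K.triple-≡ (eq a x) (eq b y) (eq c z)
    where
    eq : ∀ a x → x ≡ K.0# K.* a K.+ K.1# K.* x
    eq = K.solve 2 (λ a x → x K.:= K.:0 K.:* a K.:+ K.:1 K.:* x) refl

  private
    0*+1* : ∀ a b → a K.* K.0# K.+ b K.* K.1# ≡ b
    0*+1* = K.solve 2 (λ a b → a K.:* K.:0 K.:+ b K.:* K.:1 K.:= b) refl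

    1*+0* : ∀ a b → a K.* K.1# K.+ b K.* K.0# ≡ a
    1*+0* = K.solve 2 (λ a b → a K.:* K.:1 K.:+ b K.:* K.:0 K.:= a) refl

    1*+* : ∀ {a b x} → b ≡ K.0# → a K.* K.1# K.+ b K.* x ≡ K.0# → a ≡ K.0#
    1*+* {a} {x = x} refl eq = trans (K.solve 2 (λ a x → a K.:= a K.:* K.:1 K.:+ K.:0 K.:* x) refl a x) eq

    0*+0* : ∀ a b → a K.* K.0# K.+ b K.* K.0# ≡ K.0#
    0*+0* = K.solve 2 (λ a b → a K.:* K.:0 K.:+ b K.:* K.:0 K.:= K.:0) refl

  independent-e₂ : ∀ x y → K.Independent₂ K.e₂ ⟨ x , y ⟩
  independent-e₂ x y a b eq = let b≡0 = trans (sym (0*+1* a b)) (cong proj₁ eq) in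
    1*+* b≡0 (cong (proj₂ ∘ proj₂) eq) , b≡0

  independent-e₁ : ∀ x y → K.Independent₂ K.e₁ ⟨ x , y ⟩
  independent-e₁ x y a b eq = let b≡0 = trans (sym (0*+1* a b)) (cong proj₁ eq) in
    1*+* b≡0 (cong (proj₁ ∘ proj₂) eq) , b≡0

  independent-e₀ : ∀ y → K.Independent₂ K.e₀ ⟨ K.1# , y ⟩
  independent-e₀ y a b eq = let b≡0 = trans (sym (0*+1* a b)) (cong (proj₁ ∘ proj₂) eq) in
    1*+* b≡0 (cong proj₁ eq) , b≡0

  independent-e₁e₂ : K.Independent₂ K.e₁ K.e₂
  independent-e₁e₂ a b eq = trans (sym (1*+0* a b)) (cong (proj₁ ∘ proj₂) eq) , trans (sym (0*+1* a b))
      (cong (proj₂ ∘ proj₂) eq)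

  independent-e₀e₂ : K.Independent₂ K.e₀ K.e₂
  independent-e₀e₂ a b eq = trans (sym (1*+0* a b)) (cong proj₁ eq) , trans (sym (0*+1* a b))
      (cong (proj₂ ∘ proj₂) eq)

  independent-e₀e₁ : K.Independent₂ K.e₀ K.e₁
  independent-e₀e₁ a b eq = trans (sym (1*+0* a b)) (cong proj₁ eq) , trans (sym (0*+1* a b))
      (cong (proj₁ ∘ proj₂) eq)

  off-e₁e₂ : ∀ {x y z} → x ≢ K.0# → ¬ K.OnLine K.e₁ K.e₂ (x , y , z)
  off-e₁e₂ x≢0 (a , b , eq) = x≢0 (trans (cong proj₁ eq) (0*+0* a b))

  off-e₀e₂ : ∀ {x y z} → y ≢ K.0# → ¬ K.OnLine K.e₀ K.e₂ (x , y , z)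
  off-e₀e₂ y≢0 (a , b , eq) = y≢0 (trans (cong (proj₁ ∘ proj₂) eq) (0*+0* a b))

  off-e₀e₁ : ∀ {x y z} → z ≢ K.0# → ¬ K.OnLine K.e₀ K.e₁ (x , y , z)
  off-e₀e₁ z≢0 (a , b , eq) = z≢0 (trans (cong (proj₂ ∘ proj₂) eq) (0*+0* a b))

  conicPoint : Parameter → K.Triple
  conicPoint (just θ) = ⟨ θ , θ K.* θ ⟩
  conicPoint nothing  = K.e₂

  module Normalised (g : K.Triple → Triple) (g-lines : PreservesLines g)
                    {d₀ d₁ d₂ : Carrier} (d₀≢0 : d₀ ≢ 0#) (d₁≢0 : d₁ ≢ 0#) (d₂≢0 : d₂ ≢ 0#)
                    (g-e₀ : g K.e₀ ≡ (d₀ , 0# , 0#)) (g-e₁ : g K.e₁ ≡ (0# , d₁ , 0#)) (g-e₂ : g K.e₂ ≡ (0# , 0# , d₂))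
                    (g-unit : g unit ≡ (1# , 1# , 1#)) where
    open LineImage

    through-e₀ : ∀ {x y} (ℓ : LineImage g x y) → K.OnLine x y K.e₀ → proj₁ (l ℓ) ≡ 0#
    through-e₀ ℓ e₀∈ = *-cancelʳ-0 d₀≢0 (trans
      (solve 4 (λ a b c d → a :* d := a :* d :+ b :* :0 :+ c :* :0) refl _ _ _ d₀)
      (trans (cong (l ℓ ∙₃_) (sym g-e₀)) (on ℓ e₀≢0 e₀∈)))

    through-e₁ : ∀ {x y} (ℓ : LineImage g x y) → K.OnLine x y K.e₁ → proj₁ (proj₂ (l ℓ)) ≡ 0#
    through-e₁ ℓ e₁∈ = *-cancelʳ-0 d₁≢0 (trans
      (solve 4 (λ a b c d → b :* d := a :* :0 :+ b :* d :+ c :* :0) refl _ _ _ d₁)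
      (trans (cong (l ℓ ∙₃_) (sym g-e₁)) (on ℓ e₁≢0 e₁∈)))

    through-e₂ : ∀ {x y} (ℓ : LineImage g x y) → K.OnLine x y K.e₂ → proj₂ (proj₂ (l ℓ)) ≡ 0#
    through-e₂ ℓ e₂∈ = *-cancelʳ-0 d₂≢0 (trans
      (solve 4 (λ a b c d → c :* d := a :* :0 :+ b :* :0 :+ c :* d) refl _ _ _ d₂)
      (trans (cong (l ℓ ∙₃_) (sym g-e₂)) (on ℓ e₂≢0 e₂∈)))

    -- Two points of a line through a coordinate vertex have the same ratio of the other two coordinates.
    same-ratio : ∀ {l₁ l₂ b c β γ} → (l₁ ≡ 0# → l₂ ≡ 0# → ⊥) → b ≢ 0# →
                 l₁ * b + l₂ * c ≡ 0# → l₁ * β + l₂ * γ ≡ 0# → b * γ ≡ c * β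
    same-ratio {l₁} {l₂} {b} {c} {β} {γ} nontrivial b≢0 eq eq′ = x-y≡0⇒x≡y (*-cancelˡ-0 l₂≢0 (trans
      (solve 6 (λ l m b c β γ → m :* (b :* γ :- c :* β)
          := b :* (l :* β :+ m :* γ) :- β :* (l :* b :+ m :* c)) refl l₁ l₂ b c β γ)
      (trans (cong₂ (λ u v → b * u - β * v) eq′ eq) (solve 2 (λ b β → b :* :0 :- β :* :0 := :0) refl b β))))
      where
      l₂≢0 : l₂ ≢ 0#
      l₂≢0 refl = nontrivial (*-cancelʳ-0 b≢0 (trans (solve 3 (λ l b c → l :* b := l :* b :+ :0 :* c)
          refl l₁ b c) eq)) refl

    drop₀ : ∀ {a b c x y z : Carrier} → a ≡ 0# → (a , b , c) ∙₃ (x , y , z) ≡ 0# → b * y + c * z ≡ 0#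
    drop₀ {b = b} {c} {x} {y} {z} refl eq = trans (solve 5 (λ b c x y z → b :* y :+ c :* z
        := :0 :* x :+ b :* y :+ c :* z) refl b c x y z) eq

    drop₁ : ∀ {a b c x y z : Carrier} → b ≡ 0# → (a , b , c) ∙₃ (x , y , z) ≡ 0# → a * x + c * z ≡ 0#
    drop₁ {a} {c = c} {x} {y} {z} refl eq = trans (solve 5 (λ a c x y z → a :* x :+ c :* z
        := a :* x :+ :0 :* y :+ c :* z) refl a c x y z) eq

    drop₂ : ∀ {a b c x y z : Carrier} → c ≡ 0# → (a , b , c) ∙₃ (x , y , z) ≡ 0# → a * x + b * y ≡ 0#
    drop₂ {a} {b} {x = x} {y} {z} refl eq = trans (solve 5 (λ a b x y z → a :* x :+ b :* y
        := a :* x :+ b :* y :+ :0 :* z) refl a b x y z) eq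

    first second third : K.Triple → Carrier
    first  z = proj₁ (g z)
    second z = proj₁ (proj₂ (g z))
    third  z = proj₂ (proj₂ (g z))

    first≢0 : ∀ x y → first ⟨ x , y ⟩ ≢ 0#
    first≢0 x y eq = off ℓ affine≢0 (off-e₁e₂ K.1≢0) (trans
      (cong₂ _+_ (cong₂ _+_ (trans (cong (_ *_) eq) (zeroʳ _)) (trans
          (cong (_* second ⟨ x , y ⟩) (through-e₁ ℓ (endˡ _ _))) (zeroˡ _)))
        (trans (cong (_* third ⟨ x , y ⟩) (through-e₂ ℓ (endʳ _ _))) (zeroˡ _)))
      (trans (+-identityʳ _) (+-identityʳ _)))
      where ℓ = g-lines K.e₁ K.e₂ independent-e₁e₂

    -- The scale is read off on the diagonal joining `K.e₀` to `unit`: the image of (1, x, x) is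
    -- proportional to (1, σ x, σ x).
    σ : K.Carrier → Carrier
    σ x = proj₁ (inverse _ (first≢0 x x)) * second ⟨ x , x ⟩

    second-diagonal : ∀ x → second ⟨ x , x ⟩ ≡ first ⟨ x , x ⟩ * σ x
    second-diagonal x = let y , yx≡1 = inverse _ (first≢0 x x) in
      sym (trans (solve 3 (λ a b y → a :* (y :* b) := y :* a :* b) refl (first ⟨ x , x ⟩) (second ⟨ x , x ⟩) y)
        (trans (cong (_* second ⟨ x , x ⟩) yx≡1) (*-identityˡ _)))

    third-diagonal : ∀ x → third ⟨ x , x ⟩ ≡ first ⟨ x , x ⟩ * σ x
    third-diagonal x = trans (trans (sym (*-identityˡ _)) (trans (same-ratio nontrivial 1≢0 unit∈ point∈)
        (*-identityˡ _))) (second-diagonal x)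
      where
      ℓ = g-lines K.e₀ unit (independent-e₀ K.1#)
      l₀≡0 = through-e₀ ℓ (endˡ _ _)
      nontrivial = λ l₁≡0 l₂≡0 → l≢0 ℓ (triple-≡ l₀≡0 l₁≡0 l₂≡0)
      unit∈ = drop₀ l₀≡0 (trans (cong (l ℓ ∙₃_) (sym g-unit)) (on ℓ affine≢0 (endʳ K.e₀ unit)))
      point∈ = drop₀ l₀≡0 (on ℓ affine≢0 (K.1# K.- x , x , K.triple-≡
        (K.solve 1 (λ x → K.:1 K.:= (K.:1 K.:- x) K.:* K.:1 K.:+ x K.:* K.:1) refl x)
        (sym (0*+1* _ x)) (sym (0*+1* _ x))))

    -- The points (1, x, y) and (1, x, x) are collinear with `K.e₂`. In `third-affine` the same
    -- point is joined to (1, y, y) by a line through `K.e₁`, so the diagonal determines the images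
    -- of all affine points.
    second-affine : ∀ x y → second ⟨ x , y ⟩ ≡ first ⟨ x , y ⟩ * σ x
    second-affine x y = *-cancelˡ (first≢0 x x) (trans (same-ratio nontrivial (first≢0 x x) diagonal∈ point∈)
      (trans (cong (_* first ⟨ x , y ⟩) (second-diagonal x)) (solve 3 (λ a b s → a :* s :* b
          := a :* (b :* s)) refl _ _ _)))
      where
      ℓ = g-lines K.e₂ ⟨ x , x ⟩ (independent-e₂ x x)
      l₂≡0 = through-e₂ ℓ (endˡ _ _)
      nontrivial = λ l₀≡0 l₁≡0 → l≢0 ℓ (triple-≡ l₀≡0 l₁≡0 l₂≡0)
      diagonal∈ = drop₂ l₂≡0 (on ℓ affine≢0 (endʳ K.e₂ ⟨ x , x ⟩))
      point∈ = drop₂ l₂≡0 (on ℓ affine≢0 (y K.- x , K.1# , K.triple-≡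
        (sym (0*+1* _ _)) (K.solve 2 (λ x y → x K.:= (y K.:- x) K.:* K.:0 K.:+ K.:1 K.:* x) refl x y)
        (K.solve 2 (λ x y → y K.:= (y K.:- x) K.:* K.:1 K.:+ K.:1 K.:* x) refl x y)))

    third-affine : ∀ x y → third ⟨ x , y ⟩ ≡ first ⟨ x , y ⟩ * σ y
    third-affine x y = *-cancelˡ (first≢0 y y) (trans (same-ratio nontrivial (first≢0 y y) diagonal∈ point∈)
      (trans (cong (_* first ⟨ x , y ⟩) (third-diagonal y)) (solve 3 (λ a b s → a :* s :* b
          := a :* (b :* s)) refl _ _ _)))
      where
      ℓ = g-lines K.e₁ ⟨ y , y ⟩ (independent-e₁ y y)
      l₁≡0 = through-e₁ ℓ (endˡ _ _)
      nontrivial = λ l₀≡0 l₂≡0 → l≢0 ℓ (triple-≡ l₀≡0 l₁≡0 l₂≡0)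
      diagonal∈ = drop₁ l₁≡0 (on ℓ affine≢0 (endʳ K.e₁ ⟨ y , y ⟩))
      point∈ = drop₁ l₁≡0 (on ℓ affine≢0 (x K.- y , K.1# , K.triple-≡
        (sym (0*+1* _ _)) (K.solve 2 (λ x y → x K.:= (x K.:- y) K.:* K.:1 K.:+ K.:1 K.:* y) refl x y)
        (K.solve 2 (λ x y → y K.:= (x K.:- y) K.:* K.:0 K.:+ K.:1 K.:* y) refl x y)))

    g-affine : ∀ x y → g ⟨ x , y ⟩ ≡ first ⟨ x , y ⟩ ·₃ (1# , σ x , σ y)
    g-affine x y = triple-≡ (sym (*-identityʳ _)) (second-affine x y) (third-affine x y)

    σ-1 : σ K.1# ≡ 1#
    σ-1 = begin
      σ K.1#                  ≡⟨ *-identityˡ _ ⟨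
      1# * σ K.1#             ≡⟨ cong (_* σ K.1#) (cong proj₁ g-unit) ⟨
      first unit * σ K.1#     ≡⟨ second-diagonal K.1# ⟨
      second unit             ≡⟨ cong (proj₁ ∘ proj₂) g-unit ⟩
      1#                      ∎
      where open ≡-Reasoning

    affine∈ : ∀ {x y a b} (ℓ : LineImage g x y) → K.OnLine x y ⟨ a , b ⟩ → l ℓ ∙₃ (1# , σ a , σ b) ≡ 0#
    affine∈ {a = a} {b} ℓ ∈ = *-cancelˡ-0 (first≢0 a b) (trans (sym (∙₃-scale (l ℓ) _ _))
      (trans (cong (l ℓ ∙₃_) (sym (g-affine a b))) (on ℓ affine≢0 ∈)))

    -- The points (1, 1, y) and (1, x, x y) are collinear with `K.e₀`, so their images have the same
    -- ratio of second to third coordinate; `σ-1` normalises the first of these ratios.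
    σ-* : ∀ x y → σ (x K.* y) ≡ σ x * σ y
    σ-* x y = trans (sym (*-identityˡ _)) (trans (same-ratio nontrivial 1≢0 first∈ point∈) (*-comm _ _))
      where
      ℓ = g-lines K.e₀ ⟨ K.1# , y ⟩ (independent-e₀ y)
      l₀≡0 = through-e₀ ℓ (endˡ _ _)
      nontrivial = λ l₁≡0 l₂≡0 → l≢0 ℓ (triple-≡ l₀≡0 l₁≡0 l₂≡0)
      first∈ = subst (λ z → proj₁ (proj₂ (l ℓ)) * z + proj₂ (proj₂ (l ℓ)) * σ y ≡ 0#) σ-1 (drop₀ l₀≡0 (affine∈ ℓ (endʳ K.e₀ ⟨ K.1# , y ⟩)))
      point∈ = drop₀ l₀≡0 (affine∈ ℓ (K.1# K.- x , x , K.triple-≡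
        (K.solve 1 (λ x → K.:1 K.:= (K.:1 K.:- x) K.:* K.:1 K.:+ x K.:* K.:1) refl x)
        (sym (0*+1* _ x)) (K.solve 2 (λ x y → x K.:* y K.:= (K.:1 K.:- x) K.:* K.:0 K.:+ x K.:* y) refl x y)))

    -- If the values agree, the image of (1, y, y) satisfies the equation of the line joining `K.e₂`
    -- to (1, x, x), and then (1, y, y) lies on that line.
    σ-injective : ∀ {x y} → σ x ≡ σ y → x ≡ y
    σ-injective {x} {y} eq = let a , b , eq′ = Equivalence.from (image ℓ ⟨ y , y ⟩ affine≢0) y∈ in
      sym (trans (cong (proj₁ ∘ proj₂) eq′)
        (trans (cong (λ z → a K.* K.0# K.+ z K.* x) (sym (trans (cong proj₁ eq′) (0*+1* a b))))
          (K.solve 2 (λ a x → a K.:* K.:0 K.:+ K.:1 K.:* x K.:= x) refl a x)))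
      where
      ℓ = g-lines K.e₂ ⟨ x , x ⟩ (independent-e₂ x x)
      y∈ : l ℓ ∙₃ g ⟨ y , y ⟩ ≡ 0#
      y∈ = trans (cong (l ℓ ∙₃_) (g-affine y y)) (trans (∙₃-scale (l ℓ) _ _) (trans (cong (first ⟨ y , y ⟩ *_)
        (subst (λ z → l ℓ ∙₃ (1# , z , z) ≡ 0#) eq (affine∈ ℓ (endʳ K.e₂ ⟨ x , x ⟩)))) (zeroʳ _)))

    σ-^ : ∀ x n → σ (x K.^ n) ≡ σ x ^ n
    σ-^ x zero    = σ-1
    σ-^ x (suc n) = trans (σ-* x (x K.^ n)) (cong (σ x *_) (σ-^ x n))

    τ-spec : ∀ x → ∃[ a ] embed a ≡ σ x
    τ-spec x = frob-fixed (trans (sym (σ-^ x q)) (cong σ (Fermat.x^n≡x K K-order x)))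

    τ : K.Carrier → K.Carrier
    τ x = proj₁ (τ-spec x)

    τ-surjective : ∀ a → ∃[ x ] τ x ≡ a
    τ-surjective = injection⇒surjection K-order K-order τ (cong τ) λ {x} {y} eq →
      σ-injective (trans (sym (proj₂ (τ-spec x))) (trans (cong embed eq) (proj₂ (τ-spec y))))

    -- The coordinates 1, x, x² involve products only, so multiplicativity of `σ` turns the point
    -- with parameter x into the one with parameter `τ x`.
    g-conic : ∀ x → g (conicPoint (just x)) ≡ first ⟨ x , x K.* x ⟩ ·₃ point (just (τ x))
    g-conic x = trans (g-affine x (x K.* x)) (cong (first ⟨ x , x K.* x ⟩ ·₃_)
      (triple-≡ refl (sym (proj₂ (τ-spec x))) (trans (σ-* x x) (sym
          (cong₂ _*_ (proj₂ (τ-spec x)) (proj₂ (τ-spec x)))))))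

    reparametrise : Parameter → Parameter
    reparametrise (just x) = just (τ x)
    reparametrise nothing  = nothing

    reparametrise-surjective : ∀ t → ∃[ s ] reparametrise s ≡ t
    reparametrise-surjective (just a) = let x , eq = τ-surjective a in just x , cong just eq
    reparametrise-surjective nothing  = nothing , refl

    g-parametrised : ∀ s → ∃[ c ] c ≢ 0# × g (conicPoint s) ≡ c ·₃ point (reparametrise s)
    g-parametrised (just x) = _ , first≢0 x (x K.* x) , g-conic x
    g-parametrised nothing  = d₂ , d₂≢0 , trans g-e₂ (triple-≡ (sym (zeroʳ d₂)) (sym (zeroʳ d₂)) (sym
        (*-identityʳ d₂)))

  -- The `xᵢ` are the rows of the matrix from frame coordinates back to homogeneous coordinates;
  -- read as quadratic forms in the parameter they parametrise the image of the conic. `kernel`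
  -- expresses that the matrix is invertible, and `x₀-value` gives a nonzero first row.
  record Coordinatised (f : K.Triple → Triple) : Set where
    field
      x₀ x₁ x₂              : Triple
      x₀-value              : ∃[ w ] x₀ ∙₃ w ≡ 1#
      kernel                : ∀ w → x₀ ∙₃ w ≡ 0# → x₁ ∙₃ w ≡ 0# → x₂ ∙₃ w ≡ 0# → w ≡ 0₃
      reparametrise         : Parameter → Parameter
      reparametrise-surjective : ∀ t → ∃[ s ] reparametrise s ≡ t
      parametrised          : ∀ s → (let t = reparametrise s) → ∃[ c ] c ≢ 0# ×
                              f (conicPoint s) ≡ c ·₃ (x₀ ∙₃ point t , x₁ ∙₃ point t , x₂ ∙₃ point t)

  -- The equation of the image of a side of the coordinate triangle, scaled to take the
  -- value 1 at the image of the unit point. The three of them are coordinates in the image.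
  record ScaledSide (f : K.Triple → Triple) (x y : K.Triple) : Set where
    field
      form    : Triple
      at-unit : form ∙₃ f unit ≡ 1#
      on      : ∀ {z} → z ≢ K.0₃ → K.OnLine x y z → form ∙₃ f z ≡ 0#
      off     : ∀ {z} → z ≢ K.0₃ → ¬ K.OnLine x y z → form ∙₃ f z ≢ 0#

  scaledSide : ∀ {f x y} → LineImage f x y → ¬ K.OnLine x y unit → ScaledSide f x y
  scaledSide {f} ℓ ∉ = let r , r*≡1 = inverse _ (off ℓ affine≢0 ∉) in record
    { form    = r ·₃ l ℓ
    ; at-unit = trans (scale-left r (l ℓ) _) r*≡1
    ; on      = λ {z} z≢0 z∈ → trans (scale-left r (l ℓ) (f z)) (trans (cong (r *_) (on ℓ z≢0 z∈)) (zeroʳ r))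
    ; off     = λ {z} z≢0 z∉ eq → *-≢0 (Projective.inverse≢0 L r*≡1) (off ℓ z≢0 z∉)
                  (trans (sym (scale-left r (l ℓ) (f z))) eq)
    }
    where
    open LineImage
    scale-left : ∀ r l v → (r ·₃ l) ∙₃ v ≡ r * (l ∙₃ v)
    scale-left r (a , b , c) (x , y , z) = solve 7
      (λ r a b c x y z → r :* a :* x :+ r :* b :* y :+ r :* c :* z := r :* (a :* x :+ b :* y :+ c :* z))
          refl r a b c x y z

  module Frame (f : K.Triple → Triple) (f-lines : PreservesLines f) (s₀ : ScaledSide f K.e₁ K.e₂)
               (s₁ : ScaledSide f K.e₀ K.e₂) (s₂ : ScaledSide f K.e₀ K.e₁) where
    open LineImage
    module S₀ = ScaledSide s₀
    module S₁ = ScaledSide s₁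
    module S₂ = ScaledSide s₂

    coordinates : Triple → Triple
    coordinates w = S₀.form ∙₃ w , S₁.form ∙₃ w , S₂.form ∙₃ w

    g : K.Triple → Triple
    g z = coordinates (f z)

    d₀ = proj₁ (g K.e₀)
    d₁ = proj₁ (proj₂ (g K.e₁))
    d₂ = proj₂ (proj₂ (g K.e₂))

    d₀≢0 : d₀ ≢ 0#
    d₀≢0 = S₀.off e₀≢0 (off-e₁e₂ K.1≢0)

    d₁≢0 : d₁ ≢ 0#
    d₁≢0 = S₁.off e₁≢0 (off-e₀e₂ K.1≢0)

    d₂≢0 : d₂ ≢ 0#
    d₂≢0 = S₂.off e₂≢0 (off-e₀e₁ K.1≢0)

    g-e₀ : g K.e₀ ≡ (d₀ , 0# , 0#)
    g-e₀ = triple-≡ refl (S₁.on e₀≢0 (endˡ _ _)) (S₂.on e₀≢0 (endˡ _ _))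

    g-e₁ : g K.e₁ ≡ (0# , d₁ , 0#)
    g-e₁ = triple-≡ (S₀.on e₁≢0 (endˡ _ _)) refl (S₂.on e₁≢0 (endʳ _ _))

    g-e₂ : g K.e₂ ≡ (0# , 0# , d₂)
    g-e₂ = triple-≡ (S₀.on e₂≢0 (endʳ _ _)) (S₁.on e₂≢0 (endʳ _ _)) refl

    g-unit : g unit ≡ (1# , 1# , 1#)
    g-unit = triple-≡ S₀.at-unit S₁.at-unit S₂.at-unit

    r₀ = proj₁ (inverse d₀ d₀≢0)
    r₁ = proj₁ (inverse d₁ d₁≢0)
    r₂ = proj₁ (inverse d₂ d₂≢0)

    -- Since `coordinates` sends the image of the i-th vertex to dᵢ times the i-th unit vector,
    -- these are the columns of the matrix inverse to `coordinates`.
    column₀ column₁ column₂ : Triple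
    column₀ = r₀ ·₃ f K.e₀
    column₁ = r₁ ·₃ f K.e₁
    column₂ = r₂ ·₃ f K.e₂

    x₀ x₁ x₂ : Triple
    x₀ = proj₁ column₀ , proj₁ column₁ , proj₁ column₂
    x₁ = proj₁ (proj₂ column₀) , proj₁ (proj₂ column₁) , proj₁ (proj₂ column₂)
    x₂ = proj₂ (proj₂ column₀) , proj₂ (proj₂ column₁) , proj₂ (proj₂ column₂)

    fromCoordinates : Triple → Triple
    fromCoordinates w = x₀ ∙₃ w , x₁ ∙₃ w , x₂ ∙₃ w

    ∙₃-fromCoordinates : ∀ l w → l ∙₃ fromCoordinates w ≡ (l ∙₃ column₀ , l ∙₃ column₁ , l ∙₃ column₂) ∙₃ w
    ∙₃-fromCoordinates (l₀ , l₁ , l₂) (w₀ , w₁ , w₂) = go column₀ column₁ column₂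
      where
      go : ∀ (a b c : Triple) → (let a₀ , a₁ , a₂ = a ; b₀ , b₁ , b₂ = b ; c₀ , c₁ , c₂ = c) →
           (l₀ , l₁ , l₂) ∙₃ ((a₀ , b₀ , c₀) ∙₃ (w₀ , w₁ , w₂) , (a₁ , b₁ , c₁) ∙₃ (w₀ , w₁ , w₂) , (a₂ , b₂ , c₂) ∙₃ (w₀ , w₁ , w₂))
         ≡ ((l₀ , l₁ , l₂) ∙₃ a , (l₀ , l₁ , l₂) ∙₃ b , (l₀ , l₁ , l₂) ∙₃ c) ∙₃ (w₀ , w₁ , w₂)
      go (a₀ , a₁ , a₂) (b₀ , b₁ , b₂) (c₀ , c₁ , c₂) = begin
        l₀ * (a₀ * w₀ + b₀ * w₁ + c₀ * w₂) + l₁ * (a₁ * w₀ + b₁ * w₁ + c₁ * w₂) + l₂ * (a₂ * w₀ + b₂ * w₁ + c₂ * w₂)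
          ≡⟨ cong₂ _+_ (cong₂ _+_ (expand l₀ a₀ b₀ c₀) (expand l₁ a₁ b₁ c₁)) (expand l₂ a₂ b₂ c₂) ⟩
        l₀ * a₀ * w₀ + l₀ * b₀ * w₁ + l₀ * c₀ * w₂ + (l₁ * a₁ * w₀ + l₁ * b₁ * w₁ + l₁ * c₁ * w₂)
          + (l₂ * a₂ * w₀ + l₂ * b₂ * w₁ + l₂ * c₂ * w₂)
          ≡⟨ regroup ⟩
        (l₀ * a₀ + l₁ * a₁ + l₂ * a₂) * w₀ + (l₀ * b₀ + l₁ * b₁ + l₂ * b₂) * w₁ + (l₀ * c₀ + l₁ * c₁ + l₂ * c₂) * w₂
          ∎
        where
        open ≡-Reasoning
        expand : ∀ l a b c → l * (a * w₀ + b * w₁ + c * w₂) ≡ l * a * w₀ + l * b * w₁ + l * c * w₂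
        expand l a b c = solve 7 (λ l a b c u v w → l :* (a :* u :+ b :* v :+ c :* w)
            := l :* a :* u :+ l :* b :* v :+ l :* c :* w)
          refl l a b c w₀ w₁ w₂
        regroup = solve 12 (λ p₀ q₀ r₀ p₁ q₁ r₁ p₂ q₂ r₂ u v w →
             p₀ :* u :+ q₀ :* v :+ r₀ :* w :+ (p₁ :* u :+ q₁ :* v :+ r₁ :* w) :+ (p₂ :* u :+ q₂ :* v :+ r₂ :* w)
          := (p₀ :+ p₁ :+ p₂) :* u :+ (q₀ :+ q₁ :+ q₂) :* v :+ (r₀ :+ r₁ :+ r₂) :* w) refl
          (l₀ * a₀) (l₀ * b₀) (l₀ * c₀) (l₁ * a₁) (l₁ * b₁) (l₁ * c₁) (l₂ * a₂) (l₂ * b₂) (l₂ * c₂) w₀ w₁ w₂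

    coordinates-fromCoordinates : ∀ w → coordinates (fromCoordinates w) ≡ w
    coordinates-fromCoordinates w@(w₀ , w₁ , w₂) = triple-≡
      (trans (∙₃-fromCoordinates S₀.form w) (trans (cong (_∙₃ w) (triple-≡
          (trans (∙₃-scale S₀.form r₀ _) (proj₂ (inverse d₀ d₀≢0)))
          (kill S₀.form r₁ (cong proj₁ g-e₁)) (kill S₀.form r₂ (cong proj₁ g-e₂))))
        (solve 3 (λ u v w → :1 :* u :+ :0 :* v :+ :0 :* w := u) refl w₀ w₁ w₂)))
      (trans (∙₃-fromCoordinates S₁.form w) (trans (cong (_∙₃ w) (triple-≡
          (kill S₁.form r₀ (cong (proj₁ ∘ proj₂) g-e₀))
          (trans (∙₃-scale S₁.form r₁ _) (proj₂ (inverse d₁ d₁≢0)))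
          (kill S₁.form r₂ (cong (proj₁ ∘ proj₂) g-e₂))))
        (solve 3 (λ u v w → :0 :* u :+ :1 :* v :+ :0 :* w := v) refl w₀ w₁ w₂)))
      (trans (∙₃-fromCoordinates S₂.form w) (trans (cong (_∙₃ w) (triple-≡
          (kill S₂.form r₀ (cong (proj₂ ∘ proj₂) g-e₀)) (kill S₂.form r₁ (cong (proj₂ ∘ proj₂) g-e₁))
          (trans (∙₃-scale S₂.form r₂ _) (proj₂ (inverse d₂ d₂≢0)))))
        (solve 3 (λ u v w → :0 :* u :+ :0 :* v :+ :1 :* w := w) refl w₀ w₁ w₂)))
      where
      kill : ∀ l r {v} → l ∙₃ v ≡ 0# → l ∙₃ (r ·₃ v) ≡ 0#
      kill l r {v} eq = trans (∙₃-scale l r v) (trans (cong (r *_) eq) (zeroʳ r))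

    fromCoordinates-coordinates : ∀ v → fromCoordinates (coordinates v) ≡ v
    fromCoordinates-coordinates = left-inverse⇒right-inverse L-order fromCoordinates coordinates coordinates-fromCoordinates

    -- Equations of lines are transported by the transpose of `fromCoordinates`. The two coordinate
    -- maps are mutually inverse, so incidence is unchanged and a nonzero equation stays nonzero.
    g-lines : PreservesLines g
    g-lines x y independent = record
      { l     = m
      ; l≢0   = λ eq → l≢0 ℓ (trans (basis-test (l ℓ)) (triple-≡ (vanish eq e₀) (vanish eq e₁) (vanish eq e₂)))
      ; image = λ z z≢0 → mk⇔ (λ z∈ → trans (m∙g z) (on ℓ z≢0 z∈))
                              (λ eq → Equivalence.from (image ℓ z z≢0) (trans (sym (m∙g z)) eq))
      }
      where
      ℓ = f-lines x y independent
      m = l ℓ ∙₃ column₀ , l ℓ ∙₃ column₁ , l ℓ ∙₃ column₂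
      m∙coordinates : ∀ v → m ∙₃ coordinates v ≡ l ℓ ∙₃ v
      m∙coordinates v = trans (sym (∙₃-fromCoordinates (l ℓ) (coordinates v)))
          (cong (l ℓ ∙₃_) (fromCoordinates-coordinates v))
      m∙g : ∀ z → m ∙₃ g z ≡ l ℓ ∙₃ f z
      m∙g z = m∙coordinates (f z)
      vanish : m ≡ 0₃ → ∀ v → l ℓ ∙₃ v ≡ 0#
      vanish eq v = trans (sym (m∙coordinates v)) (trans (cong (_∙₃ coordinates v) eq)
        (solve 3 (λ u v w → :0 :* u :+ :0 :* v :+ :0 :* w := :0) refl _ _ _))
      basis-test : ∀ l → l ≡ (l ∙₃ e₀ , l ∙₃ e₁ , l ∙₃ e₂)
      basis-test (a , b , c) = triple-≡
        (solve 3 (λ a b c → a := a :* :1 :+ b :* :0 :+ c :* :0) refl a b c)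
        (solve 3 (λ a b c → b := a :* :0 :+ b :* :1 :+ c :* :0) refl a b c)
        (solve 3 (λ a b c → c := a :* :0 :+ b :* :0 :+ c :* :1) refl a b c)

    coordinatised : Coordinatised f
    coordinatised = record
      { x₀ = x₀ ; x₁ = x₁ ; x₂ = x₂
      ; x₀-value = coordinates e₀ , cong proj₁ (fromCoordinates-coordinates e₀)
      ; kernel = λ w eq₀ eq₁ eq₂ → trans (sym (coordinates-fromCoordinates w)) (trans
          (cong coordinates (triple-≡ eq₀ eq₁ eq₂))
          (triple-≡ (∙₃-0 S₀.form) (∙₃-0 S₁.form) (∙₃-0 S₂.form)))
      ; reparametrise = reparametrise
      ; reparametrise-surjective = reparametrise-surjective
      ; parametrised = λ s → let c , c≢0 , eq = g-parametrised s in
          c , c≢0 , trans (sym (fromCoordinates-coordinates _)) (trans (cong fromCoordinates eq)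
            (triple-≡ (∙₃-scale x₀ c _) (∙₃-scale x₁ c _) (∙₃-scale x₂ c _)))
      }
      where
      open Normalised g g-lines d₀≢0 d₁≢0 d₂≢0 g-e₀ g-e₁ g-e₂ g-unit
      ∙₃-0 : ∀ l → l ∙₃ 0₃ ≡ 0#
      ∙₃-0 (a , b , c) = solve 3 (λ a b c → a :* :0 :+ b :* :0 :+ c :* :0 := :0) refl a b c


  coordinatise : ∀ f → PreservesLines f → Coordinatised f
  coordinatise f f-lines = Frame.coordinatised f f-lines
    (scaledSide (f-lines K.e₁ K.e₂ independent-e₁e₂) (off-e₁e₂ K.1≢0))
    (scaledSide (f-lines K.e₀ K.e₂ independent-e₀e₂) (off-e₀e₂ K.1≢0))
    (scaledSide (f-lines K.e₀ K.e₁ independent-e₀e₁) (off-e₀e₁ K.1≢0))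

-- Conics of PG(2, q)

module Conics (F : Field) {n : ℕ} (order : HasOrder F n) where
  open FieldFacts F
  open FiniteField F order
  open Triples F
  open Projective F using (Vec; 0ᵛ; _+ᵛ_; _·_; QuadraticForm; eval; NonDegenerate)
  open Sum semiring using (∑-distrib-+)

  _≟₃_ : (u v : Triple) → Dec (u ≡ v)
  _≟₃_ = ≡-dec _≟_ (≡-dec _≟_ _≟_)

  vec : Triple → Vec 3
  vec (a , b , c) = a ∷ b ∷ c ∷ []

  triple : Vec 3 → Triple
  triple v = v zero , v (suc zero) , v (suc (suc zero))

  vec-triple : ∀ v → vec (triple v) ≗ v
  vec-triple v zero             = refl
  vec-triple v (suc zero)       = refl
  vec-triple v (suc (suc zero)) = refl

  count-triples : Counted (≡.setoid Triple) (n ℕ.^ 3)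
  count-triples = Counted-≡ (cong (λ k → n ℕ.* (n ℕ.* k)) (sym (ℕ.*-identityʳ n))) (Triple-order order)

  module _ (A : QuadraticForm 3) where

    bilinear : Vec 3 → Vec 3 → Carrier
    bilinear v w = sum (λ i → sum (λ j → A i j * (v i * w j)))

    bilinear-cong : ∀ {v v′ w w′} → v ≗ v′ → w ≗ w′ → bilinear v w ≡ bilinear v′ w′
    bilinear-cong v≗ w≗ = sum-cong-≗ {3} λ i → sum-cong-≗ {3} λ j → cong (A i j *_) (cong₂ _*_ (v≗ i) (w≗ j))

    bilinear-+ˡ : ∀ u v w → bilinear (u +ᵛ v) w ≡ bilinear u w + bilinear v w
    bilinear-+ˡ u v w = trans (sum-cong-≗ {3} λ i → trans (sum-cong-≗ {3} λ j →
        solve 4 (λ a u v w → a :* ((u :+ v) :* w) := a :* (u :* w) :+ a :* (v :* w))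
            refl (A i j) (u i) (v i) (w j))
      (∑-distrib-+ {3} (λ j → A i j * (u i * w j)) (λ j → A i j * (v i * w j))))
      (∑-distrib-+ {3} (λ i → sum (λ j → A i j * (u i * w j))) (λ i → sum (λ j → A i j * (v i * w j))))

    bilinear-+ʳ : ∀ u v w → bilinear w (u +ᵛ v) ≡ bilinear w u + bilinear w v
    bilinear-+ʳ u v w = trans (sum-cong-≗ {3} λ i → trans (sum-cong-≗ {3} λ j →
        solve 4 (λ a u v w → a :* (w :* (u :+ v)) := a :* (w :* u) :+ a :* (w :* v))
            refl (A i j) (u j) (v j) (w i))
      (∑-distrib-+ {3} (λ j → A i j * (w i * u j)) (λ j → A i j * (w i * v j))))
      (∑-distrib-+ {3} (λ i → sum (λ j → A i j * (w i * u j))) (λ i → sum (λ j → A i j * (w i * v j))))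

    bilinear-·ˡ : ∀ s v w → bilinear (s · v) w ≡ s * bilinear v w
    bilinear-·ˡ s v w = sym (trans (*-distribˡ-sum s (λ i → sum (λ j → A i j * (v i * w j))))
      (sum-cong-≗ {3} λ i → trans (*-distribˡ-sum s (λ j → A i j * (v i * w j))) (sum-cong-≗ {3} λ j →
        solve 4 (λ s a v w → s :* (a :* (v :* w)) := a :* (s :* v :* w)) refl s (A i j) (v i) (w j))))

    bilinear-·ʳ : ∀ s v w → bilinear w (s · v) ≡ s * bilinear w v
    bilinear-·ʳ s v w = sym (trans (*-distribˡ-sum s (λ i → sum (λ j → A i j * (w i * v j))))
      (sum-cong-≗ {3} λ i → trans (*-distribˡ-sum s (λ j → A i j * (w i * v j))) (sum-cong-≗ {3} λ j →
        solve 4 (λ s a v w → s :* (a :* (w :* v)) := a :* (w :* (s :* v))) refl s (A i j) (v j) (w i))))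

    Q : Vec 3 → Carrier
    Q = eval A

    -- The symmetrised matrix of `A`. It is the polar form without a division by 2, so it serves in
    -- every characteristic.
    B : Vec 3 → Vec 3 → Carrier
    B v w = bilinear v w + bilinear w v

    Q-cong : ∀ {v w} → v ≗ w → Q v ≡ Q w
    Q-cong v≗w = bilinear-cong v≗w v≗w

    B-cong : ∀ v {w w′} → w ≗ w′ → B v w ≡ B v w′
    B-cong v w≗ = cong₂ _+_ (bilinear-cong {v} {v} (λ _ → refl) w≗) (bilinear-cong {w = v} {v} w≗ (λ _ → refl))

    B-sym : ∀ v w → B v w ≡ B w v
    B-sym v w = +-comm _ _

    B-self : ∀ v → Q v ≡ 0# → B v v ≡ 0#
    B-self v Q≡0 = trans (cong₂ _+_ Q≡0 Q≡0) (+-identityˡ 0#)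

    B-+ : ∀ v u w → B v (u +ᵛ w) ≡ B v u + B v w
    B-+ v u w = trans (cong₂ _+_ (bilinear-+ʳ u w v) (bilinear-+ˡ u w v))
      (solve 4 (λ a b c d → a :+ b :+ (c :+ d) := a :+ c :+ (b :+ d)) refl _ _ _ _)

    B-· : ∀ v s w → B v (s · w) ≡ s * B v w
    B-· v s w = trans (cong₂ _+_ (bilinear-·ʳ s w v) (bilinear-·ˡ s w v)) (sym (distribˡ s _ _))

    Q-+ : ∀ v w → Q (v +ᵛ w) ≡ Q v + Q w + B v w
    Q-+ v w = trans (bilinear-+ˡ v w (v +ᵛ w)) (trans (cong₂ _+_ (bilinear-+ʳ v w v) (bilinear-+ʳ v w w))
      (solve 4 (λ a b c d → a :+ b :+ (c :+ d) := a :+ d :+ (b :+ c)) refl _ _ _ _))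

    Q-· : ∀ s v → Q (s · v) ≡ s * s * Q v
    Q-· s v = trans (bilinear-·ˡ s v (s · v)) (trans (cong (s *_) (bilinear-·ʳ s v v)) (sym (*-assoc s s _)))

    polar : ∀ v w → Q (v +ᵛ w) - Q v - Q w ≡ B v w
    polar v w = trans (cong (λ z → z - Q v - Q w) (Q-+ v w))
      (solve 3 (λ a b c → a :+ b :+ c :- a :- b := c) refl (Q v) (Q w) (B v w))

    combination : Vec 3 → Vec 3 → Vec 3 → Triple → Vec 3
    combination u v w (a , b , c) = a · u +ᵛ b · v +ᵛ c · w

    B-combination : ∀ x u v w a b c → B x (combination u v w (a , b , c)) ≡ a * B x u + b * B x v + c * B x w
    B-combination x u v w a b c = trans (B-+ x (a · u +ᵛ b · v) (c · w))
      (cong₂ _+_ (trans (B-+ x (a · u) (b · v)) (cong₂ _+_ (B-· x a u) (B-· x b v))) (B-· x c w))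

    -- m₀ and m₂ span a hyperbolic line with m₁ in its orthogonal complement.
    record Hyperbolic (m₀ m₁ m₂ : Vec 3) : Set where
      field
        Q₀≡0   : Q m₀ ≡ 0#
        Q₂≡0   : Q m₂ ≡ 0#
        B₀₁≡0  : B m₀ m₁ ≡ 0#
        B₂₁≡0  : B m₂ m₁ ≡ 0#
        B₀₂≢0  : B m₀ m₂ ≢ 0#
        m₁≢0   : ¬ (m₁ ≗ 0ᵛ)

      -- Pairing with `m₀` isolates c and pairing with `m₂` isolates a, because these two vectors
      -- are isotropic and orthogonal to `m₁`. What is left is a multiple of `m₁`.
      combination-injective : ∀ {z} → combination m₀ m₁ m₂ z ≗ 0ᵛ → z ≡ 0₃
      combination-injective {a , b , c} eq = triple-≡ a≡0 b≡0 c≡0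
        where
        open ≡-Reasoning
        B-0 : ∀ x → B x (combination m₀ m₁ m₂ (a , b , c)) ≡ 0#
        B-0 x = trans (B-cong x {w′ = 0# · 0ᵛ} (λ i → trans (eq i) (sym (zeroˡ 0#))))
            (trans (B-· x 0# 0ᵛ) (zeroˡ _))
        c≡0 : c ≡ 0#
        c≡0 = *-cancelʳ-0 B₀₂≢0 (begin
          c * B m₀ m₂                                   ≡⟨ solve 3 (λ a b x → x := a :* :0 :+ b :* :0 :+ x)
              refl a b _ ⟩
          a * 0# + b * 0# + c * B m₀ m₂                 ≡⟨ cong₂
              (λ u v → a * u + b * v + c * B m₀ m₂) (B-self m₀ Q₀≡0) B₀₁≡0 ⟨
          a * B m₀ m₀ + b * B m₀ m₁ + c * B m₀ m₂       ≡⟨ B-combination m₀ m₀ m₁ m₂ a b c ⟨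
          B m₀ (combination m₀ m₁ m₂ (a , b , c))       ≡⟨ B-0 m₀ ⟩
          0#                                            ∎)
        a≡0 : a ≡ 0#
        a≡0 = *-cancelʳ-0 B₀₂≢0 (begin
          a * B m₀ m₂                                   ≡⟨ solve 3 (λ b c x → x := x :+ b :* :0 :+ c :* :0)
              refl b c _ ⟩
          a * B m₀ m₂ + b * 0# + c * 0#                 ≡⟨ cong₂
              (λ u v → a * B m₀ m₂ + b * u + c * v) B₂₁≡0 (B-self m₂ Q₂≡0) ⟨
          a * B m₀ m₂ + b * B m₂ m₁ + c * B m₂ m₂       ≡⟨ cong
              (λ u → a * u + b * B m₂ m₁ + c * B m₂ m₂) (B-sym m₀ m₂) ⟩
          a * B m₂ m₀ + b * B m₂ m₁ + c * B m₂ m₂       ≡⟨ B-combination m₂ m₀ m₁ m₂ a b c ⟨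
          B m₂ (combination m₀ m₁ m₂ (a , b , c))       ≡⟨ B-0 m₂ ⟩
          0#                                            ∎)
        b≡0 : b ≡ 0#
        b≡0 = Dec.decidable-stable (b ≟ 0#) λ b≢0 → m₁≢0 λ i → *-cancelˡ-0 b≢0 (begin
          b * m₁ i                                      ≡⟨ solve 3 (λ x u v → x := :0 :* u :+ x :+ :0 :* v)
              refl (b * m₁ i) (m₀ i) (m₂ i) ⟩
          0# * m₀ i + b * m₁ i + 0# * m₂ i              ≡⟨ cong₂
              (λ u v → u * m₀ i + b * m₁ i + v * m₂ i) a≡0 c≡0 ⟨
          combination m₀ m₁ m₂ (a , b , c) i            ≡⟨ eq i ⟩
          0#                                            ∎)

      combination-faithful : ∀ {z z′} → combination m₀ m₁ m₂ z ≗ combination m₀ m₁ m₂ z′ → z ≡ z′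
      combination-faithful {a , b , c} {a′ , b′ , c′} eq =
        triple-≡ (x-y≡0⇒x≡y (cong proj₁ z≡0)) (x-y≡0⇒x≡y (cong (proj₁ ∘ proj₂) z≡0)) (x-y≡0⇒x≡y
            (cong (proj₂ ∘ proj₂) z≡0))
        where
        z≡0 : (a - a′ , b - b′ , c - c′) ≡ 0₃
        z≡0 = combination-injective (λ i → trans
          (solve 9 (λ a b c a′ b′ c′ u v w → (a :- a′) :* u :+ (b :- b′) :* v :+ (c :- c′) :* w
            := (a :* u :+ b :* v :+ c :* w) :- (a′ :* u :+ b′ :* v :+ c′ :* w))
                refl a b c a′ b′ c′ (m₀ i) (m₁ i) (m₂ i))
          (x≡y⇒x-y≡0 (eq i)))

      combination-surjective : ∀ v → ∃[ z ] combination m₀ m₁ m₂ z ≗ v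
      combination-surjective = injection⇒surjection count-triples (countVec 3) (combination m₀ m₁ m₂)
        (λ { refl _ → refl }) combination-faithful

      Q-combination : ∀ a b c → Q (combination m₀ m₁ m₂ (a , b , c)) ≡ b * b * Q m₁ + a * c * B m₀ m₂
      Q-combination a b c = begin
        Q (a · m₀ +ᵛ b · m₁ +ᵛ c · m₂)
          ≡⟨ Q-+ (a · m₀ +ᵛ b · m₁) (c · m₂) ⟩
        Q (a · m₀ +ᵛ b · m₁) + Q (c · m₂) + B (a · m₀ +ᵛ b · m₁) (c · m₂)
          ≡⟨ cong₂ _+_ (cong₂ _+_ (Q-+ (a · m₀) (b · m₁)) (Q-· c m₂)) (B-· (a · m₀ +ᵛ b · m₁) c m₂) ⟩
        Q (a · m₀) + Q (b · m₁) + B (a · m₀) (b · m₁) + c * c * Q m₂ + c * B (a · m₀ +ᵛ b · m₁) m₂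
          ≡⟨ cong₂ (λ x y → x + c * c * Q m₂ + c * y)
              (cong₂ _+_ (cong₂ _+_ (Q-· a m₀) (Q-· b m₁)) (trans (B-· (a · m₀) b m₁)
                  (cong (b *_) (B-·ˡ a m₀ m₁))))
              (trans (B-sym (a · m₀ +ᵛ b · m₁) m₂) (trans (B-+ m₂ (a · m₀) (b · m₁)) (cong₂ _+_
                  (trans (B-· m₂ a m₀) (cong (a *_) (B-sym m₂ m₀))) (B-· m₂ b m₁)))) ⟩
        a * a * Q m₀ + b * b * Q m₁ + b * (a * B m₀ m₁) + c * c * Q m₂ + c * (a * B m₀ m₂ + b * B m₂ m₁)
          ≡⟨ cong₂ (λ x y → x + c * (a * B m₀ m₂ + b * y)) (cong₂ (λ x y → x + c * c * y)
               (cong₂ (λ x y → a * a * x + b * b * Q m₁ + b * (a * y)) Q₀≡0 B₀₁≡0) Q₂≡0) B₂₁≡0 ⟩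
        a * a * 0# + b * b * Q m₁ + b * (a * 0#) + c * c * 0# + c * (a * B m₀ m₂ + b * 0#)
          ≡⟨ solve 5 (λ a b c x y → a :* a :* :0 :+ b :* b :* x :+ b :* (a :* :0) :+ c :* c :* :0
               :+ c :* (a :* y :+ b :* :0) := b :* b :* x :+ a :* c :* y) refl a b c (Q m₁) (B m₀ m₂) ⟩
        b * b * Q m₁ + a * c * B m₀ m₂
          ∎
        where
        open ≡-Reasoning
        B-·ˡ : ∀ s v w → B (s · v) w ≡ s * B v w
        B-·ˡ s v w = trans (B-sym (s · v) w) (trans (B-· w s v) (cong (s *_) (B-sym w v)))

    module _ (nonDegenerate : NonDegenerate A) where

      nonOrthogonal : ∀ {v} → Q v ≡ 0# → ¬ (v ≗ 0ᵛ) → ∃[ w ] B v w ≢ 0#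
      nonOrthogonal {v} Q≡0 v≢0 = decide (finite-any? (Triple-order order) (λ z → Dec.¬? (B v (vec z) ≟ 0#)))
        where
        decide : Dec (∃[ z ] B v (vec z) ≢ 0#) → ∃[ w ] B v w ≢ 0#
        decide (yes (z , B≢0)) = vec z , B≢0
        decide (no none) = contradiction (nonDegenerate v Q≡0 λ w → trans (polar v w)
          (Dec.decidable-stable (B v w ≟ 0#) λ B≢0 → none (triple w , λ eq → B≢0 (trans
              (sym (B-cong v (vec-triple w))) eq)))) v≢0

      -- Two linear conditions on three coordinates: otherwise w ↦ (B u w , B v w , 0) would be a bijection.
      orthogonal : ∀ u v → ∃[ w ] ¬ (w ≗ 0ᵛ) × B u w ≡ 0# × B v w ≡ 0#
      orthogonal u v = decide (finite-any? (Triple-order order)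
          (λ z → Dec.¬? (z ≟₃ 0₃) Dec.×-dec (B u (vec z) ≟ 0#) Dec.×-dec (B v (vec z) ≟ 0#)))
        where
        f : Triple → Triple
        f z = B u (vec z) , B v (vec z) , 0#
        difference : ∀ x a b c a′ b′ c′ → B x (vec (a , b , c)) ≡ B x (vec (a′ , b′ , c′)) →
                     B x (vec (a - a′ , b - b′ , c - c′)) ≡ 0#
        difference x a b c a′ b′ c′ eq = begin
          B x (vec (a - a′ , b - b′ , c - c′))
            ≡⟨ B-cong x {vec (a - a′ , b - b′ , c - c′)} {vec (a , b , c) +ᵛ (- 1#) · vec (a′ , b′ , c′)}
                (λ { zero → lem a a′ ; (suc zero) → lem b b′ ; (suc (suc zero)) → lem c c′ }) ⟩
          B x (vec (a , b , c) +ᵛ (- 1#) · vec (a′ , b′ , c′))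
            ≡⟨ trans (B-+ x (vec (a , b , c)) ((- 1#) · vec (a′ , b′ , c′)))
                (cong₂ _+_ eq (B-· x (- 1#) (vec (a′ , b′ , c′)))) ⟩
          B x (vec (a′ , b′ , c′)) + (- 1#) * B x (vec (a′ , b′ , c′))
            ≡⟨ solve 1 (λ x → x :+ (:- :1) :* x := :0) refl _ ⟩
          0# ∎
          where
          open ≡-Reasoning
          lem : ∀ a b → a - b ≡ a + (- 1#) * b
          lem = solve 2 (λ a b → a :- b := a :+ (:- :1) :* b) refl
        Solution : Triple → Set
        Solution z = z ≢ 0₃ × B u (vec z) ≡ 0# × B v (vec z) ≡ 0#
        f-injective : ¬ ∃ Solution → ∀ {z z′} → f z ≡ f z′ → z ≡ z′
        f-injective none {a , b , c} {a′ , b′ , c′} eq =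
          let z≡0 = Dec.decidable-stable (_ ≟₃ 0₃) λ z≢0 → none ((a - a′ , b - b′ , c - c′) , z≢0 ,
                      difference u a b c a′ b′ c′ (cong proj₁ eq) , difference v a b c a′ b′ c′
                          (cong (proj₁ ∘ proj₂) eq))
          in triple-≡ (x-y≡0⇒x≡y (cong proj₁ z≡0)) (x-y≡0⇒x≡y (cong (proj₁ ∘ proj₂) z≡0)) (x-y≡0⇒x≡y
              (cong (proj₂ ∘ proj₂) z≡0))

        decide : Dec (∃ Solution) → ∃[ w ] ¬ (w ≗ 0ᵛ) × B u w ≡ 0# × B v w ≡ 0#
        decide (yes (z , z≢0 , Bu≡0 , Bv≡0)) =
          vec z , (λ eq → z≢0 (triple-≡ (eq zero) (eq (suc zero)) (eq (suc (suc zero))))) , Bu≡0 , Bv≡0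
        decide (no none) = contradiction (sym (cong (proj₂ ∘ proj₂) (proj₂ (injection⇒surjection
          (Triple-order order) (Triple-order order) f (cong f) (f-injective none) e₂)))) 1≢0

      -- If `m₁` were isotropic, it would be orthogonal to itself as well as to `m₀` and `m₂`, hence
      -- to everything, and so would be a singular point.
      Q₁≢0 : ∀ {m₀ m₁ m₂} → Hyperbolic m₀ m₁ m₂ → Q m₁ ≢ 0#
      Q₁≢0 {m₀} {m₁} {m₂} H Q₁≡0 = m₁≢0 (nonDegenerate m₁ Q₁≡0 λ w → trans (polar m₁ w) (B≡0 w))
        where
        open Hyperbolic H
        open ≡-Reasoning
        B-comb≡0 : ∀ a b c → B m₁ (combination m₀ m₁ m₂ (a , b , c)) ≡ 0#
        B-comb≡0 a b c = begin
          B m₁ (combination m₀ m₁ m₂ (a , b , c))      ≡⟨ B-combination m₁ m₀ m₁ m₂ a b c ⟩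
          a * B m₁ m₀ + b * B m₁ m₁ + c * B m₁ m₂      ≡⟨ cong₂ _+_ (cong₂ (λ x y → a * x + b * y)
                                                            (trans (B-sym m₁ m₀) B₀₁≡0) (B-self m₁ Q₁≡0))
                                                            (cong (c *_) (trans (B-sym m₁ m₂) B₂₁≡0)) ⟩
          a * 0# + b * 0# + c * 0#                     ≡⟨ solve 3 (λ a b c → a :* :0 :+ b :* :0 :+ c :* :0
              := :0) refl a b c ⟩
          0#                                           ∎
        B≡0 : ∀ w → B m₁ w ≡ 0#
        B≡0 w = let (a , b , c) , eq = combination-surjective w in
          trans (sym (B-cong m₁ eq)) (B-comb≡0 a b c)

      record ConicFrame : Set where
        field
          m₀ m₁ m₂   : Vec 3
          faithful   : ∀ {z z′} → combination m₀ m₁ m₂ z ≗ combination m₀ m₁ m₂ z′ → z ≡ z′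
          surjective : ∀ v → ∃[ z ] combination m₀ m₁ m₂ z ≗ v
          zero⇒      : ∀ a b c → Q (combination m₀ m₁ m₂ (a , b , c)) ≡ 0# → b * b ≡ a * c
          zero⇐      : ∀ a b c → b * b ≡ a * c → Q (combination m₀ m₁ m₂ (a , b , c)) ≡ 0#

      -- The second point of the conic on the line joining `m₀` and `w`: along w + λ m₀ the form is
      -- affine in λ, with slope `B m₀ w`.
      isotropicPartner : ∀ m₀ → Q m₀ ≡ 0# → ∀ w → B m₀ w ≢ 0# → ∃[ r ] Q r ≡ 0# × B m₀ r ≢ 0#
      isotropicPartner m₀ Q₀≡0 w β≢0 = let t , tβ≡1 = inverse (B m₀ w) β≢0 in
        partner t , Qr t tβ≡1 , λ eq → β≢0 (trans (sym (Bm₀r t)) eq)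
        where
        open ≡-Reasoning
        partner : Carrier → Vec 3
        partner t = w +ᵛ (- (t * Q w)) · m₀
        Bm₀r : ∀ t → B m₀ (partner t) ≡ B m₀ w
        Bm₀r t = begin
          B m₀ (partner t)
            ≡⟨ trans (B-+ m₀ w ((- (t * Q w)) · m₀))
                 (cong (B m₀ w +_) (trans (B-· m₀ (- (t * Q w)) m₀) (cong (- (t * Q w) *_) (B-self m₀ Q₀≡0)))) ⟩
          B m₀ w + - (t * Q w) * 0#
            ≡⟨ solve 2 (λ a b → a :+ b :* :0 := a) refl (B m₀ w) (- (t * Q w)) ⟩
          B m₀ w ∎
        Qr : ∀ t → t * B m₀ w ≡ 1# → Q (partner t) ≡ 0#
        Qr t tβ≡1 = begin
          Q (partner t)
            ≡⟨ Q-+ w (- (t * Q w) · m₀) ⟩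
          Q w + Q (- (t * Q w) · m₀) + B w (- (t * Q w) · m₀)
            ≡⟨ cong₂ (λ x y → Q w + x + y) (trans (Q-· (- (t * Q w)) m₀)
                (cong (- (t * Q w) * - (t * Q w) *_) Q₀≡0))
                 (trans (B-· w (- (t * Q w)) m₀) (cong (- (t * Q w) *_) (B-sym w m₀))) ⟩
          Q w + - (t * Q w) * - (t * Q w) * 0# + - (t * Q w) * B m₀ w
            ≡⟨ solve 3 (λ x y z → x :+ :- (y :* x) :* :- (y :* x) :* :0 :+ :- (y :* x) :* z
                 := x :- x :* (y :* z)) refl (Q w) t (B m₀ w) ⟩
          Q w - Q w * (t * B m₀ w)
            ≡⟨ cong (λ z → Q w - Q w * z) tβ≡1 ⟩
          Q w - Q w * 1#
            ≡⟨ solve 1 (λ x → x :- x :* :1 := :0) refl (Q w) ⟩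
          0# ∎

      -- The vector `m₁` is the pole of the chord joining `m₀` to its partner; in characteristic 2
      -- it is the nucleus of the conic.
      hyperbolic : ∀ m₀ → Q m₀ ≡ 0# → ¬ (m₀ ≗ 0ᵛ) → ∃₂ λ m₁ r → Hyperbolic m₀ m₁ r
      hyperbolic m₀ Q₀≡0 m₀≢0 =
        let w , B≢0 = nonOrthogonal Q₀≡0 m₀≢0
            r , Qr≡0 , B₀r≢0 = isotropicPartner m₀ Q₀≡0 w B≢0
            m₁ , m₁≢0 , B₀₁≡0 , Br₁≡0 = orthogonal m₀ r
        in m₁ , r , record { Q₀≡0 = Q₀≡0 ; Q₂≡0 = Qr≡0 ; B₀₁≡0 = B₀₁≡0 ; B₂₁≡0 = Br₁≡0 ; B₀₂≢0 = B₀r≢0 ; m₁≢0 = m₁≢0 }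

      rescale : ∀ {m₀ m₁ r} s → s ≢ 0# → Hyperbolic m₀ m₁ r → Hyperbolic m₀ m₁ (s · r)
      rescale {m₀} {m₁} {r} s s≢0 H = record
        { Q₀≡0  = Q₀≡0
        ; Q₂≡0  = trans (Q-· s r) (trans (cong (s * s *_) Q₂≡0) (zeroʳ _))
        ; B₀₁≡0 = B₀₁≡0
        ; B₂₁≡0 = trans (B-sym (s · r) m₁) (trans (B-· m₁ s r) (trans (cong (s *_)
            (trans (B-sym m₁ r) B₂₁≡0)) (zeroʳ s)))
        ; B₀₂≢0 = λ eq → *-≢0 s≢0 B₀₂≢0 (trans (sym (B-· m₀ s r)) eq)
        ; m₁≢0  = m₁≢0
        }
        where open Hyperbolic H

      -- The scalar is chosen so that the form becomes (b² - a c) `Q m₁` in the frame, which gives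
      -- the conic the equation b² = a c.
      scaledFrame : ∀ {m₀ m₁ r} → Hyperbolic m₀ m₁ r → ∃[ s ] s ≢ 0# × s * B m₀ r ≡ - Q m₁
      scaledFrame {m₀} {m₁} {r} H = let t , tβ≡1 = inverse _ B₀₂≢0 in
        - (t * Q m₁) ,
        (λ eq → *-≢0 (Projective.inverse≢0 F tβ≡1) (Q₁≢0 H) (trans (sym (-‿involutive _)) (trans
            (cong -_ eq) -0#≈0#))) ,
        trans (solve 3 (λ a b c → :- (a :* b) :* c := :- (a :* c :* b)) refl t (Q m₁) (B m₀ r))
          (trans (cong (λ z → - (z * Q m₁)) tβ≡1) (cong -_ (*-identityˡ (Q m₁))))
        where open Hyperbolic H

      Hyperbolic⇒ConicFrame : ∀ {m₀ m₁ m₂} → Hyperbolic m₀ m₁ m₂ → B m₀ m₂ ≡ - Q m₁ → ConicFrame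
      Hyperbolic⇒ConicFrame {m₀} {m₁} {m₂} H B₀₂ = record
        { m₀ = m₀ ; m₁ = m₁ ; m₂ = m₂
        ; faithful   = combination-faithful
        ; surjective = combination-surjective
        ; zero⇒ = λ a b c eq → x-y≡0⇒x≡y (*-cancelʳ-0 (Q₁≢0 H) (trans (sym (Q-comb a b c)) eq))
        ; zero⇐ = λ a b c eq → trans (Q-comb a b c) (trans (cong (_* Q m₁) (x≡y⇒x-y≡0 eq)) (zeroˡ _))
        }
        where
        open Hyperbolic H
        Q-comb : ∀ a b c → Q (combination m₀ m₁ m₂ (a , b , c)) ≡ (b * b - a * c) * Q m₁
        Q-comb a b c = trans (Q-combination a b c) (trans (cong (λ z → b * b * Q m₁ + a * c * z) B₀₂)
          (solve 4 (λ a b c x → b :* b :* x :+ a :* c :* :- x := (b :* b :- a :* c) :* x) refl a b c (Q m₁)))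

      conicFrame : ∀ v → Q v ≡ 0# → ¬ (v ≗ 0ᵛ) → ConicFrame
      conicFrame v Q≡0 v≢0 =
        let m₁ , r , H = hyperbolic v Q≡0 v≢0
            s , s≢0 , eq = scaledFrame H
        in Hyperbolic⇒ConicFrame (rescale s s≢0 H) (trans (B-· v s r) eq)

-- Linear algebra

module LinearAlgebra (F : Field) where
  open FieldFacts F
  open Projective F using (Vec; 0ᵛ; _+ᵛ_; _·_; _∙_; lincomb; _∈⟨_⟩; Independent)
  open Sum semiring using (∑-distrib-+; ∑-comm; *-distribʳ-sum)

  ∙-cong : ∀ {m} (u : Vec m) {v w} → v ≗ w → u ∙ v ≡ u ∙ w
  ∙-cong {m} u v≗w = sum-cong-≗ {m} λ i → cong (u i *_) (v≗w i)

  ∙-+ : ∀ {m} (u v w : Vec m) → u ∙ (v +ᵛ w) ≡ u ∙ v + u ∙ w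
  ∙-+ {m} u v w = trans (sum-cong-≗ {m} λ i → distribˡ (u i) (v i) (w i)) (∑-distrib-+ {m} _ _)

  ∙-· : ∀ {m} (u : Vec m) s v → u ∙ (s · v) ≡ s * (u ∙ v)
  ∙-· {m} u s v = sym (trans (*-distribˡ-sum s (λ i → u i * v i)) (sum-cong-≗ {m} λ i →
    solve 3 (λ s u v → s :* (u :* v) := u :* (s :* v)) refl s (u i) (v i)))

  ∙-0 : ∀ {m} (u : Vec m) → u ∙ 0ᵛ ≡ 0#
  ∙-0 u = trans (∙-cong u {0ᵛ} {0# · 0ᵛ} (λ _ → sym (zeroʳ 0#))) (trans (∙-· u 0# 0ᵛ) (zeroˡ _))

  lincomb-cong : ∀ {r m} {c d : Vec r} (b : Vector (Vec m) r) → c ≗ d → lincomb c b ≗ lincomb d b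
  lincomb-cong {r} b c≗d i = sum-cong-≗ {r} λ j → cong (_* b j i) (c≗d j)

  lincomb-+ : ∀ {r m} (c d : Vec r) (b : Vector (Vec m) r) → lincomb (c +ᵛ d) b ≗ lincomb c b +ᵛ lincomb d b
  lincomb-+ {r} c d b i = trans (sum-cong-≗ {r} λ j → distribʳ (b j i) (c j) (d j)) (∑-distrib-+ {r} _ _)

  lincomb-· : ∀ {r m} s (c : Vec r) (b : Vector (Vec m) r) → lincomb (s · c) b ≗ s · lincomb c b
  lincomb-· {r} s c b i = sym (trans (*-distribˡ-sum s (λ j → c j * b j i)) (sum-cong-≗ {r} λ j → sym
      (*-assoc s (c j) (b j i))))

  lincomb-lincomb : ∀ {r n m} (d : Vec r) (M : Vector (Vec n) r) (b : Vector (Vec m) n) →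
                    lincomb (lincomb d M) b ≗ lincomb d (λ j → lincomb (M j) b)
  lincomb-lincomb {r} {n} d M b k = begin
    sum {n} (λ i → sum {r} (λ j → d j * M j i) * b i k)     ≡⟨ sum-cong-≗ {n} (λ i → *-distribʳ-sum (b i k)
        (λ j → d j * M j i)) ⟩
    sum {n} (λ i → sum {r} (λ j → d j * M j i * b i k))     ≡⟨ ∑-comm {n} {r} (λ i j → d j * M j i * b i k) ⟩
    sum {r} (λ j → sum {n} (λ i → d j * M j i * b i k))     ≡⟨ sum-cong-≗ {r}
        (λ j → sum-cong-≗ {n} λ i → *-assoc (d j) (M j i) (b i k)) ⟩
    sum {r} (λ j → sum {n} (λ i → d j * (M j i * b i k)))   ≡⟨ sum-cong-≗ {r} (λ j → *-distribˡ-sum (d j)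
        (λ i → M j i * b i k)) ⟨
    sum {r} (λ j → d j * sum {n} (λ i → M j i * b i k))     ∎
    where open ≡-Reasoning

  ∙-lincomb : ∀ {r m} (u : Vec m) (c : Vec r) (b : Vector (Vec m) r) → u ∙ lincomb c b ≡ sum
      (λ j → c j * (u ∙ b j))
  ∙-lincomb {r} {m} u c b = begin
    sum {m} (λ i → u i * sum {r} (λ j → c j * b j i))       ≡⟨ sum-cong-≗ {m} (λ i → *-distribˡ-sum (u i)
        (λ j → c j * b j i)) ⟩
    sum {m} (λ i → sum {r} (λ j → u i * (c j * b j i)))     ≡⟨ ∑-comm {m} {r} (λ i j → u i * (c j * b j i)) ⟩
    sum {r} (λ j → sum {m} (λ i → u i * (c j * b j i)))     ≡⟨ sum-cong-≗ {r} (λ j → trans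
      (sum-cong-≗ {m} λ i → solve 3 (λ u c b → u :* (c :* b) := c :* (u :* b)) refl (u i) (c j) (b j i))
      (sym (*-distribˡ-sum (c j) (λ i → u i * b j i)))) ⟩
    sum {r} (λ j → c j * sum {m} (λ i → u i * b j i))       ∎
    where open ≡-Reasoning

  sum-zero : ∀ {r} {v : Vec r} → v ≗ 0ᵛ → sum v ≡ 0#
  sum-zero {zero}  v≗0 = refl
  sum-zero {suc r} v≗0 = trans (cong₂ _+_ (v≗0 zero) (sum-zero {r} (v≗0 ∘ suc))) (+-identityˡ 0#)

  ∈-cong : ∀ {r m} {v w : Vec m} (b : Vector (Vec m) r) → v ≗ w → v ∈⟨ b ⟩ → w ∈⟨ b ⟩
  ∈-cong b v≗w (c , v≗) = c , λ i → trans (sym (v≗w i)) (v≗ i)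

  ∈-combination : ∀ {r m} {v w : Vec m} (b : Vector (Vec m) r) s t → v ∈⟨ b ⟩ → w ∈⟨ b ⟩ → (s · v +ᵛ t · w) ∈⟨ b ⟩
  ∈-combination b s t (c , v≗) (d , w≗) = (s · c +ᵛ t · d) , λ i → sym (trans (lincomb-+ (s · c) (t · d) b i)
    (cong₂ _+_ (trans (lincomb-· s c b i) (cong (s *_) (sym (v≗ i)))) (trans (lincomb-· t d b i)
        (cong (t *_) (sym (w≗ i))))))

  delta : ∀ {r} → Fin r → Vec r
  delta zero    zero    = 1#
  delta zero    (suc j) = 0#
  delta (suc i) zero    = 0#
  delta (suc i) (suc j) = delta i j

  lincomb-delta : ∀ {r m} (b : Vector (Vec m) r) j → lincomb (delta j) b ≗ b j
  lincomb-delta {suc r} b zero i = trans (cong₂ _+_ (*-identityˡ _) (sum-zero {r}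
      (λ k → zeroˡ (b (suc k) i)))) (+-identityʳ _)
  lincomb-delta {suc r} b (suc j) i = trans (cong₂ _+_ (zeroˡ _) (lincomb-delta (b ∘ suc) j i)) (+-identityˡ _)

  ∙-delta : ∀ {m} (u : Vec m) i → u ∙ delta i ≡ u i
  ∙-delta {suc m} u zero    = trans (cong₂ _+_ (*-identityʳ _) (sum-zero {m}
      (λ k → zeroʳ (u (suc k))))) (+-identityʳ _)
  ∙-delta {suc m} u (suc i) = trans (cong₂ _+_ (zeroʳ _) (∙-delta (u ∘ suc) i)) (+-identityˡ _)

  ∈-basis : ∀ {r m} (b : Vector (Vec m) r) j → b j ∈⟨ b ⟩
  ∈-basis b j = delta j , λ i → sym (lincomb-delta b j i)

  independent⇒injective : ∀ {r m} {b : Vector (Vec m) r} → Independent b → ∀ {c d} → lincomb c b ≗ lincomb d b → c ≗ d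
  independent⇒injective {b = b} ind {c} {d} eq j = x-y≡0⇒x≡y (trans
    (solve 2 (λ x y → x :- y := x :+ (:- :1) :* y) refl (c j) (d j))
    (ind (c +ᵛ (- 1#) · d) (λ i → trans (lincomb-+ c ((- 1#) · d) b i)
      (trans (cong₂ _+_ (eq i) (lincomb-· (- 1#) d b i))
        (solve 1 (λ x → x :+ (:- :1) :* x := :0) refl _))) j))

  -- The change of coordinates is injective, hence surjective by counting.
  exchange : ∀ {n} → HasOrder F n → ∀ {r m} {b w : Vector (Vec m) r} → Independent w → (∀ j → w j ∈⟨ b ⟩) →
             ∀ {v} → v ∈⟨ b ⟩ → v ∈⟨ w ⟩
  exchange order {r} {m} {b} {w} ind w∈ {v} (c , v≗) =
    let d , fd≗c = injection⇒surjection (countVec r) (countVec r) f (λ d≗d′ → lincomb-cong M d≗d′) f-injective c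
    in d , λ i → trans (v≗ i) (trans (lincomb-cong b (λ j → sym (fd≗c j)) i) (f-lincomb d i))
    where
    open FiniteField F order
    M : Vector (Vec r) r
    M j = proj₁ (w∈ j)
    f : Vec r → Vec r
    f d = lincomb d M
    f-lincomb : ∀ d → lincomb (f d) b ≗ lincomb d w
    f-lincomb d i = trans (lincomb-lincomb d M b i) (sum-cong-≗ {r} λ j → cong (d j *_) (sym (proj₂ (w∈ j) i)))
    f-injective : ∀ {d d′} → f d ≗ f d′ → d ≗ d′
    f-injective {d} {d′} eq = independent⇒injective ind
      (λ i → trans (sym (f-lincomb d i)) (trans (lincomb-cong b eq i) (f-lincomb d′ i)))


-- Coordinates of the Bruck-Bose representation

module Coordinates {K L : Field} {q : ℕ} (6≤q : 6 ≤ q) (K-order : HasOrder K q) (L-order : HasOrder L (q ℕ.^ 3))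
                   (E : FieldExtension K L) (Σ∞ : Projective.Hyperplane K 6) (S : BruckBose.RegularSpread E q Σ∞) where
  private
    module K where
      open FieldFacts K public
      open FiniteField K K-order public
      open Projective K public
      open LinearAlgebra K public
  open FieldExtension E
  open FieldFacts L
  open FiniteField L L-order
  open Frobenius 6≤q K-order L-order E
  open Projective L using (Vec; 0ᵛ; _+ᵛ_; _·_; _∙_; lincomb; basis)
  open LinearAlgebra L
  open BruckBose E q using (conj; embedᵛ)
  open K.Hyperplane Σ∞ using (form) renaming (nonzero to form≢0)
  open BruckBose.RegularSpread S

  trace-+ : ∀ x y → trace (x + y) ≡ trace x + trace y
  trace-+ x y = trans (cong₂ (λ u v → x + y + u + v) (frob-+ x y) (trans (cong frob (frob-+ x y)) (frob-+ _ _)))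
    (solve 6 (λ a b c d e f → a :+ b :+ (c :+ d) :+ (e :+ f) := a :+ c :+ e :+ (b :+ d :+ f)) refl _ _ _ _ _ _)

  trace-frob : ∀ x → trace (frob x) ≡ trace x
  trace-frob x = trans (cong (frob x + frob (frob x) +_) (frob³ x))
    (solve 3 (λ a b c → b :+ c :+ a := a :+ b :+ c) refl x _ _)

  trace-fixed* : ∀ {s} → frob s ≡ s → ∀ x → trace (s * x) ≡ s * trace x
  trace-fixed* {s} fix x = trans (cong₂ (λ u v → s * x + u + v) (step x) (trans
      (cong frob (step x)) (step (frob x))))
    (solve 4 (λ s a b c → s :* a :+ s :* b :+ s :* c := s :* (a :+ b :+ c)) refl s _ _ _)
    where
    step : ∀ x → frob (s * x) ≡ s * frob x
    step x = trans (frob-* s x) (cong (_* frob x) fix)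

  opaque
    averagingElement : ∃[ α ] trace α ≡ 1#
    averagingElement = trace-1

  α : Carrier
  α = proj₁ averagingElement

  -- The spread only gives an expression of w as x + y^q + z^(q²) with independent x, y, z.
  -- Multiplying by α and taking traces makes the three summands conjugate.
  averaging : ∀ {w x y z} → frob w ≡ w → w ≡ x + (frob y + frob (frob z)) →
              w ≡ trace (α * x + frob α * z + frob (frob α) * y)
  averaging {w} {x} {y} {z} fix eq = begin
    w
      ≡⟨ *-identityʳ w ⟨
    w * 1#
      ≡⟨ cong (w *_) (proj₂ averagingElement) ⟨
    w * trace α
      ≡⟨ trace-fixed* fix α ⟨
    trace (w * α)
      ≡⟨ cong (λ v → trace (v * α)) eq ⟩
    trace ((x + (frob y + frob (frob z))) * α)
      ≡⟨ cong trace (solve 4 (λ x y z α → (x :+ (y :+ z)) :* α := α :* x :+ α :* z :+ α :* y) refl x _ _ α) ⟩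
    trace (α * x + α * frob (frob z) + α * frob y)
      ≡⟨ trans (trace-+ _ _) (cong (_+ trace (α * frob y)) (trace-+ _ _)) ⟩
    trace (α * x) + trace (α * frob (frob z)) + trace (α * frob y)
      ≡⟨ cong₂ (λ u v → trace (α * x) + u + v)
           (trans (sym (trace-frob _)) (cong trace (trans (frob-* _ _) (cong (frob α *_) (frob³ z)))))
           (trans (sym (trans (trace-frob _) (trace-frob _)))
             (cong trace (trans (trans (cong frob (frob-* _ _)) (frob-* _ _))
                 (cong (frob (frob α) *_) (frob³ y))))) ⟩
    trace (α * x) + trace (frob α * z) + trace (frob (frob α) * y)
      ≡⟨ trans (trace-+ _ _) (cong (_+ trace (frob (frob α) * y)) (trace-+ _ _)) ⟨
    trace (α * x + frob α * z + frob (frob α) * y)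
      ∎
    where open ≡-Reasoning

  opaque
    tr : Carrier → K.Carrier
    tr x = proj₁ (frob-fixed (frob-trace x))

    embed-tr : ∀ x → embed (tr x) ≡ trace x
    embed-tr x = proj₂ (frob-fixed (frob-trace x))

  embed-sum : ∀ {m} (v : K.Vec m) → embed (K.sum v) ≡ sum (embed ∘ v)
  embed-sum {zero}  v = embed-0
  embed-sum {suc m} v = trans (embed-+ _ _) (cong (embed (v zero) +_) (embed-sum (v ∘ suc)))

  frob-sum : ∀ {m} (v : Vec m) → frob (sum v) ≡ sum (frob ∘ v)
  frob-sum {zero}  v = frob-0
  frob-sum {suc m} v = trans (frob-+ _ _) (cong (frob (v zero) +_) (frob-sum (v ∘ suc)))

  embed-∙ : ∀ {m} (u v : K.Vec m) → embed (u K.∙ v) ≡ embedᵛ u ∙ embedᵛ v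
  embed-∙ {m} u v = trans (embed-sum (λ i → u i K.* v i)) (sum-cong-≗ {m} λ i → embed-* (u i) (v i))

  conj-∙ : ∀ {m} (u : K.Vec m) (X : Vec m) → embedᵛ u ∙ conj X ≡ frob (embedᵛ u ∙ X)
  conj-∙ {m} u X = sym (trans (frob-sum (λ i → embed (u i) * X i)) (sum-cong-≗ {m} λ i →
    trans (frob-* _ _) (cong (_* frob (X i)) (frob-embed (u i)))))

  opaque
    pivot : ∃[ i ] form i ≢ K.0#
    pivot = Fin.¬∀⟶∃¬ 7 (λ i → form i ≡ K.0#) (λ i → form i K.≟ K.0#) form≢0

    origin : ∃[ e ] form K.∙ e ≡ K.1#
    origin = let i , fi≢0 = pivot
                 r , r*≡1 = K.inverse (form i) fi≢0
             in r K.· K.delta i , trans (K.∙-· form r (K.delta i)) (trans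
                 (cong (r K.*_) (K.∙-delta form i)) r*≡1)

  Coordinate : Set
  Coordinate = K.Carrier × Carrier × Carrier

  infixl 6 _⊕_
  infixr 7 _⊙_

  _⊕_ : Coordinate → Coordinate → Coordinate
  (k , a , b) ⊕ (k′ , a′ , b′) = k K.+ k′ , a + a′ , b + b′

  _⊙_ : K.Carrier → Coordinate → Coordinate
  s ⊙ (k , a , b) = s K.* k , embed s * a , embed s * b

  onSpine : Carrier → Carrier → Vec 7
  onSpine a b = lincomb (a ∷ b ∷ []) (basis g)

  onSpine-+ : ∀ a b a′ b′ i → onSpine (a + a′) (b + b′) i ≡ onSpine a b i + onSpine a′ b′ i
  onSpine-+ a b a′ b′ i = solve 6 (λ a b a′ b′ x y → (a :+ a′) :* x :+ ((b :+ b′) :* y :+ :0)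
    := a :* x :+ (b :* y :+ :0) :+ (a′ :* x :+ (b′ :* y :+ :0))) refl
    a b a′ b′ (basis g zero i) (basis g (suc zero) i)

  onSpine-· : ∀ s a b i → onSpine (s * a) (s * b) i ≡ s * onSpine a b i
  onSpine-· s a b i = solve 5 (λ s a b x y → s :* a :* x :+ (s :* b :* y :+ :0)
    := s :* (a :* x :+ (b :* y :+ :0))) refl s a b (basis g zero i) (basis g (suc zero) i)

  e : K.Vec 7
  e = proj₁ origin

  τ : Coordinate → K.Vec 7
  τ (k , a , b) i = k K.* e i K.+ tr (onSpine a b i)

  embed-τ : ∀ k a b i → embed (τ (k , a , b) i) ≡ embed k * embed (e i) + trace (onSpine a b i)
  embed-τ k a b i = trans (embed-+ _ _) (cong₂ _+_ (embed-* k (e i)) (embed-tr _))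

  τ-⊕ : ∀ c d → τ (c ⊕ d) ≗ τ c K.+ᵛ τ d
  τ-⊕ (k , a , b) (k′ , a′ , b′) i = embed-injective (begin
    embed (τ (k K.+ k′ , a + a′ , b + b′) i)
      ≡⟨ embed-τ _ _ _ i ⟩
    embed (k K.+ k′) * embed (e i) + trace (onSpine (a + a′) (b + b′) i)
      ≡⟨ cong₂ _+_ (cong (_* embed (e i)) (embed-+ k k′)) (trans
          (cong trace (onSpine-+ a b a′ b′ i)) (trace-+ _ _)) ⟩
    (embed k + embed k′) * embed (e i) + (trace (onSpine a b i) + trace (onSpine a′ b′ i))
      ≡⟨ solve 5 (λ k l e x y → (k :+ l) :* e :+ (x :+ y) := k :* e :+ x :+ (l :* e :+ y))
          refl (embed k) (embed k′) (embed (e i)) _ _ ⟩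
    embed k * embed (e i) + trace (onSpine a b i) + (embed k′ * embed (e i) + trace (onSpine a′ b′ i))
      ≡⟨ trans (embed-+ _ _) (cong₂ _+_ (embed-τ k a b i) (embed-τ k′ a′ b′ i)) ⟨
    embed (τ (k , a , b) i K.+ τ (k′ , a′ , b′) i)
      ∎)
    where open ≡-Reasoning

  τ-⊙ : ∀ s c → τ (s ⊙ c) ≗ s K.· τ c
  τ-⊙ s (k , a , b) i = embed-injective (begin
    embed (τ (s K.* k , embed s * a , embed s * b) i)
      ≡⟨ embed-τ _ _ _ i ⟩
    embed (s K.* k) * embed (e i) + trace (onSpine (embed s * a) (embed s * b) i)
      ≡⟨ cong₂ _+_ (cong (_* embed (e i)) (embed-* s k))
           (trans (cong trace (onSpine-· (embed s) a b i)) (trace-fixed* (frob-embed s) _)) ⟩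
    embed s * embed k * embed (e i) + embed s * trace (onSpine a b i)
      ≡⟨ solve 4 (λ s k e x → s :* k :* e :+ s :* x := s :* (k :* e :+ x))
          refl (embed s) (embed k) (embed (e i)) _ ⟩
    embed s * (embed k * embed (e i) + trace (onSpine a b i))
      ≡⟨ trans (embed-* _ _) (cong (embed s *_) (embed-τ k a b i)) ⟨
    embed (s K.* τ (k , a , b) i)
      ∎)
    where open ≡-Reasoning

  -- The trace part lies in the hyperplane: `form` has coefficients in `K`, so it vanishes on the
  -- conjugates of a vector of `g` as well as on the vector itself.
  form-τ : ∀ k a b → form K.∙ τ (k , a , b) ≡ k
  form-τ k a b = embed-injective (begin
    embed (form K.∙ τ (k , a , b))
      ≡⟨ embed-∙ form (τ (k , a , b)) ⟩
    embedᵛ form ∙ embedᵛ (τ (k , a , b))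
      ≡⟨ ∙-cong (embedᵛ form) (embed-τ k a b) ⟩
    embedᵛ form ∙ (embed k · embedᵛ e +ᵛ (X +ᵛ conj X +ᵛ conj (conj X)))
      ≡⟨ ∙-+ (embedᵛ form) (embed k · embedᵛ e) (X +ᵛ conj X +ᵛ conj (conj X)) ⟩
    embedᵛ form ∙ (embed k · embedᵛ e) + embedᵛ form ∙ (X +ᵛ conj X +ᵛ conj (conj X))
      ≡⟨ cong₂ _+_
           (trans (∙-· (embedᵛ form) (embed k) (embedᵛ e)) (cong (embed k *_) (trans (sym (embed-∙ form e))
               (trans (cong embed (proj₂ origin)) embed-1))))
           (trans (∙-+ (embedᵛ form) (X +ᵛ conj X) (conj (conj X)))
               (cong₂ _+_ (∙-+ (embedᵛ form) X (conj X)) refl)) ⟩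
    embed k * 1# + (embedᵛ form ∙ X + embedᵛ form ∙ conj X + embedᵛ form ∙ conj (conj X))
      ≡⟨ cong₂ _+_ (*-identityʳ _) (trans (cong₂ _+_ (cong₂ _+_ X∈ (conj∈ X X∈)) (conj∈ (conj X) (conj∈ X X∈)))
           (trans (+-identityʳ _) (+-identityʳ 0#))) ⟩
    embed k + 0#
      ≡⟨ +-identityʳ _ ⟩
    embed k
      ∎)
    where
    open ≡-Reasoning
    X = onSpine a b
    X∈ : embedᵛ form ∙ X ≡ 0#
    X∈ = g⊆Σ∞* X ((a ∷ b ∷ []) , λ _ → refl)
    conj∈ : ∀ X → embedᵛ form ∙ X ≡ 0# → embedᵛ form ∙ conj X ≡ 0#
    conj∈ X eq = trans (conj-∙ form X) (trans (cong frob eq) frob-0)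

  averaged : ∀ {a b c d e f w} i → frob w ≡ w → w ≡ onSpine a b i + (frob (onSpine c d i) + frob (frob (onSpine e f i))) →
             w ≡ trace (onSpine (α * a + frob α * e + frob (frob α) * c) (α * b + frob α * f + frob (frob α) * d) i)
  averaged {a} {b} {c} {d} {e} {f} i fix eq = trans (averaging fix eq) (cong trace (sym (begin
    onSpine (α * a + frob α * e + frob (frob α) * c) (α * b + frob α * f + frob (frob α) * d) i
      ≡⟨ onSpine-+ _ _ _ _ i ⟩
    onSpine (α * a + frob α * e) (α * b + frob α * f) i + onSpine (frob (frob α) * c) (frob (frob α) * d) i
      ≡⟨ cong₂ _+_ (trans (onSpine-+ _ _ _ _ i)
          (cong₂ _+_ (onSpine-· α a b i) (onSpine-· (frob α) e f i))) (onSpine-· (frob (frob α)) c d i) ⟩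
    α * onSpine a b i + frob α * onSpine e f i + frob (frob α) * onSpine c d i
      ∎)))
    where open ≡-Reasoning

  direction : K.Vec 7 → K.Vec 7
  direction v i = v i K.- (form K.∙ v) K.* e i

  direction∈Σ∞ : ∀ v → embedᵛ form ∙ embedᵛ (direction v) ≡ 0#
  direction∈Σ∞ v = trans (sym (embed-∙ form (direction v))) (trans (cong embed eq) embed-0)
    where
    open ≡-Reasoning
    eq : form K.∙ direction v ≡ K.0#
    eq = begin
      form K.∙ direction v
        ≡⟨ K.∙-cong form {direction v} {v K.+ᵛ (K.- (form K.∙ v)) K.· e}
             (λ i → K.solve 3 (λ v k e → v K.:- k K.:* e K.:= v K.:+ (K.:- k) K.:* e)
                 refl (v i) (form K.∙ v) (e i)) ⟩
      form K.∙ (v K.+ᵛ (K.- (form K.∙ v)) K.· e)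
        ≡⟨ trans (K.∙-+ form v ((K.- (form K.∙ v)) K.· e))
             (cong (form K.∙ v K.+_) (trans (K.∙-· form (K.- (form K.∙ v)) e)
                 (cong (K.- (form K.∙ v) K.*_) (proj₂ origin)))) ⟩
      form K.∙ v K.+ K.- (form K.∙ v) K.* K.1#
        ≡⟨ K.solve 1 (λ k → k K.:+ K.:- k K.:* K.:1 K.:= K.:0) refl (form K.∙ v) ⟩
      K.0# ∎

  τ-direction : ∀ v a b → (∀ i → embed (direction v i) ≡ trace (onSpine a b i)) → τ (form K.∙ v , a , b) ≗ v
  τ-direction v a b eq i = embed-injective (begin
    embed (τ (k , a , b) i)
      ≡⟨ embed-τ k a b i ⟩
    embed k * embed (e i) + trace (onSpine a b i)
      ≡⟨ cong₂ _+_ (embed-* k (e i)) (eq i) ⟨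
    embed (k K.* e i) + embed (direction v i)
      ≡⟨ embed-+ (k K.* e i) (direction v i) ⟨
    embed (k K.* e i K.+ (v i K.- k K.* e i))
      ≡⟨ cong embed (K.solve 2 (λ v x → x K.:+ (v K.:- x) K.:= v) refl (v i) (k K.* e i)) ⟩
    embed (v i)
      ∎)
    where
    open ≡-Reasoning
    k = form K.∙ v

  spanned : ∀ (w : K.Vec 7) {X Y Z} (x y z : Vec 2) → X ≗ lincomb x (basis g) → Y ≗ lincomb y (basis g) → Z ≗ lincomb z (basis g) →
            embedᵛ w ≗ (X +ᵛ conj Y +ᵛ conj (conj Z)) →
            ∃₂ λ a b → ∀ i → embed (w i) ≡ trace (onSpine a b i)
  spanned w x y z X≗ Y≗ Z≗ w≗ = _ , _ , λ i → averaged
    {x zero} {x (suc zero)} {y zero} {y (suc zero)} {z zero} {z (suc zero)} i (frob-embed (w i))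
    (trans (w≗ i) (trans (cong₂ _+_ (cong₂ _+_ (X≗ i) (cong frob (Y≗ i))) (cong (frob ∘ frob) (Z≗ i)))
      (+-assoc _ _ _)))

  opaque
    τ-surjective : ∀ v → ∃[ c ] τ c ≗ v
    τ-surjective v =
      let X , Y , Z , (x , X≗) , (y , Y≗) , (z , Z≗) , W≗ = g-spans (embedᵛ (direction v)) (direction∈Σ∞ v)
          a , b , eq = spanned (direction v) x y z X≗ Y≗ Z≗ W≗
      in (form K.∙ v , a , b) , τ-direction v a b eq

  opaque
    count-coordinates : Counted (≡.setoid Coordinate) (q ℕ.^ 7)
    count-coordinates = Counted-≡ (cong (q ℕ.*_) (sym (ℕ.^-distribˡ-+-* q 3 3)))
      (compose (K-order ×-↔ compose (L-order ×-↔ L-order) (symmetry Fin.*↔×)) (symmetry Fin.*↔×))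

  -- The spread supplies spanning, hence surjectivity. Both sides have q⁷ elements, so uniqueness of
  -- the coordinates follows by counting.
  τ-injective : ∀ {c d} → τ c ≗ τ d → c ≡ d
  τ-injective = section⇒injective count-coordinates (K.countVec 7) τ (λ { refl _ → refl })
    (proj₁ ∘ τ-surjective) (proj₂ ∘ τ-surjective)

-- Points and lines of the representation in homogeneous coordinates

module Representation {K L : Field} {q : ℕ} (6≤q : 6 ≤ q) (K-order : HasOrder K q) (L-order : HasOrder L (q ℕ.^ 3))
                      (E : FieldExtension K L) (Σ∞ : Projective.Hyperplane K 6) (S : BruckBose.RegularSpread E q Σ∞) where
  private
    module K where
      open FieldFacts K public
      open FiniteField K K-order public
      open Projective K public
      open LinearAlgebra K public
  open FieldExtension E
  open FieldFacts L
  open FiniteField L L-order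
  open Frobenius 6≤q K-order L-order E
  open Coordinates 6≤q K-order L-order E Σ∞ S
  open Triples L
  open Projective L using (Vec; lincomb; _∈⟨_⟩; basis)
  open BruckBose E q using (conj; embedᵛ; InΣ∞)
  open K.Hyperplane Σ∞ using (form)
  open BruckBose.RegularSpread S
  open IncidenceStructure (BruckBose.representation E q S) using (Point; Line; _I_)
  open BruckBose E q using (AffinePoint; SpreadPlane)

  -- In the coordinates `τ`, the spread plane through the point a g₀ + b g₁ of `g` consists of the
  -- L-multiples of (a , b) at height 0. This is why it becomes the single point (0 : a : b).
  InPlane : Carrier → Carrier → K.Vec 7 → Set
  InPlane a b v = ∃[ c ] v ≗ τ (K.0# , c * a , c * b)

  trace≡ : ∀ c x → trace (c * x) ≡ c * x + (frob c * frob x + (frob (frob c) * frob (frob x) + 0#))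
  trace≡ c x = trans (cong₂ (λ u v → c * x + u + v) (frob-* c x) (trans (cong frob (frob-* c x)) (frob-* _ _)))
    (solve 3 (λ a b c → a :+ b :+ c := a :+ (b :+ (c :+ :0))) refl _ _ _)

  embed-τ₀ : ∀ a b i → embed (τ (K.0# , a , b) i) ≡ trace (onSpine a b i)
  embed-τ₀ a b i = trans (embed-τ K.0# a b i) (trans (cong
      (λ z → z * embed (e i) + trace (onSpine a b i)) embed-0)
    (solve 2 (λ x y → :0 :* x :+ y := y) refl (embed (e i)) (trace (onSpine a b i))))

  module _ {X : Vec 7} {a b : Carrier} (X≗ : X ≗ onSpine a b) where

    plane⇒ : ∀ v → InΣ∞ Σ∞ v → embedᵛ v ∈⟨ X ∷ conj X ∷ conj (conj X) ∷ [] ⟩ → InPlane a b v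
    plane⇒ v v∈Σ∞ (d , v≗) = c , λ i → embed-injective (trans (eq i) (sym (embed-τ₀ (c * a) (c * b) i)))
      where
      -- `averaging` expects summands of the shape x, `frob y` and `frob (frob z)`. By `frob³`, the
      -- second coefficient is `frob` of d₁ and the third is `frob ∘ frob` of d₂.
      d₀ = d zero
      d₁ = frob (frob (d (suc zero)))
      d₂ = frob (d (suc (suc zero)))
      c = α * d₀ + frob α * d₂ + frob (frob α) * d₁
      eq : ∀ i → embed (v i) ≡ trace (onSpine (c * a) (c * b) i)
      eq i = trans (averaging {x = d₀ * X i} {y = d₁ * X i} {z = d₂ * X i} (frob-embed (v i)) (trans (v≗ i)
          (cong (d₀ * X i +_)
          (cong₂ _+_ (sym (trans (frob-* d₁ (X i)) (cong (_* frob (X i)) (frob³ _))))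
            (trans (+-identityʳ _) (sym (trans (cong frob (frob-* d₂ (X i))) (trans (frob-* _ _)
                (cong (_* frob (frob (X i))) (frob³ _))))))))))
        (cong trace (trans (solve 7 (λ α β γ d₀ d₁ d₂ x → α :* (d₀ :* x) :+ β :* (d₂ :* x) :+ γ :* (d₁ :* x)
            := (α :* d₀ :+ β :* d₂ :+ γ :* d₁) :* x) refl α (frob α) (frob (frob α)) d₀ d₁ d₂ (X i))
          (trans (cong (c *_) (X≗ i)) (sym (onSpine-· c a b i)))))

    plane⇐ : ∀ v → InPlane a b v → InΣ∞ Σ∞ v × embedᵛ v ∈⟨ X ∷ conj X ∷ conj (conj X) ∷ [] ⟩
    plane⇐ v (c , v≗) = trans (K.∙-cong form v≗) (form-τ K.0# (c * a) (c * b)) ,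
      (c ∷ frob c ∷ frob (frob c) ∷ []) , λ i → trans (cong embed (v≗ i)) (trans (embed-τ₀ (c * a) (c * b) i)
        (trans (cong trace (trans (onSpine-· c a b i) (cong (c *_) (sym (X≗ i))))) (trace≡ c (X i))))

  -- The direction of a spread plane, as a point of the line g.
  slope : SpreadPlane S → Carrier × Carrier
  slope (_ , X , (c , _) , _) = c zero , c (suc zero)

  slope≢0 : ∀ U → ¬ (proj₁ (slope U) ≡ 0# × proj₂ (slope U) ≡ 0#)
  slope≢0 (_ , X , (c , X≗) , _) (a≡0 , b≡0) = Projective.nonzero X λ i → trans (X≗ i)
    (trans (cong₂ (λ a b → a * basis g zero i + (b * basis g (suc zero) i + 0#)) a≡0 b≡0)
      (solve 2 (λ x y → :0 :* x :+ (:0 :* y :+ :0) := :0) refl _ _))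

  inPlane⇒ : ∀ U {v} → v K.∈ proj₁ U → InPlane (proj₁ (slope U)) (proj₂ (slope U)) v
  inPlane⇒ (_ , X , (c , X≗) , char) {v} v∈ = let v∈Σ∞ , v∈X = Equivalence.to (char v) v∈ in plane⇒ X≗ v v∈Σ∞ v∈X

  inPlane⇐ : ∀ U {v} → InPlane (proj₁ (slope U)) (proj₂ (slope U)) v → v K.∈ proj₁ U
  inPlane⇐ (_ , X , (c , X≗) , char) {v} v∈ = Equivalence.from (char v) (plane⇐ X≗ v v∈)

  coordinate : K.Vec 7 → Coordinate
  coordinate v = proj₁ (τ-surjective v)

  τ-coordinate : ∀ v → τ (coordinate v) ≗ v
  τ-coordinate v = proj₂ (τ-surjective v)

  embedded : Coordinate → Triple
  embedded (k , a , b) = embed k , a , b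

  homogeneous : Point → Triple
  homogeneous (inj₁ P) = embedded (coordinate (K.coords (proj₁ P)))
  homogeneous (inj₂ U) = 0# , slope U

  height≡ : ∀ {k a b v} → τ (k , a , b) ≗ v → k ≡ form K.∙ v
  height≡ {k} {a} {b} eq = trans (sym (form-τ k a b)) (K.∙-cong form eq)

  affine-height≢0 : ∀ (P : AffinePoint S) → proj₁ (coordinate (K.coords (proj₁ P))) ≢ K.0#
  affine-height≢0 (P , P∉) eq = P∉ (trans (sym (height≡ (τ-coordinate (K.coords P)))) eq)

  proportional-pair : ∀ {a b s t} → ¬ (a ≡ 0# × b ≡ 0#) → b * s ≡ a * t → ∃[ c ] s ≡ c * a × t ≡ c * b
  proportional-pair {a} {b} {s} {t} ≢0 eq = decide (a ≟ 0#)
    where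
    decide : Dec (a ≡ 0#) → ∃[ c ] s ≡ c * a × t ≡ c * b
    decide (no a≢0) = let r , ra≡1 = inverse a a≢0 in r * s ,
      sym (trans (solve 3 (λ r s a → r :* s :* a := r :* a :* s) refl r s a) (trans (cong (_* s) ra≡1)
          (*-identityˡ s))) ,
      sym (trans (solve 3 (λ r s b → r :* s :* b := r :* (b :* s)) refl r s b) (trans (cong (r *_) eq)
        (trans (sym (*-assoc r a t)) (trans (cong (_* t) ra≡1) (*-identityˡ t)))))
    decide (yes a≡0) = let r , rb≡1 = inverse b b≢0 in r * t ,
      trans s≡0 (sym (trans (cong (r * t *_) a≡0) (zeroʳ _))) ,
      sym (trans (solve 3 (λ r t b → r :* t :* b := r :* b :* t) refl r t b) (trans (cong (_* t) rb≡1)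
          (*-identityˡ t)))
      where
      b≢0 : b ≢ 0#
      b≢0 b≡0 = ≢0 (a≡0 , b≡0)
      s≡0 : s ≡ 0#
      s≡0 = *-cancelˡ-0 b≢0 (trans eq (trans (cong (_* t) a≡0) (zeroˡ t)))

  record LineForm (m : Line) : Set where
    field
      l     : Triple
      l≢0   : l ≢ 0₃
      image : ∀ P → P I m ⇔ l ∙₃ homogeneous P ≡ 0#

  lineAtInfinity : LineForm (inj₂ tt)
  lineAtInfinity = record { l = e₀ ; l≢0 = λ eq → 1≢0 (cong proj₁ eq) ; image = image }
    where
    first : ∀ k a b → e₀ ∙₃ (k , a , b) ≡ k
    first = solve 3 (λ k a b → :1 :* k :+ :0 :* a :+ :0 :* b := k) refl
    image : ∀ P → P I inj₂ tt ⇔ e₀ ∙₃ homogeneous P ≡ 0#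
    image (inj₁ P) = mk⇔ (λ ()) λ eq → affine-height≢0 P (embed-injective (trans (sym (first _ _ _))
        (trans eq (sym embed-0))))
    image (inj₂ U) = mk⇔ (λ _ → first 0# _ _) (λ _ → tt)

  -- An affine line, given by an affine point P₀ = τ (k₀ , a₀ , b₀) and its spread plane U of slope (a₁ , b₁).
  module _ (V : K.Space 3 6) (U : SpreadPlane S) (U⊆V : ∀ v → v K.∈ proj₁ U → v K.∈ V)
           (P₀ : K.Vec 7) (P₀∈V : P₀ K.∈ V) (k₀ : K.Carrier) (a₀ b₀ : Carrier)
           (P₀≗ : τ (k₀ , a₀ , b₀) ≗ P₀) (k₀≢0 : k₀ ≢ K.0#) where
    private
      a₁ = proj₁ (slope U)
      b₁ = proj₂ (slope U)
      u : Vector (K.Vec 7) 3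
      u = K.basis (proj₁ U)

    u∈Σ∞ : ∀ {v} → InPlane a₁ b₁ v → form K.∙ v ≡ K.0#
    u∈Σ∞ (c , v≗) = trans (K.∙-cong form v≗) (form-τ K.0# (c * a₁) (c * b₁))

    form-lincomb : ∀ s (d : K.Vec 3) → form K.∙ (K.lincomb (s ∷ d) (P₀ ∷ u)) ≡ s K.* k₀
    form-lincomb s d = trans (K.∙-lincomb form (s ∷ d) (P₀ ∷ u)) (trans
      (cong₂ K._+_ (cong (s K.*_) (sym (height≡ P₀≗)))
        (K.sum-zero (λ j → trans (cong (d j K.*_) (u∈Σ∞ (inPlane⇒ U (K.∈-basis u j)))) (K.zeroʳ (d j)))))
      (K.+-identityʳ _))

    generators-independent : K.Independent (P₀ ∷ u)
    generators-independent c eq = λ { zero → c₀≡0 ; (suc j) → K.independent (proj₁ U) (c ∘ suc) tail-eq j }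
      where
      c₀≡0 : c zero ≡ K.0#
      c₀≡0 = K.*-cancelʳ-0 k₀≢0 (trans (sym (form-lincomb (c zero) (c ∘ suc)))
        (trans (K.∙-cong form eq) (K.∙-0 form)))
      tail-eq : K.lincomb (c ∘ suc) u ≗ K.0ᵛ
      tail-eq i = trans (sym (K.+-identityˡ _)) (trans (cong (K._+ K.lincomb (c ∘ suc) u i)
        (sym (trans (cong (K._* P₀ i) c₀≡0) (K.zeroˡ (P₀ i))))) (eq i))

    generators∈V : ∀ j → (P₀ ∷ u) j K.∈⟨ K.basis V ⟩
    generators∈V zero    = P₀∈V
    generators∈V (suc j) = U⊆V (u j) (K.∈-basis u j)

    -- By exchange, `P₀` and the basis of `U` span `V`. As `form` vanishes on `U` but not at `P₀`, a
    -- vector of `V` in the hyperplane has no component along `P₀`.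
    V∩Σ∞⊆U : ∀ {v} → v K.∈ V → form K.∙ v ≡ K.0# → InPlane a₁ b₁ v
    V∩Σ∞⊆U {v} v∈V v∈Σ∞ = inPlane⇒ U (proj₁ v∈ ∘ suc , λ i → trans (proj₂ v∈ i)
        (trans (cong (λ z → z K.* P₀ i K.+ K.lincomb (proj₁ v∈ ∘ suc) u i) c₀≡0)
          (K.solve 2 (λ x y → K.:0 K.:* x K.:+ y K.:= y) refl (P₀ i) _)))
      where
      v∈ : v K.∈⟨ P₀ ∷ u ⟩
      v∈ = K.exchange K-order {b = K.basis V} generators-independent generators∈V v∈V
      c₀≡0 : proj₁ v∈ zero ≡ K.0#
      c₀≡0 = K.*-cancelʳ-0 k₀≢0 (trans (sym (form-lincomb (proj₁ v∈ zero) (proj₁ v∈ ∘ suc)))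
        (trans (K.∙-cong form (λ i → trans (lincomb-η i) (sym (proj₂ v∈ i)))) v∈Σ∞))
        where
        lincomb-η : K.lincomb (proj₁ v∈ zero ∷ (proj₁ v∈ ∘ suc)) (P₀ ∷ u) ≗ K.lincomb (proj₁ v∈) (P₀ ∷ u)
        lincomb-η i = refl

    -- The cross product of (k₀, a₀, b₀) and (0, a₁, b₁): the equation of the line joining the two
    -- points.
    affineForm : Triple
    affineForm = a₀ * b₁ - b₀ * a₁ , - (embed k₀ * b₁) , embed k₀ * a₁

    affineForm≢0 : affineForm ≢ 0₃
    affineForm≢0 eq = slope≢0 U (*-cancelˡ-0 (embed-≢0 k₀≢0) (cong (proj₂ ∘ proj₂) eq) ,
      *-cancelˡ-0 (embed-≢0 k₀≢0) (trans (sym (-‿involutive _)) (trans (cong -_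
          (cong (proj₁ ∘ proj₂) eq)) -0#≈0#)))

    affineForm-∙ : ∀ k a b → affineForm ∙₃ (k , a , b) ≡ b₁ * (k * a₀ - embed k₀ * a) - a₁ * (k * b₀ - embed k₀ * b)
    affineForm-∙ k a b = solve 8 (λ a₀ b₀ a₁ b₁ k₀ k a b → (a₀ :* b₁ :- b₀ :* a₁) :* k :+ :- (k₀ :* b₁) :* a :+ k₀ :* a₁ :* b
      := b₁ :* (k :* a₀ :- k₀ :* a) :- a₁ :* (k :* b₀ :- k₀ :* b)) refl a₀ b₀ a₁ b₁ (embed k₀) k a b

    -- The point at infinity of the line joining P₀ to τ (k , a , b).
    module _ {v : K.Vec 7} {k : K.Carrier} {a b : Carrier} (v≗ : τ (k , a , b) ≗ v) where
      s t : Carrier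
      s = embed k * a₀ - embed k₀ * a
      t = embed k * b₀ - embed k₀ * b

      difference : τ (K.0# , s , t) ≗ k K.· P₀ K.+ᵛ (K.- k₀) K.· v
      difference i = begin
        τ (K.0# , s , t) i
          ≡⟨ cong (λ c → τ c i) (triple-eq (K.solve 2 (λ k l → K.:0 K.:= k K.:* l K.:+ (K.:- l) K.:* k)
              refl k k₀) (neg a₀ a) (neg b₀ b)) ⟩
        τ (k ⊙ (k₀ , a₀ , b₀) ⊕ (K.- k₀) ⊙ (k , a , b)) i
          ≡⟨ τ-⊕ (k ⊙ (k₀ , a₀ , b₀)) ((K.- k₀) ⊙ (k , a , b)) i ⟩
        τ (k ⊙ (k₀ , a₀ , b₀)) i K.+ τ ((K.- k₀) ⊙ (k , a , b)) i
          ≡⟨ cong₂ K._+_ (trans (τ-⊙ k _ i) (cong (k K.*_) (P₀≗ i))) (trans (τ-⊙ (K.- k₀) _ i)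
              (cong (K.- k₀ K.*_) (v≗ i))) ⟩
        k K.* P₀ i K.+ K.- k₀ K.* v i
          ∎
        where
        open ≡-Reasoning
        neg : ∀ x y → embed k * x - embed k₀ * y ≡ embed k * x + embed (K.- k₀) * y
        neg x y = trans (solve 4 (λ k l x y → k :* x :- l :* y := k :* x :+ (:- l) :* y)
            refl (embed k) (embed k₀) x y)
          (cong (λ z → embed k * x + z * y) (sym (embed-neg k₀)))
        triple-eq : ∀ {k k′ : K.Carrier} {a a′ b b′ : Carrier} → k ≡ k′ → a ≡ a′ → b ≡ b′ → (k , a , b) ≡ (k′ , a′ , b′)
        triple-eq refl refl refl = refl

      affine⇒ : v K.∈ V → affineForm ∙₃ (embed k , a , b) ≡ 0#
      affine⇒ v∈V = on-form (V∩Σ∞⊆U (K.∈-cong (K.basis V)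
          (λ i → sym (difference i)) (K.∈-combination (K.basis V) k (K.- k₀) P₀∈V v∈V)) (form-τ K.0# s t))
        where
        on-form : InPlane a₁ b₁ (τ (K.0# , s , t)) → affineForm ∙₃ (embed k , a , b) ≡ 0#
        on-form (c , eq) = let c≡ = τ-injective eq in trans (affineForm-∙ (embed k) a b)
          (trans (cong₂ (λ x y → b₁ * x - a₁ * y) (cong (proj₁ ∘ proj₂) c≡) (cong (proj₂ ∘ proj₂) c≡))
            (solve 3 (λ a b c → b :* (c :* a) :- a :* (c :* b) := :0) refl a₁ b₁ c))

      affine⇐ : affineForm ∙₃ (embed k , a , b) ≡ 0# → v K.∈ V
      affine⇐ eq = recover (K.inverse k₀ k₀≢0) (U⊆V _ (inPlane⇐ U (on-plane
          (proportional-pair (slope≢0 U) (x-y≡0⇒x≡y (trans (sym (affineForm-∙ (embed k) a b)) eq))))))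
        where
        on-plane : ∃[ c ] s ≡ c * a₁ × t ≡ c * b₁ → InPlane a₁ b₁ (τ (K.0# , s , t))
        on-plane (c , s≡ , t≡) = c , λ i → cong₂ (λ x y → τ (K.0# , x , y) i) s≡ t≡
        recover : ∃[ r ] r K.* k₀ ≡ K.1# → τ (K.0# , s , t) K.∈ V → v K.∈ V
        recover (r , rk₀≡1) d∈V = K.∈-cong (K.basis V) (λ i → begin
            r K.* k K.* P₀ i K.+ K.- r K.* τ (K.0# , s , t) i
              ≡⟨ cong (λ z → r K.* k K.* P₀ i K.+ K.- r K.* z) (difference i) ⟩
            r K.* k K.* P₀ i K.+ K.- r K.* (k K.* P₀ i K.+ K.- k₀ K.* v i)
              ≡⟨ K.solve 5 (λ r k p l v → r K.:* k K.:* p K.:+ K.:- r K.:* (k K.:* p K.:+ K.:- l K.:* v)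
                  K.:= r K.:* l K.:* v) refl r k (P₀ i) k₀ (v i) ⟩
            r K.* k₀ K.* v i
              ≡⟨ trans (cong (K._* v i) rk₀≡1) (K.*-identityˡ (v i)) ⟩
            v i ∎) (K.∈-combination (K.basis V) (r K.* k) (K.- r) P₀∈V d∈V)
          where open ≡-Reasoning

    infinite⇒ : ∀ U′ → (∀ v → v K.∈ proj₁ U′ → v K.∈ V) → affineForm ∙₃ (0# , slope U′) ≡ 0#
    -- One vector of `U′` is enough, the one with multiplier 1: once it lies in `U`, injectivity of
    -- `τ` makes the slopes proportional.
    infinite⇒ U′ U′⊆V = on-form (V∩Σ∞⊆U (U′⊆V _ (inPlane⇐ U′ (1# , λ i → cong₂ (λ x y → τ (K.0# , x , y) i)
        (sym (*-identityˡ a′)) (sym (*-identityˡ b′))))) (form-τ K.0# a′ b′))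
      where
      a′ = proj₁ (slope U′)
      b′ = proj₂ (slope U′)
      on-form : InPlane a₁ b₁ (τ (K.0# , a′ , b′)) → affineForm ∙₃ (0# , a′ , b′) ≡ 0#
      on-form (c , eq) = let c≡ = τ-injective eq in trans (affineForm-∙ 0# a′ b′)
        (trans (cong₂ (λ x y → b₁ * (0# * a₀ - embed k₀ * x) - a₁ * (0# * b₀ - embed k₀ * y))
            (cong (proj₁ ∘ proj₂) c≡) (cong (proj₂ ∘ proj₂) c≡))
          (solve 6 (λ a b c k x y → b :* (:0 :* x :- k :* (c :* a)) :- a :* (:0 :* y :- k :* (c :* b)) := :0)
            refl a₁ b₁ c (embed k₀) a₀ b₀))

    infinite⇐ : ∀ U′ → affineForm ∙₃ (0# , slope U′) ≡ 0# → ∀ v → v K.∈ proj₁ U′ → v K.∈ V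
    infinite⇐ U′ eq v v∈U′ = U⊆V v (inPlane⇐ U (scale (proportional-pair (slope≢0 U) (x-y≡0⇒x≡y
        (*-cancelˡ-0 (embed-≢0 k₀≢0) (trans
        (solve 7 (λ a b x y k c d → k :* (b :* x :- a :* y)
            := :- (b :* (:0 :* c :- k :* x) :- a :* (:0 :* d :- k :* y)))
          refl a₁ b₁ a′ b′ (embed k₀) a₀ b₀)
        (trans (cong -_ (trans (sym (affineForm-∙ 0# a′ b′)) eq)) -0#≈0#))))) (inPlane⇒ U′ v∈U′)))
      where
      a′ = proj₁ (slope U′)
      b′ = proj₂ (slope U′)
      scale : ∃[ c ] a′ ≡ c * a₁ × b′ ≡ c * b₁ → InPlane a′ b′ v → InPlane a₁ b₁ v
      scale (c , a′≡ , b′≡) (d , v≗) = d * c , λ i → trans (v≗ i) (cong₂ (λ x y → τ (K.0# , x , y) i)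
        (trans (cong (d *_) a′≡) (sym (*-assoc d c a₁))) (trans (cong (d *_) b′≡) (sym (*-assoc d c b₁))))

  affineLine-point : ∀ V → ¬ (∀ v → v K.∈ V → InΣ∞ Σ∞ v) → ∃[ j ] form K.∙ K.basis V j ≢ K.0#
  affineLine-point V V⊈Σ∞ = Fin.¬∀⟶∃¬ 4 (λ j → form K.∙ K.basis V j ≡ K.0#) (λ j → _ K.≟ K.0#)
    λ all → V⊈Σ∞ λ v (c , v≗) → trans (K.∙-cong form v≗) (trans (K.∙-lincomb form c (K.basis V))
      (K.sum-zero λ j → trans (cong (c j K.*_) (all j)) (K.zeroʳ (c j))))

  affineLineForm : ∀ V V⊈Σ∞ U U⊆V → LineForm (inj₁ (V , V⊈Σ∞ , U , U⊆V))
  affineLineForm V V⊈Σ∞ U U⊆V = from-point (affineLine-point V V⊈Σ∞)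
    where
    from-point : ∃[ j ] form K.∙ K.basis V j ≢ K.0# → LineForm (inj₁ (V , V⊈Σ∞ , U , U⊆V))
    from-point (j , P₀∉) = record
      { l     = affineForm V U U⊆V P₀ P₀∈V k₀ a₀ b₀ P₀≗ k₀≢0
      ; l≢0   = affineForm≢0 V U U⊆V P₀ P₀∈V k₀ a₀ b₀ P₀≗ k₀≢0
      ; image = λ where
          (inj₁ P) → mk⇔ (affine⇒ V U U⊆V P₀ P₀∈V k₀ a₀ b₀ P₀≗ k₀≢0 (τ-coordinate (K.coords (proj₁ P))))
                         (affine⇐ V U U⊆V P₀ P₀∈V k₀ a₀ b₀ P₀≗ k₀≢0 (τ-coordinate (K.coords (proj₁ P))))
          (inj₂ U′) → mk⇔ (infinite⇒ V U U⊆V P₀ P₀∈V k₀ a₀ b₀ P₀≗ k₀≢0 U′)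
                          (infinite⇐ V U U⊆V P₀ P₀∈V k₀ a₀ b₀ P₀≗ k₀≢0 U′)
      }
      where
      P₀ = K.basis V j
      P₀∈V = K.∈-basis (K.basis V) j
      k₀ = proj₁ (coordinate P₀)
      a₀ = proj₁ (proj₂ (coordinate P₀))
      b₀ = proj₂ (proj₂ (coordinate P₀))
      P₀≗ = τ-coordinate P₀
      k₀≢0 : k₀ ≢ K.0#
      k₀≢0 eq = P₀∉ (trans (sym (height≡ P₀≗)) eq)

  lineForm : ∀ m → LineForm m
  lineForm (inj₁ (V , V⊈Σ∞ , U , U⊆V)) = affineLineForm V V⊈Σ∞ U U⊆V
  lineForm (inj₂ tt) = lineAtInfinity

-- The curve

module Curves {K L : Field} {q : ℕ} (6≤q : 6 ≤ q) (K-order : HasOrder K q) (L-order : HasOrder L (q ℕ.^ 3))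
              (E : FieldExtension K L) (Σ∞ : Projective.Hyperplane K 6) (S : BruckBose.RegularSpread E q Σ∞) where
  private
    module K where
      open FieldFacts K public
      open FiniteField K K-order public
      open Projective K public
      open LinearAlgebra K public
  open FieldExtension E
  open FieldFacts L
  open FiniteField L L-order
  open Frobenius 6≤q K-order L-order E
  open Sequences L
  open Multipliers 6≤q K-order L-order E
  open Coordinates 6≤q K-order L-order E Σ∞ S
  open Triples L using (triple-≡)

  linear≗lincomb : ∀ {r m} (G : K.Vec r → K.Vec m) → (∀ {c d} → c ≗ d → G c ≗ G d) →
                   (∀ c d → G (c K.+ᵛ d) ≗ G c K.+ᵛ G d) → (∀ s c → G (s K.· c) ≗ s K.· G c) →
                   ∀ c → K.lincomb c (λ j → G (K.delta j)) ≗ G c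
  linear≗lincomb {zero} G G-cong G-+ G-· c i = sym (trans (G-cong {c} {K.0# K.· c} (λ ()) i)
      (trans (G-· K.0# c i) (K.zeroˡ _)))
  linear≗lincomb {suc r} G G-cong G-+ G-· c i = begin
    c zero K.* G (K.delta zero) i K.+ K.lincomb (c ∘ suc) (λ j → G (K.delta (suc j))) i
      ≡⟨ cong (c zero K.* G (K.delta zero) i K.+_) (trans
           (K.sum-cong-≗ {r} λ j → cong (c (suc j) K.*_) (G-cong {K.delta (suc j)} {K.0# ∷ K.delta j}
               (λ { zero → refl ; (suc _) → refl }) i))
           (linear≗lincomb (λ d → G (K.0# ∷ d))
             (λ c≗d → G-cong λ { zero → refl ; (suc j) → c≗d j })
             (λ c d i → trans (G-cong {K.0# ∷ (c K.+ᵛ d)} {(K.0# ∷ c) K.+ᵛ (K.0# ∷ d)}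
                 (λ { zero → sym (K.+-identityˡ K.0#) ; (suc j) → refl }) i) (G-+ _ _ i))
             (λ s c i → trans (G-cong {K.0# ∷ (s K.· c)} {s K.· (K.0# ∷ c)}
                 (λ { zero → sym (K.zeroʳ s) ; (suc j) → refl }) i) (G-· s _ i))
             (c ∘ suc) i)) ⟩
    c zero K.* G (K.delta zero) i K.+ G (K.0# ∷ (c ∘ suc)) i
      ≡⟨ cong (K._+ G (K.0# ∷ (c ∘ suc)) i) (sym (G-· (c zero) (K.delta zero) i)) ⟩
    G (c zero K.· K.delta zero) i K.+ G (K.0# ∷ (c ∘ suc)) i
      ≡⟨ sym (G-+ _ _ i) ⟩
    G ((c zero K.· K.delta zero) K.+ᵛ (K.0# ∷ (c ∘ suc))) i
      ≡⟨ G-cong {(c zero K.· K.delta zero) K.+ᵛ (K.0# ∷ (c ∘ suc))} {c}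
           (λ { zero → trans (K.+-identityʳ _) (K.*-identityʳ _) ; (suc j) → trans
               (cong (K._+ c (suc j)) (K.zeroʳ _)) (K.+-identityˡ _) }) i ⟩
    G c i ∎
    where open ≡-Reasoning

  sequence : ∀ {r} → K.Vec r → Sequence
  sequence c = extend (embed ∘ c)

  sequence-cong : ∀ {r} {c d : K.Vec r} → c ≗ d → sequence c ≗ sequence d
  sequence-cong {zero}  c≗d i       = refl
  sequence-cong {suc r} c≗d zero    = cong embed (c≗d zero)
  sequence-cong {suc r} c≗d (suc i) = sequence-cong {r} (c≗d ∘ suc) i

  sequence-+ : ∀ {r} (c d : K.Vec r) i → sequence (c K.+ᵛ d) i ≡ sequence c i + sequence d i
  sequence-+ {zero}  c d i       = sym (+-identityˡ 0#)
  sequence-+ {suc r} c d zero    = embed-+ _ _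
  sequence-+ {suc r} c d (suc i) = sequence-+ {r} (c ∘ suc) (d ∘ suc) i

  sequence-· : ∀ {r} s (c : K.Vec r) i → sequence (s K.· c) i ≡ embed s * sequence c i
  sequence-· {zero}  s c i       = sym (zeroʳ _)
  sequence-· {suc r} s c zero    = embed-* _ _
  sequence-· {suc r} s c (suc i) = sequence-· {r} s (c ∘ suc) i

  sequence-fixed : ∀ {r} (c : K.Vec r) → Fixed (sequence c)
  sequence-fixed {zero}  c i       = frob-0
  sequence-fixed {suc r} c zero    = frob-embed _
  sequence-fixed {suc r} c (suc i) = sequence-fixed {r} (c ∘ suc) i

  standard : ∀ k → Parameter → K.Vec (suc k)
  standard k (just θ) = λ i → θ K.^ toℕ i
  standard k nothing  = updateAt K.0ᵛ (fromℕ k) (const K.1#)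

  standardCurve : ∀ k t → K.StandardCurve k (standard k t)
  standardCurve k (just θ) = K.affine θ
  standardCurve k nothing  = K.infinity

  standardParameter : ∀ {k x} → K.StandardCurve k x → ∃[ t ] x ≡ standard k t
  standardParameter (K.affine θ) = just θ , refl
  standardParameter K.infinity   = nothing , refl

  sequence-standard : ∀ k t i → i ≤ k → sequence (standard k t) i ≡ veronese t k i
  sequence-standard k (just θ) i i≤k = trans (extend-toℕ {k} (λ i → embed (θ K.^ i)) i i≤k) (embed-^ θ i)
  sequence-standard k nothing  i i≤k = go k i i≤k
    where
    go : ∀ k i → i ≤ k → sequence (standard k nothing) i ≡ top k i
    go zero    zero    _         = embed-1
    go (suc k) zero    _         = embed-0
    go (suc k) (suc i) (s≤s i≤k) = go k i i≤k

  origin₀ : Coordinate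
  origin₀ = K.0# , 0# , 0#

  coordinate-≡ : ∀ {k k′ : K.Carrier} {a a′ b b′ : Carrier} → k ≡ k′ → a ≡ a′ → b ≡ b′ → (k , a , b) ≡ (k′ , a′ , b′)
  coordinate-≡ refl refl refl = refl

  τ-origin₀ : τ origin₀ ≗ K.0ᵛ
  τ-origin₀ i = trans (cong (λ c → τ c i) (coordinate-≡ (sym (K.zeroʳ K.0#)) (sym (zeroʳ (embed K.0#)))
      (sym (zeroʳ (embed K.0#)))))
    (trans (τ-⊙ K.0# origin₀ i) (K.zeroˡ _))

  module Curve (x₀ x₁ x₂ : Triple) (kernel : ∀ w → x₀ ∙₃ w ≡ 0# → x₁ ∙₃ w ≡ 0# → x₂ ∙₃ w ≡ 0# → w ≡ 0₃)
               (n : ℕ) (multiplier : Multiplier x₀ n) where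
    open Multiplier multiplier

    k : ℕ
    k = 2 ℕ.+ n

    -- The pairing of `c` with the product of the forms `x` and `u`. At a unit vector it is a
    -- coefficient of that product, at `standard k t` the value of the product at the parameter; so
    -- `generators` are the coefficient vectors of the curve.
    component : Triple → K.Vec (suc k) → Carrier
    component x c = u (x ▷₂ sequence c)

    component-cong : ∀ x {c d} → c ≗ d → component x c ≡ component x d
    component-cong x c≗d = u-cong (▷₂-linear x linear) (λ i _ → sequence-cong c≗d i)

    component-+ : ∀ x c d → component x (c K.+ᵛ d) ≡ component x c + component x d
    component-+ x c d = trans (u-cong (▷₂-linear x linear) (λ i _ → sequence-+ c d i))
      (u-+ (▷₂-linear x linear) (sequence c) (sequence d))

    component-· : ∀ x s c → component x (s K.· c) ≡ embed s * component x c
    component-· x s c = trans (u-cong (▷₂-linear x linear) (λ i _ → sequence-· s c i))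
      (u-* (▷₂-linear x linear) (embed s) (sequence c))

    component-standard : ∀ x t → component x (standard k t) ≡ x ∙₃ point t * u (veronese t n)
    component-standard x t = trans (u-cong (▷₂-linear x linear) (sequence-standard k t)) (evaluate₂ linear x t)

    opaque
      height : K.Vec (suc k) → K.Carrier
      height c = proj₁ (frob-fixed (rational (sequence-fixed c)))

      embed-height : ∀ c → embed (height c) ≡ component x₀ c
      embed-height c = proj₂ (frob-fixed (rational (sequence-fixed c)))

    lift : K.Vec (suc k) → Coordinate
    lift c = height c , component x₁ c , component x₂ c

    lift-cong : ∀ {c d} → c ≗ d → lift c ≡ lift d
    lift-cong {c} {d} c≗d = coordinate-≡
      (embed-injective (trans (embed-height c) (trans (component-cong x₀ c≗d) (sym (embed-height d)))))
      (component-cong x₁ c≗d) (component-cong x₂ c≗d)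

    lift-+ : ∀ c d → lift (c K.+ᵛ d) ≡ lift c ⊕ lift d
    lift-+ c d = coordinate-≡
      (embed-injective (trans (embed-height (c K.+ᵛ d)) (trans (component-+ x₀ c d)
        (sym (trans (embed-+ _ _) (cong₂ _+_ (embed-height c) (embed-height d)))))))
      (component-+ x₁ c d) (component-+ x₂ c d)

    lift-· : ∀ s c → lift (s K.· c) ≡ s ⊙ lift c
    lift-· s c = coordinate-≡
      (embed-injective (trans (embed-height (s K.· c)) (trans (component-· x₀ s c)
        (sym (trans (embed-* _ _) (cong (embed s *_) (embed-height c)))))))
      (component-· x₁ s c) (component-· x₂ s c)

    generators : Vector (K.Vec 7) (suc k)
    generators j = τ (lift (K.delta j))

    lincomb-generators : ∀ c → K.lincomb c generators ≗ τ (lift c)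
    lincomb-generators = linear≗lincomb (λ c → τ (lift c))
      (λ c≗d i → cong (λ c → τ c i) (lift-cong c≗d))
      (λ c d i → trans (cong (λ c → τ c i) (lift-+ c d)) (τ-⊕ (lift c) (lift d) i))
      (λ s c i → trans (cong (λ c → τ c i) (lift-· s c)) (τ-⊙ s (lift c) i))

    generators-independent : K.Independent generators
    generators-independent c eq j = embed-injective (begin
      embed (c j)              ≡⟨ extend-lookup (embed ∘ c) j ⟨
      sequence c (toℕ j)       ≡⟨ spanning (sequence-fixed c) all≡0 (toℕ j) (Fin.toℕ≤pred[n] j) ⟩
      0#                       ≡⟨ embed-0 ⟨
      embed K.0#               ∎)
      where
      open ≡-Reasoning
      lift≡0 : lift c ≡ origin₀
      lift≡0 = τ-injective (λ i → trans (sym (lincomb-generators c i)) (trans (eq i) (sym (τ-origin₀ i))))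
      -- The values of `u` on the three monomial shifts of the dependence. The coordinates of
      -- `lift c` are the products of the rows `xᵢ` with this triple, so invertibility of the rows
      -- makes it zero.
      w : Triple
      w = u (e₀ ▷₂ sequence c) , u (e₁ ▷₂ sequence c) , u (e₂ ▷₂ sequence c)
      w≡0 : w ≡ 0₃
      w≡0 = kernel w
        (trans (sym (linear-expand linear x₀ (sequence c))) (trans (sym (embed-height c)) (trans (cong embed
            (cong proj₁ lift≡0)) embed-0)))
        (trans (sym (linear-expand linear x₁ (sequence c))) (cong (proj₁ ∘ proj₂) lift≡0))
        (trans (sym (linear-expand linear x₂ (sequence c))) (cong (proj₂ ∘ proj₂) lift≡0))
      all≡0 : ∀ y → u (y ▷₂ sequence c) ≡ 0#
      all≡0 y = trans (linear-expand linear y (sequence c)) (trans (cong (y ∙₃_) w≡0)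
        (solve 3 (λ a b c → a :* :0 :+ b :* :0 :+ c :* :0 := :0) refl _ _ _))

    ambient : K.Space k 6
    ambient = record { basis = generators ; independent = generators-independent }

    curvePoint : Parameter → K.Vec 7
    curvePoint t = K.lincomb (standard k t) generators

    value : Parameter → Carrier
    value t = u (veronese t n)

    curvePoint≗ : ∀ t → curvePoint t ≗ τ (lift (standard k t))
    curvePoint≗ t = lincomb-generators (standard k t)

    height-standard : ∀ t → embed (height (standard k t)) ≡ x₀ ∙₃ point t * value t
    height-standard t = trans (embed-height (standard k t)) (component-standard x₀ t)

    -- Both coordinate triples are L-multiples of (x₀(t), x₁(t), x₂(t)), and both have a nonzero
    -- first coordinate in `K`. Their ratio is therefore in `K`, and the two vectors are the same
    -- point of PG(6, q).
    representative : ∀ t {v : K.Vec 7} {h a b c} → τ (h , a , b) ≗ v → h ≢ K.0# →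
                     embed h ≡ c * (x₀ ∙₃ point t) → a ≡ c * (x₁ ∙₃ point t) → b ≡ c * (x₂ ∙₃ point t) →
                     ∃[ κ ] κ ≢ K.0# × v ≗ κ K.· curvePoint t
    representative t {v} {h} {a} {b} {c} v≗ h≢0 h≡ a≡ b≡ = finish (K.inverse N N≢0)
      where
      open ≡-Reasoning
      X₀ = x₀ ∙₃ point t
      N = height (standard k t)
      X₀≢0 : X₀ ≢ 0#
      X₀≢0 eq = embed-≢0 h≢0 (trans h≡ (trans (cong (c *_) eq) (zeroʳ c)))
      N≢0 : N ≢ K.0#
      N≢0 eq = *-≢0 X₀≢0 (nonvanishing t X₀≢0) (trans (sym (height-standard t)) (trans (cong embed eq) embed-0))
      finish : ∃[ r ] r K.* N ≡ K.1# → ∃[ κ ] κ ≢ K.0# × v ≗ κ K.· curvePoint t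
      finish (r , rN≡1) = κ , κ≢0 , λ i → begin
        v i                                          ≡⟨ v≗ i ⟨
        τ (h , a , b) i                              ≡⟨ cong
            (λ c → τ c i) (coordinate-≡ h≡κN (part x₁ a≡) (part x₂ b≡)) ⟩
        τ (κ ⊙ lift (standard k t)) i                ≡⟨ τ-⊙ κ (lift (standard k t)) i ⟩
        κ K.* τ (lift (standard k t)) i              ≡⟨ cong (κ K.*_) (curvePoint≗ t i) ⟨
        κ K.* curvePoint t i                         ∎
        where
        κ = h K.* r
        κ≢0 : κ ≢ K.0#
        κ≢0 = K.*-≢0 h≢0 (K.inverse≢0 rN≡1)
        h≡κN : h ≡ κ K.* N
        h≡κN = sym (trans (K.*-assoc h r N) (trans (cong (h K.*_) rN≡1) (K.*-identityʳ h)))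
        κv≡c : embed κ * value t ≡ c
        κv≡c = *-cancelˡ X₀≢0 (begin
          X₀ * (embed κ * value t)    ≡⟨ solve 3 (λ x k v → x :* (k :* v) := k :* (x :* v))
              refl X₀ (embed κ) (value t) ⟩
          embed κ * (X₀ * value t)    ≡⟨ cong (embed κ *_) (height-standard t) ⟨
          embed κ * embed N           ≡⟨ embed-* κ N ⟨
          embed (κ K.* N)             ≡⟨ cong embed h≡κN ⟨
          embed h                     ≡⟨ h≡ ⟩
          c * X₀                      ≡⟨ *-comm c X₀ ⟩
          X₀ * c                      ∎)
        part : ∀ x {a} → a ≡ c * (x ∙₃ point t) → a ≡ embed κ * component x (standard k t)
        part x {a} a≡ = begin
          a                                           ≡⟨ a≡ ⟩
          c * (x ∙₃ point t)                          ≡⟨ cong (_* (x ∙₃ point t)) κv≡c ⟨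
          embed κ * value t * (x ∙₃ point t)          ≡⟨ solve 3 (λ k v x → k :* v :* x := k :* (x :* v))
              refl (embed κ) (value t) (x ∙₃ point t) ⟩
          embed κ * (x ∙₃ point t * value t)          ≡⟨ cong (embed κ *_) (component-standard x t) ⟨
          embed κ * component x (standard k t)        ∎

-- The conic and its curve in PG(6, q)

module ConicRepresentation
  {K L : Field} {q : ℕ} (6≤q : 6 ≤ q) (K-order : HasOrder K q) (L-order : HasOrder L (q ℕ.^ 3))
  (E : FieldExtension K L) (Σ∞ : Projective.Hyperplane K 6) (S : BruckBose.RegularSpread E q Σ∞)
  (φ : BruckBose.representation E q S ≅ Projective.PG L 2) (C : Pred (Projective.Point L 2) 0ℓ)
  (π : Subplane (Projective.PG L 2) q) (ψ : Projective.PG K 2 ≅ Subplane.plane π)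
  (A : Projective.QuadraticForm K 3) (nonDegenerate : Projective.NonDegenerate K A)
  (C⇔ : ∀ X → C X ⇔ (∃[ Y ] Projective.eval K A (Projective.coords Y) ≡ Field.0# K ×
                      Projective._∼_ L X (proj₁ (_≅_.onPoints ψ Y)))) where
  private
    module K where
      open FieldFacts K public
      open FiniteField K K-order public
      open Projective K public
      open LinearAlgebra K public
      open Triples K public
    module L = Projective L
    module R = IncidenceStructure (BruckBose.representation E q S)
    module PGL = IncidenceStructure (L.PG 2)
    module φ = _≅_ φ
    module ψ = _≅_ ψ
  open FieldFacts L
  open Frobenius 6≤q K-order L-order E
  open Triples L
  open Multipliers 6≤q K-order L-order E using (Parameter; point; classify)
  open Fundamental 6≤q K-order L-order E
  open Coordinates 6≤q K-order L-order E Σ∞ S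
  open Representation 6≤q K-order L-order E Σ∞ S
  open Curves 6≤q K-order L-order E Σ∞ S
  open Conics K K-order
  open BruckBose E q using (AffinePoint; Represents; InΣ∞)
  open FieldExtension E
  open K.Hyperplane Σ∞ using (form)

  Conclusion : Set₁
  Conclusion = ∃[ k ] (k ≡ 2 ⊎ k ≡ 3 ⊎ k ≡ 4 ⊎ k ≡ 6) ×
    Σ (Pred (K.Point 6) 0ℓ) λ N → K.IsNormalRationalCurve k N × Represents S φ C N

  NormalRationalCurve : ∀ {k} → K.Space k 6 → Pred (K.Point 6) 0ℓ
  NormalRationalCurve {k} U P = ∃[ x ] K.StandardCurve k x × (∃[ c ] c ≢ K.0# × K.coords P ≗ c K.· K.lincomb x (K.basis U))

  pull : L.Point 2 → R.Point
  pull = Inverse.from φ.pointMap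

  pullLine : L.Space 1 2 → R.Line
  pullLine = Inverse.from φ.lineMap

  push-pull : ∀ X → φ.onPoints (pull X) PGL.≈ₚ X
  push-pull X = Inverse.inverseˡ φ.pointMap (Setoid.refl R.points {pull X})

  pull-push : ∀ P → pull (φ.onPoints P) R.≈ₚ P
  pull-push P = Inverse.inverseʳ φ.pointMap (Setoid.refl PGL.points {φ.onPoints P})

  push-pullLine : ∀ m → φ.onLines (pullLine m) PGL.≈ₗ m
  push-pullLine m = Inverse.inverseˡ φ.lineMap (Setoid.refl R.lines {pullLine m})

  pull-incidence : ∀ X m → X PGL.I m ⇔ pull X R.I pullLine m
  pull-incidence X m = mk⇔
    (λ X∈m → Equivalence.from (φ.incidence (pull X) (pullLine m))
      (PGL.I-resp {X} {φ.onPoints (pull X)} {m} {φ.onLines (pullLine m)}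
        (Setoid.sym PGL.points {φ.onPoints (pull X)} {X} (push-pull X))
        (Setoid.sym PGL.lines {φ.onLines (pullLine m)} {m} (push-pullLine m)) X∈m))
    (λ P∈l → PGL.I-resp {φ.onPoints (pull X)} {X} {φ.onLines (pullLine m)} {m} (push-pull X) (push-pullLine m)
      (Equivalence.to (φ.incidence (pull X) (pullLine m)) P∈l))

  χ : K.Point 2 → R.Point
  χ Y = pull (proj₁ (ψ.onPoints Y))

  χ-line : K.Space 1 2 → R.Line
  χ-line l = pullLine (proj₁ (ψ.onLines l))

  χ-incidence : ∀ Y l → K.coords Y K.∈ l ⇔ χ Y R.I χ-line l
  χ-incidence Y l = mk⇔
    (λ Y∈l → Equivalence.to (pull-incidence _ _) (Equivalence.to (ψ.incidence Y l) Y∈l))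
    (λ P∈m → Equivalence.from (ψ.incidence Y l) (Equivalence.from (pull-incidence _ _) P∈m))

  -- Obtained from any point of PG(2,q³) on the image of the line at infinity.
  spreadPlane : ∃[ U ] BruckBose.RegularSpread.IsElement S U
  spreadPlane = at-infinity (pull X) (Equivalence.from (φ.incidence (pull X) (inj₂ tt))
      (PGL.I-resp {X} {φ.onPoints (pull X)} {m} {m} (Setoid.sym PGL.points {φ.onPoints (pull X)} {X} (push-pull X))
        (Setoid.refl PGL.lines {m}) (LinearAlgebra.∈-basis L (L.basis m) zero)))
    where
    m : L.Space 1 2
    m = φ.onLines (inj₂ tt)
    X : L.Point 2
    X = record { coords = L.basis m zero ; nonzero = λ eq → 1≢0 (L.independent m (1# ∷ 0# ∷ []) (λ i →
      trans (cong₂ (λ x y → 1# * x + (0# * y + 0#)) (eq i) refl)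
        (solve 1 (λ y → :1 :* :0 :+ (:0 :* y :+ :0) := :0) refl (L.basis m (suc zero) i))) zero) }
    at-infinity : ∀ P → P R.I inj₂ tt → ∃[ U ] BruckBose.RegularSpread.IsElement S U
    at-infinity (inj₁ P) ()
    at-infinity (inj₂ U) _ = U

  ConicHasPoint : Set
  ConicHasPoint = ∃[ z ] z ≢ K.0₃ × K.eval A (vec z) ≡ K.0#

  -- Chevalley's theorem excludes an empty conic; any conic inside Σ∞ represents it vacuously,
  -- which makes the theorem unnecessary here.
  empty-conic : ¬ ConicHasPoint → Conclusion
  empty-conic none = 2 , inj₁ refl , NormalRationalCurve U , (U , λ P → mk⇔ id id) , λ P → mk⇔
      (λ { (x , _ , c , _ , P≗) → ⊥-elim (proj₂ P (trans (K.∙-cong form P≗)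
          (trans (K.∙-· form c (K.lincomb x (K.basis U)))
        (trans (cong (c K.*_) (trans (K.∙-lincomb form x (K.basis U)) (K.sum-zero λ j →
          trans (cong (x j K.*_) (plane⊆Σ∞ j)) (K.zeroʳ (x j))))) (K.zeroʳ c))))) })
      (λ CP → ⊥-elim (no-point {φ.onPoints (inj₁ P)} (Equivalence.to (C⇔ (φ.onPoints (inj₁ P))) CP)))
    where
    U = proj₁ spreadPlane
    plane⊆Σ∞ : ∀ j → form K.∙ K.basis U j ≡ K.0#
    plane⊆Σ∞ j = proj₁ (Equivalence.to (proj₂ (proj₂ (proj₂ spreadPlane)) (K.basis U j)) (K.∈-basis (K.basis U) j))
    no-point : ∀ {X} → ¬ (∃[ Y ] K.eval A (K.coords Y) ≡ K.0# × X L.∼ proj₁ (ψ.onPoints Y))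
    no-point (Y , eq , _) = none (triple (K.coords Y) ,
      (λ z≡0 → K.nonzero Y λ i → trans (sym (vec-triple (K.coords Y) i)) (trans (cong
          (λ z → vec z i) z≡0) (vec-0 i))) ,
      trans (Q-cong A (vec-triple (K.coords Y))) eq)
      where
      vec-0 : vec K.0₃ ≗ K.0ᵛ
      vec-0 = λ { zero → refl ; (suc zero) → refl ; (suc (suc zero)) → refl }

  module Framed (frame : ConicFrame A nonDegenerate) where
    open ConicFrame frame

    M : K.Triple → K.Vec 3
    M = combination A m₀ m₁ m₂

    M-combination : ∀ a x b y → M (a K.·₃ x K.+₃ b K.·₃ y) ≗ a K.· M x K.+ᵛ b K.· M y
    M-combination a (x₀ , x₁ , x₂) b (y₀ , y₁ , y₂) i = K.solve 11
      (λ a x y z b u v w m n p → (a K.:* x K.:+ b K.:* u) K.:* m K.:+ (a K.:* y K.:+ b K.:* v) K.:* n K.:+ (a K.:* z K.:+ b K.:* w) K.:* p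
        K.:= a K.:* (x K.:* m K.:+ y K.:* n K.:+ z K.:* p) K.:+ b K.:* (u K.:* m K.:+ v K.:* n K.:+ w K.:* p)) refl
      a x₀ x₁ x₂ b y₀ y₁ y₂ (m₀ i) (m₁ i) (m₂ i)

    M-0 : M K.0₃ ≗ K.0ᵛ
    M-0 i = K.solve 3 (λ x y z → K.:0 K.:* x K.:+ K.:0 K.:* y K.:+ K.:0 K.:* z K.:= K.:0) refl
      (m₀ i) (m₁ i) (m₂ i)

    M-nonzero : ∀ {z} → z ≢ K.0₃ → ¬ (M z ≗ K.0ᵛ)
    M-nonzero z≢0 eq = z≢0 (faithful (λ i → trans (eq i) (sym (M-0 i))))

    planePoint : ∀ z → z ≢ K.0₃ → K.Point 2
    planePoint z z≢0 = record { coords = M z ; nonzero = M-nonzero z≢0 }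

    f-at : ∀ z → Dec (z ≡ K.0₃) → Triple
    f-at z (yes _)  = 0₃
    f-at z (no z≢0) = homogeneous (χ (planePoint z z≢0))

    f : K.Triple → Triple
    f z = f-at z (z ≟₃ K.0₃)

    -- The point carries the proof of nonvanishing that the decision inside `f` happens to return,
    -- hence the existential over such proofs.
    f≡ : ∀ z → z ≢ K.0₃ → ∃[ z≢0 ] f z ≡ homogeneous (χ (planePoint z z≢0))
    f≡ z z≢0 = go (z ≟₃ K.0₃)
      where
      go : (z≟0 : Dec (z ≡ K.0₃)) → ∃[ z≢0 ] f-at z z≟0 ≡ homogeneous (χ (planePoint z z≢0))
      go (yes z≡0) = contradiction z≡0 z≢0
      go (no z≢0)  = z≢0 , refl

    f-lines : PreservesLines f
    f-lines x y independent = record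
      { l     = LineForm.l F
      ; l≢0   = LineForm.l≢0 F
      ; image = λ z z≢0 → let z≢0′ , eq = f≡ z z≢0 in mk⇔
          (λ z∈ → trans (cong (LineForm.l F ∙₃_) eq) (Equivalence.to (LineForm.image F _)
            (Equivalence.to (χ-incidence (planePoint z z≢0′) line) (⇒line z∈))))
          (λ l∙f≡0 → line⇒ (Equivalence.from (χ-incidence (planePoint z z≢0′) line)
            (Equivalence.from (LineForm.image F _) (trans (cong (LineForm.l F ∙₃_) (sym eq)) l∙f≡0))))
      }
      where
      b : Vector (K.Vec 3) 2
      b = M x ∷ M y ∷ []
      lincomb-b : ∀ c → K.lincomb c b ≗ M (c zero K.·₃ x K.+₃ c (suc zero) K.·₃ y)
      lincomb-b c i = trans (cong (c zero K.* M x i K.+_) (K.+-identityʳ _))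
          (sym (M-combination (c zero) x (c (suc zero)) y i))
      line : K.Space 1 2
      line = record
        { basis       = b
        ; independent = λ c eq →
            let c₀≡0 , c₁≡0 = independent (c zero) (c (suc zero)) (faithful (λ i → trans (sym (lincomb-b c i)) (trans (eq i) (sym (M-0 i)))))
            in λ { zero → c₀≡0 ; (suc zero) → c₁≡0 }
        }
      F : LineForm (χ-line line)
      F = lineForm (χ-line line)
      ⇒line : ∀ {z} → K.OnLine x y z → M z K.∈ line
      ⇒line (s , t , refl) = (s ∷ t ∷ []) , λ i → sym (lincomb-b (s ∷ t ∷ []) i)
      line⇒ : ∀ {z} → M z K.∈ line → K.OnLine x y z
      line⇒ (c , eq) = c zero , c (suc zero) , faithful (λ i → trans (eq i) (lincomb-b c i))

    module Parametrised (coordinatised : Coordinatised f) (n : ℕ)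
                        (multiplier : Multipliers.Multiplier 6≤q K-order L-order E (Coordinatised.x₀ coordinatised) n) where
      open Coordinatised coordinatised
      open Curve x₀ x₁ x₂ kernel n multiplier

      conicPoint≢0 : ∀ s → conicPoint s ≢ K.0₃
      conicPoint≢0 (just θ) = affine≢0
      conicPoint≢0 nothing  = e₂≢0

      Y : Parameter → K.Point 2
      Y s = planePoint (conicPoint s) (proj₁ (f≡ (conicPoint s) (conicPoint≢0 s)))

      Y-zero : ∀ s → K.eval A (K.coords (Y s)) ≡ K.0#
      Y-zero (just θ) = zero⇐ K.1# θ (θ K.* θ) (sym (K.*-identityˡ _))
      Y-zero nothing  = zero⇐ K.0# K.0# K.1# (trans (K.zeroˡ K.0#) (sym (K.zeroˡ K.1#)))

      homogeneous-Y : ∀ s → (let t = reparametrise s) → ∃[ c ] c ≢ 0# ×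
                      homogeneous (χ (Y s)) ≡ c ·₃ (x₀ ∙₃ point t , x₁ ∙₃ point t , x₂ ∙₃ point t)
      homogeneous-Y s = let c , c≢0 , eq = parametrised s in
        c , c≢0 , trans (sym (proj₂ (f≡ (conicPoint s) (conicPoint≢0 s)))) eq

      affine-Y : ∀ s P → χ (Y s) ≡ inj₁ P →
                 ∃[ κ ] κ ≢ K.0# × K.coords (proj₁ P) ≗ κ K.· curvePoint (reparametrise s)
      affine-Y s P eq = let c , _ , hom = homogeneous-Y s
                            hom′ = trans (cong homogeneous (sym eq)) hom
        in representative (reparametrise s) {c = c} (τ-coordinate (K.coords (proj₁ P))) (affine-height≢0 P)
             (cong proj₁ hom′) (cong (proj₁ ∘ proj₂) hom′) (cong (proj₂ ∘ proj₂) hom′)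

      -- In the frame the equation is b² = a c: a zero with a = 0 is a multiple of the third vertex,
      -- any other has parameter b / a.
      conic-zero : ∀ Z → K.eval A (K.coords Z) ≡ K.0# → ∃[ s ] Z K.∼ Y s
      conic-zero Z eq = from-frame (surjective (K.coords Z))
        where
        from-frame : ∃[ z ] M z ≗ K.coords Z → ∃[ s ] Z K.∼ Y s
        from-frame ((a , b , c) , M≗) = split (a K.≟ K.0#)
          where
          b²≡ac : b K.* b ≡ a K.* c
          b²≡ac = zero⇒ a b c (trans (Q-cong A M≗) eq)
          multiple : ∀ s ν → (a , b , c) ≡ ν K.·₃ conicPoint s → Z K.∼ Y s
          multiple s ν z≡ = ν , (λ ν≡0 → K.nonzero Z λ i → trans (scaled i) (trans
              (cong (K._* M (conicPoint s) i) ν≡0) (K.zeroˡ _))) , scaled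
            where
            scaled : K.coords Z ≗ ν K.· M (conicPoint s)
            scaled i = trans (sym (M≗ i)) (trans (cong (λ z → M z i) z≡) (M-scale ν (conicPoint s) i))
              where
              M-scale : ∀ ν z → M (ν K.·₃ z) ≗ ν K.· M z
              M-scale ν (a , b , c) i = K.solve 7
                  (λ ν a b c x y z → ν K.:* a K.:* x K.:+ ν K.:* b K.:* y K.:+ ν K.:* c K.:* z
                K.:= ν K.:* (a K.:* x K.:+ b K.:* y K.:+ c K.:* z)) refl ν a b c (m₀ i) (m₁ i) (m₂ i)
          split : Dec (a ≡ K.0#) → ∃[ s ] Z K.∼ Y s
          split (yes a≡0) = nothing , multiple nothing c (K.triple-≡ (trans a≡0 (sym (K.zeroʳ c)))
              (trans b≡0 (sym (K.zeroʳ c))) (sym (K.*-identityʳ c)))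
            where
            b≡0 : b ≡ K.0#
            b≡0 = Dec.decidable-stable (b K.≟ K.0#) λ b≢0 →
              K.*-≢0 b≢0 b≢0 (trans b²≡ac (trans (cong (K._* c) a≡0) (K.zeroˡ c)))
          split (no a≢0) = let r , ra≡1 = K.inverse a a≢0 in just (r K.* b) , multiple (just (r K.* b)) a
            (K.triple-≡ (sym (K.*-identityʳ a))
              (sym (trans (K.solve 3 (λ a r b → a K.:* (r K.:* b) K.:= r K.:* a K.:* b) refl a r b) (trans
                  (cong (K._* b) ra≡1) (K.*-identityˡ b))))
              (sym (trans (K.solve 3 (λ a r b → a K.:* (r K.:* b K.:* (r K.:* b))
                  K.:= r K.:* a K.:* r K.:* (b K.:* b)) refl a r b)
                (trans (cong (r K.* a K.* r K.*_) b²≡ac) (trans (K.solve 3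
                    (λ a r c → r K.:* a K.:* r K.:* (a K.:* c) K.:= r K.:* a K.:* (r K.:* a) K.:* c) refl a r c)
                  (trans (cong (λ z → z K.* z K.* c) ra≡1) (K.solve 1 (λ c → K.:1 K.:* K.:1 K.:* c K.:= c)
                      refl c)))))))

      χ-cong : ∀ {Z Z′} → Z K.∼ Z′ → χ Z R.≈ₚ χ Z′
      χ-cong {Z} {Z′} Z∼Z′ = Inverse.from-cong φ.pointMap {proj₁ (ψ.onPoints Z)} {proj₁ (ψ.onPoints Z′)}
        (Inverse.to-cong ψ.pointMap {Z} {Z′} Z∼Z′)

      represented : ∀ (P : AffinePoint S) s → inj₁ P R.≈ₚ χ (Y s) → NormalRationalCurve ambient (proj₁ P)
      represented P s P≈ = go (χ (Y s)) refl P≈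
        where
        go : ∀ P′ → χ (Y s) ≡ P′ → inj₁ P R.≈ₚ P′ → NormalRationalCurve ambient (proj₁ P)
        go (inj₁ P′) eq (inj₁ (d , d≢0 , P≗)) = let κ , κ≢0 , P′≗ = affine-Y s P′ eq in
          standard k (reparametrise s) , standardCurve k (reparametrise s) , d K.* κ , K.*-≢0 d≢0 κ≢0 ,
          λ i → trans (P≗ i) (trans (cong (d K.*_) (P′≗ i)) (sym (K.*-assoc d κ _)))

      -- Surjectivity of `reparametrise` enters here: every parameter of the curve has to come from
      -- a point of the conic.
      curve⇒conic : ∀ P → NormalRationalCurve ambient (proj₁ P) → C (φ.onPoints (inj₁ P))
      curve⇒conic P (x , x∈ , c , c≢0 , P≗) = from-parameter (standardParameter x∈)
        where
        from-parameter : ∃[ t ] x ≡ standard k t → C (φ.onPoints (inj₁ P))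
        from-parameter (t , refl) = from-conic (reparametrise-surjective t)
          where
          from-conic : ∃[ s ] reparametrise s ≡ t → C (φ.onPoints (inj₁ P))
          from-conic (s , refl) = Equivalence.from (C⇔ (φ.onPoints (inj₁ P))) (Y s , Y-zero s ,
              Setoid.trans PGL.points {φ.onPoints (inj₁ P)} {φ.onPoints (χ (Y s))} {proj₁ (ψ.onPoints (Y s))}
                (Inverse.to-cong φ.pointMap {inj₁ P} {χ (Y s)} (same (χ (Y s)) refl)) (push-pull (proj₁ (ψ.onPoints (Y s)))))
            where
            X₀ = x₀ ∙₃ point (reparametrise s)
            -- A parameter with x₀ = 0 gives a curve point of height 0, in the hyperplane, and a
            -- conic point on the line at infinity. As `P` is affine, both are excluded.
            X₀≢0 : X₀ ≢ 0#
            X₀≢0 eq = proj₂ P (begin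
              form K.∙ K.coords (proj₁ P)                 ≡⟨ K.∙-cong form P≗ ⟩
              form K.∙ (c K.· curvePoint t)               ≡⟨ K.∙-· form c (curvePoint t) ⟩
              c K.* (form K.∙ curvePoint t)               ≡⟨ cong (c K.*_) (sym (height≡
                  (λ i → sym (curvePoint≗ t i)))) ⟩
              c K.* height (standard k t)                 ≡⟨ cong (c K.*_) (embed-injective
                  (trans (height-standard t)
                                                               (trans (cong (_* value t) eq) (trans (zeroˡ _) (sym embed-0))))) ⟩
              c K.* K.0#                                  ≡⟨ K.zeroʳ c ⟩
              K.0#                                        ∎)
              where open ≡-Reasoning
            same : ∀ P′ → χ (Y s) ≡ P′ → inj₁ P R.≈ₚ P′
            same (inj₂ U) eq = let d , d≢0 , hom = homogeneous-Y s in
              contradiction (sym (cong proj₁ (trans (cong homogeneous (sym eq)) hom))) (*-≢0 d≢0 X₀≢0)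
            same (inj₁ P′) eq = let κ , κ≢0 , P′≗ = affine-Y s P′ eq
                                    r , rκ≡1 = K.inverse κ κ≢0
              in inj₁ (c K.* r , K.*-≢0 c≢0 (K.inverse≢0 rκ≡1) , λ i → trans (P≗ i) (sym (trans
                  (cong (c K.* r K.*_) (P′≗ i))
                   (trans (K.solve 4 (λ c r κ x → c K.:* r K.:* (κ K.:* x) K.:= c K.:* (r K.:* κ K.:* x))
                       refl c r κ (curvePoint t i))
                     (cong (c K.*_) (trans (cong (K._* curvePoint t i) rκ≡1) (K.*-identityˡ _)))))))

      conic⇒curve : ∀ P → C (φ.onPoints (inj₁ P)) → NormalRationalCurve ambient (proj₁ P)
      conic⇒curve P CP = let Z , Z-zero , φP∼ψZ = Equivalence.to (C⇔ (φ.onPoints (inj₁ P))) CP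
                             s , Z∼Y = conic-zero Z Z-zero
        in represented P s (Setoid.trans R.points {inj₁ P} {χ Z} {χ (Y s)}
             (Setoid.trans R.points {inj₁ P} {pull (φ.onPoints (inj₁ P))} {χ Z}
               (Setoid.sym R.points {pull (φ.onPoints (inj₁ P))} {inj₁ P} (pull-push (inj₁ P)))
               (Inverse.from-cong φ.pointMap {φ.onPoints (inj₁ P)} {proj₁ (ψ.onPoints Z)} φP∼ψZ))
             (χ-cong {Z} {Y s} Z∼Y))

      conclusion : (n ≡ 0 ⊎ n ≡ 1 ⊎ n ≡ 2 ⊎ n ≡ 4) → Conclusion
      conclusion n≡ = k , dimension n≡ , NormalRationalCurve ambient , (ambient , λ P → mk⇔ id id) ,
          λ P → mk⇔ (curve⇒conic P) (conic⇒curve P)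
        where
        dimension : ∀ {n} → (n ≡ 0 ⊎ n ≡ 1 ⊎ n ≡ 2 ⊎ n ≡ 4) → (let k = 2 ℕ.+ n in k ≡ 2 ⊎ k ≡ 3 ⊎ k ≡ 4 ⊎ k ≡ 6)
        dimension (inj₁ refl)                 = inj₁ refl
        dimension (inj₂ (inj₁ refl))          = inj₂ (inj₁ refl)
        dimension (inj₂ (inj₂ (inj₁ refl)))   = inj₂ (inj₂ (inj₁ refl))
        dimension (inj₂ (inj₂ (inj₂ refl)))   = inj₂ (inj₂ (inj₂ refl))

    framed : Conclusion
    framed = let open Coordinatised coordinates
                 n , n≡ , multiplier = classify x₀ x₀≢0
             in Parametrised.conclusion coordinates n multiplier n≡
      where
      coordinates : Coordinatised f
      coordinates = coordinatise f f-lines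
      x₀≢0 : Coordinatised.x₀ coordinates ≢ 0₃
      x₀≢0 eq = let w , x₀∙w≡1 = Coordinatised.x₀-value coordinates in
        1≢0 (trans (sym x₀∙w≡1) (trans (cong (_∙₃ w) eq)
          (solve 3 (λ a b c → :0 :* a :+ :0 :* b :+ :0 :* c := :0) refl _ _ _)))

  conclusion : Conclusion
  conclusion = decide (finite-any? (K.Triple-order K-order) λ z → Dec.¬? (z ≟₃ K.0₃) Dec.×-dec (K.eval A (vec z) K.≟ K.0#))
    where
    decide : Dec ConicHasPoint → Conclusion
    decide (no none) = empty-conic none
    decide (yes (z , z≢0 , Q≡0)) = Framed.framed (conicFrame A nonDegenerate (vec z) Q≡0
      (λ eq → z≢0 (K.triple-≡ (eq zero) (eq (suc zero)) (eq (suc (suc zero))))))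

open import Data.Nat.Base using (_^_)

corollary4p7 : (q : ℕ) → PrimePower q → 6 ≤ q →
    (K L : Field) → HasOrder K q → HasOrder L (q ^ 3) →
    (E : FieldExtension K L) →
    (Σ∞ : Projective.Hyperplane K 6) →
    (S : BruckBose.RegularSpread E q Σ∞) →
    (φ : BruckBose.representation E q S ≅ Projective.PG L 2) →
    (C : Pred (Projective.Point L 2) 0ℓ) → IsFqConic K L q C →
    ∃[ k ] (k ≡ 2 ⊎ k ≡ 3 ⊎ k ≡ 4 ⊎ k ≡ 6) ×
    Σ (Pred (Projective.Point K 6) 0ℓ) λ N →
    Projective.IsNormalRationalCurve K k N × BruckBose.Represents E q S φ C N
corollary4p7 q _ 6≤q K L K-order L-order E Σ∞ S φ C (π , ψ , A , nonDegenerate , C⇔) =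
  ConicRepresentation.conclusion 6≤q K-order L-order E Σ∞ S φ C π ψ A nonDegenerate C⇔
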